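{- Let $S(x)=\sum_{n\ge0}S_{n+1}\frac{x^n}{n!}$, $S^\circ(x)=\sum_{n\ge0}S_{n+1}^\circ\frac{x^n}{n!}$, $\Pi(x)=1+\sum_{n\ge1}\pi_n\frac{x^n}{n!}$ and $\Pi^\circ(x)=1-\sum_{n\ge1}\pi_n^\circ\frac{x^n}{n!}$ in $\mathfrak P\otimes\mathbb Q[[x]]$. Then $$S^\circ(x)=e^{ -x}\,\Pi^\circ(x)\,S(x)=e^{ -x}\,\Pi(x)^{ -1}S(x).$$
   Context: $\mathfrak P$ is the commutative ring freely generated as an abelian group by combinatorial equivalence classes of convex polytopes, with multiplication the Cartesian product; the point is the unit $1$. For a polytope $Q$, let $\mathcal F(Q)$ be the set of nonempty faces of $Q$ (including $Q$), regarded as elements of $\mathfrak P$, and define the motivic interior $Q^\circ=\sum_{f\in\mathcal F(Q)}(-1)^{\operatorname{codim} f}f$. For a connected simple graph $\Gamma$ on $[n]$, the graph-associahedron is $P_\Gamma=\{x\in\mathbb R^n:\sum_i x_i=3^n,\ \sum_{i\in S}x_i\ge3^{|S|}\text{ for all proper nonempty }S\subset[n]\text{ with }\Gamma|_S\text{ connected}\}$. The stellohedron $S_n$ is $P_\Gamma$ for $\Gamma$ the star graph with $n$ vertices (one central vertex joined to $n-1$ leaves), an $(n-1)$-dimensional polytope ($S_1$ a point). The permutohedron $\pi_n$ is $P_\Gamma$ for $\Gamma$ the complete graph on $n$ vertices, i.e. the convex hull of the permutations of $(1,\dots,n)$. $S_n^\circ,\pi_n^\circ$ are the motivic interiors. 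-}

module Defs where

open import Data.Bool using (Bool; true; false; _∧_; _∨_; not; if_then_else_)
open import Data.Nat as ℕ using (ℕ; zero; suc; _∸_; _⊔_)
open import Data.Nat.Combinatorics using (_C_)
open import Data.Fin as Fin using (Fin)
open import Data.Vec as Vec using (Vec; []; _∷_; tabulate)
open import Data.List as List using (List; []; _∷_; map; length; lookup; filterᵇ; concat; concatMap; upTo; allFin; foldr; cartesianProduct; zipWith; _++_)
open import Data.Bool.ListAction using (and; any; all)
open import Data.List.Membership.Propositional using (_∈_)
open import Data.List.Relation.Unary.All using (All)
open import Data.List.Relation.Unary.Unique.Propositional using (Unique)
open import Data.Integer as ℤ using (ℤ; +_)
open import Data.Rational as ℚ using (ℚ; 0ℚ)
open import Data.Rational.Properties as ℚP using ()
open import Data.Product using (Σ; _×_; _,_; proj₁)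
open import Data.Unit using (⊤; tt)
open import Function.Bundles using (_↔_; Inverse)
open import Relation.Nullary.Decidable using (⌊_⌋)
open import Relation.Binary.PropositionalEquality using (_≡_)

-- Finite posets (used for the poset of NONEMPTY faces of a polytope).
-- The element set is the list `elems` (in all our constructions its
-- entries are pairwise distinct).

record FinPoset : Set₁ where
  field
    Carrier : Set
    elems   : List Carrier
    _≼_     : Carrier → Carrier → Bool

open FinPoset public

-- combinatorial equivalence = isomorphism of face posets
_≅_ : FinPoset → FinPoset → Set
X ≅ Y = Σ (Fin (length (elems X)) ↔ Fin (length (elems Y))) λ e →
  ∀ i j → _≼_ X (lookup (elems X) i) (lookup (elems X) j)
        ≡ _≼_ Y (lookup (elems Y) (Inverse.to e i)) (lookup (elems Y) (Inverse.to e j))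

pointP : FinPoset
pointP = record { Carrier = ⊤ ; elems = tt ∷ [] ; _≼_ = λ _ _ → true }

-- Cartesian product of polytopes: nonempty faces are pairs of nonempty faces
_×P_ : FinPoset → FinPoset → FinPoset
X ×P Y = record
  { Carrier = Carrier X × Carrier Y
  ; elems   = cartesianProduct (elems X) (elems Y)
  ; _≼_     = λ { (a , b) (c , d) → _≼_ X a c ∧ _≼_ Y b d } }

-- the face f of X, regarded as a polytope (its nonempty faces: those ≤ f)
faceP : (X : FinPoset) → Carrier X → FinPoset
faceP X f = record
  { Carrier = Carrier X
  ; elems   = filterᵇ (λ g → _≼_ X g f) (elems X)
  ; _≼_     = _≼_ X }

maxList : List ℕ → ℕ
maxList = foldr _⊔_ 0

heightF : (X : FinPoset) → ℕ → Carrier X → ℕ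
heightF X zero    f = 0
heightF X (suc k) f = maxList (map (λ g → suc (heightF X k g))
  (filterᵇ (λ g → _≼_ X g f ∧ not (_≼_ X f g)) (elems X)))

height : (X : FinPoset) → Carrier X → ℕ
height X = heightF X (length (elems X))

dimP : FinPoset → ℕ
dimP X = maxList (map (height X) (elems X))

codim : (X : FinPoset) → Carrier X → ℕ
codim X f = dimP X ∸ height X f

sgn : ℕ → ℤ
sgn zero    = ℤ.1ℤ
sgn (suc k) = ℤ.- sgn k

-- The ring 𝔓: formal ℤ-combinations of polytopes; two combinations are
-- equal in 𝔓 iff every ℤ-valued invariant of combinatorial type takes
-- the same value on them (this is equality in the free abelian group on
-- combinatorial equivalence classes).

Comb : Set₁
Comb = List (ℤ × FinPoset)

oneC : Comb
oneC = (ℤ.1ℤ , pointP) ∷ []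

zeroC : Comb
zeroC = []

single : FinPoset → Comb
single X = (ℤ.1ℤ , X) ∷ []

scale : ℤ → Comb → Comb
scale c = map (λ { (d , X) → (c ℤ.* d , X) })

_⊗_ : Comb → Comb → Comb
L ⊗ M = concatMap (λ { (c , X) → map (λ { (d , Y) → (c ℤ.* d , X ×P Y) }) M }) L

sumC : List Comb → Comb
sumC = concat

Invariant : (FinPoset → ℤ) → Set₁
Invariant φ = ∀ X Y → X ≅ Y → φ X ≡ φ Y

evalC : (FinPoset → ℤ) → Comb → ℤ
evalC φ = foldr (λ { (c , X) r → c ℤ.* φ X ℤ.+ r }) (+ 0)

_≈𝔓_ : Comb → Comb → Set₁
L ≈𝔓 M = ∀ φ → Invariant φ → evalC φ L ≡ evalC φ M

interior : FinPoset → Comb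
interior X = map (λ f → (sgn (codim X f) , faceP X f)) (elems X)

Graph : ℕ → Set
Graph n = Fin n → Fin n → Bool

_==F_ : ∀ {n} → Fin n → Fin n → Bool
i ==F j = ⌊ i Fin.≟ j ⌋

star : (n : ℕ) → Graph n
star zero    i j = false
star (suc m) i j = not (i ==F j) ∧ (i ==F Fin.zero ∨ j ==F Fin.zero)

complete : (n : ℕ) → Graph n
complete n i j = not (i ==F j)

SubsetB : ℕ → Set
SubsetB n = Vec Bool n

subsets : (n : ℕ) → List (SubsetB n)
subsets zero    = [] ∷ []
subsets (suc n) = map (true ∷_) (subsets n) ++ map (false ∷_) (subsets n)

memb : ∀ {n} → SubsetB n → Fin n → Bool
memb S i = Vec.lookup S i

card : ∀ {n} → SubsetB n → ℕ
card []          = 0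
card (true ∷ S)  = suc (card S)
card (false ∷ S) = card S

stepR : ∀ {n} → Graph n → SubsetB n → SubsetB n → SubsetB n
stepR {n} Γ S R = tabulate λ j →
  memb R j ∨ (memb S j ∧ any (λ i → memb R i ∧ Γ i j) (allFin n))

iterR : ∀ {n} → ℕ → Graph n → SubsetB n → SubsetB n → SubsetB n
iterR zero    Γ S R = R
iterR (suc k) Γ S R = iterR k Γ S (stepR Γ S R)

singletonB : ∀ {n} → Fin n → SubsetB n
singletonB i = tabulate (λ j → i ==F j)

connectedB : ∀ {n} → Graph n → SubsetB n → Bool
connectedB {n} Γ S =
  any (memb S) (allFin n) ∧
  all (λ i → not (memb S i) ∨
        all (λ j → not (memb S j) ∨ memb (iterR n Γ S (singletonB i)) j) (allFin n))
      (allFin n)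

constraints : (n : ℕ) → Graph n → List (SubsetB n)
constraints n Γ = filterᵇ (λ S → connectedB Γ S ∧ not (card S ℕ.≡ᵇ n)) (subsets n)

ℕtoℚ : ℕ → ℚ
ℕtoℚ k = (+ k) ℚ./ 1

sumOver : ∀ {n} → SubsetB n → (Fin n → ℚ) → ℚ
sumOver {n} S x = foldr ℚ._+_ 0ℚ (map (λ i → if memb S i then x i else 0ℚ) (allFin n))

fullB : (n : ℕ) → SubsetB n
fullB n = Vec.replicate n true

InP : (n : ℕ) → Graph n → (Fin n → ℚ) → Set
InP n Γ x = (sumOver (fullB n) x ≡ ℕtoℚ (3 ℕ.^ n))
  × All (λ S → ℕtoℚ (3 ℕ.^ card S) ℚ.≤ sumOver S x) (constraints n Γ)

tight : (n : ℕ) → Graph n → (Fin n → ℚ) → List Bool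
tight n Γ x = map (λ S → ⌊ sumOver S x ℚP.≟ ℕtoℚ (3 ℕ.^ card S) ⌋) (constraints n Γ)

-- The nonempty faces of P_Γ are in bijection with the tight-sets
-- {tight x : x ∈ P_Γ}; face g ⊆ face f iff tight(f) ⊆ tight(g).
IsFaceTightSet : (n : ℕ) → Graph n → List Bool → Set
IsFaceTightSet n Γ T = Σ (Fin n → ℚ) λ x → InP n Γ x × (tight n Γ x ≡ T)

FaceEnum : (n : ℕ) → Graph n → Set
FaceEnum n Γ = Σ (List (List Bool)) λ L → Unique L ×
  ((∀ T → IsFaceTightSet n Γ T → T ∈ L) × (∀ T → T ∈ L → IsFaceTightSet n Γ T))

subB : List Bool → List Bool → Bool
subB f g = and (zipWith (λ a b → not a ∨ b) f g)

assocP : (n : ℕ) → (Γ : Graph n) → FaceEnum n Γ → FinPoset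
assocP n Γ E = record
  { Carrier = List Bool ; elems = proj₁ E ; _≼_ = λ g f → subB f g }

module Series (eS : ∀ m → FaceEnum (suc m) (star (suc m)))
              (eπ : ∀ m → FaceEnum (suc m) (complete (suc m))) where

  Stel : ℕ → FinPoset
  Stel m = assocP (suc m) (star (suc m)) (eS m)

  Perm : ℕ → FinPoset
  Perm m = assocP (suc m) (complete (suc m)) (eπ m)

  -- coefficient of x^m/m! in S(x), S°(x), Π(x), Π°(x)
  Sc : ℕ → Comb
  Sc m = single (Stel m)

  Soc : ℕ → Comb
  Soc m = interior (Stel m)

  Πc : ℕ → Comb
  Πc zero    = oneC
  Πc (suc k) = single (Perm k)

  Πoc : ℕ → Comb
  Πoc zero    = oneC
  Πoc (suc k) = scale (ℤ.- ℤ.1ℤ) (interior (Perm k))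

  -- coefficient of x^n/n! in e^{-x} Π°(x) S(x)
  rhs1 : ℕ → Comb
  rhs1 n = sumC (map (λ a → scale (sgn a ℤ.* (+ (n C a)))
             (sumC (map (λ b → scale (+ ((n ∸ a) C b)) (Πoc b ⊗ Sc (n ∸ a ∸ b)))
                        (upTo (suc (n ∸ a))))))
           (upTo (suc n)))

  -- coefficient of x^n/n! in Π°(x) Π(x)
  prod2 : ℕ → Comb
  prod2 n = sumC (map (λ b → scale (+ (n C b)) (Πoc b ⊗ Πc (n ∸ b))) (upTo (suc n)))

  unitc : ℕ → Comb
  unitc zero    = oneC
  unitc (suc n) = zeroC

{-# OPTIONS --safe #-}

-- In both the star and the complete graph there is a set of hubs such that distinct vertices are adjacent
-- iff one of them is a hub (the centre, respectively every vertex).  A face of P_Γ is a tubing, recorded as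
-- the preorder "every tube containing j contains i".  The smallest tube T₁ containing a hub splits the
-- vertices into the singleton tubes low inside T₁, the rest mid of T₁ and the complement top of T₁, and the
-- face is the product of P_Γ on mid with a face of the permutohedron on top; its codimension is |low| plus
-- the number of blocks on top.  Grouping the faces of the stellohedron by this splitting gives
-- S° = e^{-x} Π° S, the three sizes producing the multinomial coefficients.  For the complete graph low is
-- empty, and grouping the faces of π_n expresses the term π_n° of Π° Π through all the other terms, which
-- it therefore cancels.

module Submission where

open import Defs
open import Data.Bool using (Bool; true; false; _∧_; _∨_; not; if_then_else_; T?)
open import Data.Bool.ListAction using (and; any; all)
open import Data.Bool.Properties using (¬-not; T-≡; ∧-identityʳ)
open import Data.Empty using (⊥; ⊥-elim)
open import Data.Fin as Fin using (Fin; zero; suc; toℕ)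
import Data.Fin.Properties as FinP
open import Data.Integer as ℤ using (ℤ)
import Data.Integer.Properties as ℤP
import Data.Integer.Tactic.RingSolver as ℤSolver
open import Data.List as List using (List; []; _∷_; map; length; lookup; filterᵇ; concatMap; upTo; allFin; foldr; zipWith; _++_)
open import Data.List.Membership.Propositional using (_∈_; find; lose)
open import Data.List.Membership.Propositional.Properties
open import Data.List.Membership.Propositional.Properties.WithK using (unique∧set⇒bag)
import Data.List.Properties as ListP
open import Data.List.Relation.Binary.BagAndSetEquality using (∼bag⇒↭)
import Data.List.Relation.Binary.Permutation.Propositional as Perm
open import Data.List.Relation.Unary.All as All using (All; []; _∷_)
open import Data.List.Relation.Unary.AllPairs using ([]; _∷_)
open import Data.List.Relation.Unary.Any using (here; there; index)
open import Data.List.Relation.Unary.Any.Properties using (lookup-index)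
open import Data.List.Relation.Unary.Unique.Propositional using (Unique)
import Data.List.Relation.Unary.Unique.Propositional.Properties as UniqueP
open import Data.Nat
open import Data.Nat.Combinatorics using (_C_; nCk≡nC[n∸k]; nCn≡1; k>n⇒nCk≡0; nCk+nC[k+1]≡[n+1]C[k+1])
import Data.Nat.Coprimality as Coprimality
open import Data.Nat.Induction using (<-wellFounded)
open import Data.Nat.Properties
import Data.Nat.Tactic.RingSolver as ℕSolver
open import Data.Product using (∃; Σ; _×_; _,_; proj₁; proj₂)
open import Data.Rational as ℚ using (ℚ; 0ℚ; mkℚ)
import Data.Rational.Properties as ℚP
import Data.Rational.Unnormalised as ℚᵘ
import Data.Rational.Unnormalised.Properties as ℚᵘP
open import Data.Sum using (_⊎_; inj₁; inj₂; [_,_]′)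
open import Data.Unit using (tt)
open import Data.Vec as Vec using (Vec; []; _∷_; tabulate)
open import Data.Vec.Properties using (lookup∘tabulate; lookup-replicate)
open import Function using (_∘_; id)
open import Function.Bundles using (Equivalence; mk↔ₛ′; mk⇔)
open import Induction.WellFounded using (Acc; acc)
open import Relation.Binary using (tri<; tri≈; tri>)
open import Relation.Binary.PropositionalEquality hiding ([_])
open import Relation.Nullary using (¬_; yes; no; Dec)
open import Relation.Nullary.Decidable using (⌊_⌋)

-- A hub is adjacent to every other vertex, so the union of a tube containing a hub with any other
-- tube is connected, and compatible tubes of this kind must be nested. From T₁ on (which may be the
-- whole vertex set) the tubes therefore form a chain: outside T₁ the graph is forgotten and only an
-- ordered partition remains, which is why permutohedra appear inside stellohedra. The obstacle is
-- that a face is given only as the tight set of some rational point. Two facts about the numbers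
-- 3^|S| bridge the gap. Two smaller powers of 3 add up to less than the next power (with base 2
-- equality could occur), so tight tubes are compatible. Conversely an explicit point is written
-- down for every tubing, and convexity of the powers keeps all other tubes slack there. After that
-- the polytopes enter only through `IsModel`. Equality in 𝔓 is tested on one invariant at a time,
-- so both identities become identities between integers. A tubing has one class more than it has
-- proper tubes; this extra class is the source of the minus sign in Π°.

-- Boolean tests and quantifiers over finite lists.

bool-ext : ∀ {a b} → (a ≡ true → b ≡ true) → (b ≡ true → a ≡ true) → a ≡ b
bool-ext {true}  {true}  f g = refl
bool-ext {true}  {false} f g = sym (f refl)
bool-ext {false} {true}  f g = g refl
bool-ext {false} {false} f g = refl

true≢false : ∀ {a} → a ≡ true → a ≡ false → ⊥
true≢false refl ()

true? : ∀ b → b ≡ true ⊎ b ≡ false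
true? true  = inj₁ refl
true? false = inj₂ refl

∧-intro : ∀ {a b} → a ≡ true → b ≡ true → a ∧ b ≡ true
∧-intro refl refl = refl

∧-elim : ∀ {a b} → a ∧ b ≡ true → a ≡ true × b ≡ true
∧-elim {true} {true} refl = refl , refl

∨-elim : ∀ {a b} → a ∨ b ≡ true → a ≡ true ⊎ b ≡ true
∨-elim {true}  _ = inj₁ refl
∨-elim {false} p = inj₂ p

∨-introˡ : ∀ {a b} → a ≡ true → a ∨ b ≡ true
∨-introˡ refl = refl

∨-introʳ : ∀ {a b} → b ≡ true → a ∨ b ≡ true
∨-introʳ {true}  _ = refl
∨-introʳ {false} p = p

not-intro : ∀ {a} → ¬ (a ≡ true) → not a ≡ true
not-intro {true}  p = ⊥-elim (p refl)
not-intro {false} p = refl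

not-elim : ∀ {a} → not a ≡ true → ¬ (a ≡ true)
not-elim {true} () _
not-elim {false} _ ()

∧-not-elim : ∀ {a b} → ¬ (a ∧ not b ≡ true) → a ≡ true → b ≡ true
∧-not-elim {true} {true}  _  _ = refl
∧-not-elim {true} {false} ¬e _ = ⊥-elim (¬e refl)

⇒-elim : ∀ {a b} → not a ∨ b ≡ true → a ≡ true → b ≡ true
⇒-elim p refl = p

⇒-intro : ∀ {a b} → (a ≡ true → b ≡ true) → not a ∨ b ≡ true
⇒-intro {true}  f = f refl
⇒-intro {false} f = refl

does-intro : ∀ {P : Set} {d : Dec P} → P → ⌊ d ⌋ ≡ true
does-intro {d = yes _} _ = refl
does-intro {d = no ¬p} p = ⊥-elim (¬p p)

does-elim : ∀ {P : Set} {d : Dec P} → ⌊ d ⌋ ≡ true → P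
does-elim {d = yes p} _ = p

module _ {A : Set} where

  all-elim : ∀ {p : A → Bool} {xs x} → all p xs ≡ true → x ∈ xs → p x ≡ true
  all-elim {xs = _ ∷ _} e (here refl) = proj₁ (∧-elim e)
  all-elim {xs = _ ∷ _} e (there x∈)  = all-elim (proj₂ (∧-elim e)) x∈

  all-intro : ∀ {p : A → Bool} xs → (∀ x → x ∈ xs → p x ≡ true) → all p xs ≡ true
  all-intro []       f = refl
  all-intro (x ∷ xs) f = ∧-intro (f x (here refl)) (all-intro xs (λ y → f y ∘ there))

  any-elim : ∀ {p : A → Bool} xs → any p xs ≡ true → ∃ λ x → x ∈ xs × p x ≡ true
  any-elim {p} (x ∷ xs) e with ∨-elim {p x} e
  ... | inj₁ px = x , here refl , px
  ... | inj₂ r with any-elim xs r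
  ...   | y , y∈ , py = y , there y∈ , py

  any-intro : ∀ {p : A → Bool} {xs x} → x ∈ xs → p x ≡ true → any p xs ≡ true
  any-intro (here refl) px = ∨-introˡ px
  any-intro {p} {y ∷ _} (there x∈) px = ∨-introʳ {p y} (any-intro x∈ px)

  ∈-filterᵇ⁻ : ∀ {p : A → Bool} {xs x} → x ∈ filterᵇ p xs → x ∈ xs × p x ≡ true
  ∈-filterᵇ⁻ {p} x∈ with ∈-filter⁻ (T? ∘ p) x∈
  ... | x∈xs , t = x∈xs , Equivalence.to T-≡ t

  ∈-filterᵇ⁺ : ∀ {p : A → Bool} {xs x} → x ∈ xs → p x ≡ true → x ∈ filterᵇ p xs
  ∈-filterᵇ⁺ {p} x∈ px = ∈-filter⁺ (T? ∘ p) x∈ (Equivalence.from T-≡ px)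

module _ {n : ℕ} where

  allFin-elim : ∀ {p : Fin n → Bool} → all p (allFin n) ≡ true → ∀ i → p i ≡ true
  allFin-elim e i = all-elim e (∈-allFin i)

  allFin-intro : ∀ {p : Fin n → Bool} → (∀ i → p i ≡ true) → all p (allFin n) ≡ true
  allFin-intro f = all-intro (allFin n) (λ i _ → f i)

  anyFin-elim : ∀ {p : Fin n → Bool} → any p (allFin n) ≡ true → ∃ λ i → p i ≡ true
  anyFin-elim e with any-elim (allFin n) e
  ... | i , _ , pi = i , pi

  anyFin-intro : ∀ {p : Fin n → Bool} i → p i ≡ true → any p (allFin n) ≡ true
  anyFin-intro i = any-intro (∈-allFin i)

  anyFin? : (p : Fin n → Bool) → (∃ λ i → p i ≡ true) ⊎ (∀ i → ¬ (p i ≡ true))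
  anyFin? p with true? (any p (allFin n))
  ... | inj₁ e = inj₁ (anyFin-elim e)
  ... | inj₂ e = inj₂ (λ i pi → true≢false (anyFin-intro i pi) e)

  counterexample : (p q : Fin n → Bool) → ¬ (∀ i → p i ≡ true → q i ≡ true) →
                   ∃ λ i → p i ≡ true × ¬ (q i ≡ true)
  counterexample p q ¬f with anyFin? (λ i → p i ∧ not (q i))
  ... | inj₁ (i , e) = i , proj₁ (∧-elim e) , not-elim (proj₂ (∧-elim {p i} e))
  ... | inj₂ f = ⊥-elim (¬f λ i pi → ∧-not-elim (f i) pi)

module _ {A : Set} where

  lookup-ext : ∀ {n} {u v : Vec A n} → (∀ i → Vec.lookup u i ≡ Vec.lookup v i) → u ≡ v
  lookup-ext {u = []}    {[]}    f = refl
  lookup-ext {u = x ∷ u} {y ∷ v} f = cong₂ _∷_ (f zero) (lookup-ext (f ∘ suc))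

  lookup-injective : ∀ {xs : List A} → Unique xs → ∀ i j → lookup xs i ≡ lookup xs j → i ≡ j
  lookup-injective {_ ∷ _} (_ ∷ _) zero    zero    e = refl
  lookup-injective {_ ∷ xs} (p ∷ _) zero   (suc j) e = ⊥-elim (All.lookup p (∈-lookup j) e)
  lookup-injective {_ ∷ xs} (p ∷ _) (suc i) zero   e = ⊥-elim (All.lookup p (∈-lookup i) (sym e))
  lookup-injective {_ ∷ _} (_ ∷ u) (suc i) (suc j) e = cong suc (lookup-injective u i j e)

-- Face posets are compared through positions in the list of faces, so an isomorphism amounts to
-- mutually inverse maps that only need to be defined on listed faces.
≅-intro : (X Y : FinPoset) → Unique (elems X) → Unique (elems Y) →
          (to : Carrier X → Carrier Y) (from : Carrier Y → Carrier X) →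
          (∀ x → x ∈ elems X → to x ∈ elems Y) → (∀ y → y ∈ elems Y → from y ∈ elems X) →
          (∀ x → x ∈ elems X → from (to x) ≡ x) → (∀ y → y ∈ elems Y → to (from y) ≡ y) →
          (∀ x x′ → x ∈ elems X → x′ ∈ elems X → _≼_ X x x′ ≡ _≼_ Y (to x) (to x′)) → X ≅ Y
≅-intro X Y uX uY to from to∈ from∈ from∘to to∘from ord = mk↔ₛ′ f g fg gf , ≼-f
  where
  f : Fin (length (elems X)) → Fin (length (elems Y))
  f i = index (to∈ _ (∈-lookup {xs = elems X} i))
  g : Fin (length (elems Y)) → Fin (length (elems X))
  g j = index (from∈ _ (∈-lookup {xs = elems Y} j))
  lookup-f : ∀ i → to (lookup (elems X) i) ≡ lookup (elems Y) (f i)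
  lookup-f i = lookup-index (to∈ _ (∈-lookup {xs = elems X} i))
  lookup-g : ∀ j → from (lookup (elems Y) j) ≡ lookup (elems X) (g j)
  lookup-g j = lookup-index (from∈ _ (∈-lookup {xs = elems Y} j))
  fg : ∀ j → f (g j) ≡ j
  fg j = lookup-injective uY _ _ (trans (sym (lookup-f (g j)))
           (trans (cong to (sym (lookup-g j))) (to∘from _ (∈-lookup {xs = elems Y} j))))
  gf : ∀ i → g (f i) ≡ i
  gf i = lookup-injective uX _ _ (trans (sym (lookup-g (f i)))
           (trans (cong from (sym (lookup-f i))) (from∘to _ (∈-lookup {xs = elems X} i))))
  ≼-f : ∀ i j → _≼_ X (lookup (elems X) i) (lookup (elems X) j)
              ≡ _≼_ Y (lookup (elems Y) (f i)) (lookup (elems Y) (f j))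
  ≼-f i j rewrite sym (lookup-f i) | sym (lookup-f j) =
    ord _ _ (∈-lookup {xs = elems X} i) (∈-lookup {xs = elems X} j)

-- Integer sums and maxima over lists, and heights in a finite poset.

module _ {A : Set} where

  sumℤ : (A → ℤ) → List A → ℤ
  sumℤ f = foldr (λ x r → f x ℤ.+ r) ℤ.0ℤ

  sumℤ-cong : ∀ {f g : A → ℤ} xs → (∀ x → x ∈ xs → f x ≡ g x) → sumℤ f xs ≡ sumℤ g xs
  sumℤ-cong []       e = refl
  sumℤ-cong (x ∷ xs) e = cong₂ ℤ._+_ (e x (here refl)) (sumℤ-cong xs (λ y → e y ∘ there))

  sumℤ-++ : ∀ (f : A → ℤ) xs ys → sumℤ f (xs ++ ys) ≡ sumℤ f xs ℤ.+ sumℤ f ys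
  sumℤ-++ f []       ys = sym (ℤP.+-identityˡ _)
  sumℤ-++ f (x ∷ xs) ys = trans (cong (ℤ._+_ (f x)) (sumℤ-++ f xs ys)) (sym (ℤP.+-assoc (f x) _ _))

  sumℤ-* : ∀ c (f : A → ℤ) xs → c ℤ.* sumℤ f xs ≡ sumℤ (λ x → c ℤ.* f x) xs
  sumℤ-* c f []       = ℤP.*-zeroʳ c
  sumℤ-* c f (x ∷ xs) = trans (ℤP.*-distribˡ-+ c (f x) _) (cong (ℤ._+_ (c ℤ.* f x)) (sumℤ-* c f xs))

  private
    sumℤ-↭ : ∀ (f : A → ℤ) {xs ys} → xs Perm.↭ ys → sumℤ f xs ≡ sumℤ f ys
    sumℤ-↭ f Perm.refl = refl
    sumℤ-↭ f (Perm.prep x p) = cong (ℤ._+_ (f x)) (sumℤ-↭ f p)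
    sumℤ-↭ f (Perm.swap x y p) = trans (sym (ℤP.+-assoc (f x) (f y) _))
      (trans (cong₂ ℤ._+_ (ℤP.+-comm (f x) (f y)) (sumℤ-↭ f p)) (ℤP.+-assoc (f y) (f x) _))
    sumℤ-↭ f (Perm.trans p q) = trans (sumℤ-↭ f p) (sumℤ-↭ f q)

  sumℤ-set : ∀ (f : A → ℤ) {xs ys} → Unique xs → Unique ys →
             (∀ {z} → z ∈ xs → z ∈ ys) → (∀ {z} → z ∈ ys → z ∈ xs) → sumℤ f xs ≡ sumℤ f ys
  sumℤ-set f ux uy to from = sumℤ-↭ f (∼bag⇒↭ (unique∧set⇒bag ux uy (mk⇔ to from)))

module _ {A B : Set} where

  sumℤ-map : ∀ (f : B → ℤ) (g : A → B) xs → sumℤ f (map g xs) ≡ sumℤ (f ∘ g) xs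
  sumℤ-map f g []       = refl
  sumℤ-map f g (x ∷ xs) = cong (ℤ._+_ (f (g x))) (sumℤ-map f g xs)

  sumℤ-concatMap : ∀ (f : B → ℤ) (g : A → List B) xs →
                   sumℤ f (concatMap g xs) ≡ sumℤ (λ x → sumℤ f (g x)) xs
  sumℤ-concatMap f g []       = refl
  sumℤ-concatMap f g (x ∷ xs) = trans (sumℤ-++ f (g x) _) (cong (ℤ._+_ (sumℤ f (g x))) (sumℤ-concatMap f g xs))

module _ {A : Set} where

  maxList-≤ : ∀ (f : A → ℕ) xs {b} → (∀ x → x ∈ xs → f x ≤ b) → maxList (map f xs) ≤ b
  maxList-≤ f []       h = z≤n
  maxList-≤ f (x ∷ xs) h = ⊔-lub (h x (here refl)) (maxList-≤ f xs (λ y → h y ∘ there))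

  ≤-maxList : ∀ (f : A → ℕ) {xs x} → x ∈ xs → f x ≤ maxList (map f xs)
  ≤-maxList f {y ∷ xs} (here refl) = m≤m⊔n (f y) _
  ≤-maxList f {y ∷ xs} (there x∈)  = ≤-trans (≤-maxList f x∈) (m≤n⊔m (f y) _)

-- A strictly monotone ρ for which every element of positive rank lies just above one of the preceding
-- rank computes the length of the longest chain below an element.
module Rank (X : FinPoset) (ρ : Carrier X → ℕ)
  (strict : ∀ {x y} → x ∈ elems X → y ∈ elems X → _≼_ X x y ≡ true → ¬ (_≼_ X y x ≡ true) → ρ x < ρ y)
  (cover : ∀ {y r} → y ∈ elems X → ρ y ≡ suc r →
           ∃ λ x → x ∈ elems X × _≼_ X x y ≡ true × ¬ (_≼_ X y x ≡ true) × ρ x ≡ r) where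

  private
    below : Carrier X → Carrier X → Bool
    below y x = _≼_ X x y ∧ not (_≼_ X y x)

  -- Fuel `k` sees only chains of at most `k` steps, hence the truncation. `strict` bounds every
  -- chain from above, and `cover` prolongs one downwards.
  heightF≡ : ∀ k {y} → y ∈ elems X → heightF X k y ≡ k ⊓ ρ y
  heightF≡ zero    y∈ = refl
  heightF≡ (suc k) {y} y∈ = ≤-antisym upper lower
    where
    upper : heightF X (suc k) y ≤ suc k ⊓ ρ y
    upper = maxList-≤ (λ g → suc (heightF X k g)) (filterᵇ (below y) (elems X)) step
      where
      step : ∀ x → x ∈ filterᵇ (below y) (elems X) → suc (heightF X k x) ≤ suc k ⊓ ρ y
      step x x∈f with ∈-filterᵇ⁻ {p = below y} x∈f
      ... | x∈ , e rewrite heightF≡ k x∈ = ⊓-glb (s≤s (m⊓n≤m k (ρ x)))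
        (≤-trans (s≤s (m⊓n≤n k (ρ x)))
          (strict x∈ y∈ (proj₁ (∧-elim e)) (not-elim (proj₂ (∧-elim {_≼_ X x y} e)))))
    lower : suc k ⊓ ρ y ≤ heightF X (suc k) y
    lower with ρ y in eq
    ... | zero  = z≤n
    ... | suc r with cover y∈ eq
    ...   | x , x∈ , x≼y , ¬y≼x , refl = subst (λ h → suc h ≤ heightF X (suc k) y) (heightF≡ k x∈)
            (≤-maxList (λ g → suc (heightF X k g)) (∈-filterᵇ⁺ {p = below y} x∈ (∧-intro x≼y (not-intro ¬y≼x))))

  private
    ofRank : ∀ n r {y} → y ∈ elems X → ρ y ≡ r + n → ∃ λ x → x ∈ elems X × ρ x ≡ r
    ofRank zero    r {y} y∈ e = y , y∈ , trans e (+-identityʳ r)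
    ofRank (suc n) r y∈ e with cover y∈ (trans e (+-suc r n))
    ... | x , x∈ , _ , _ , ex = ofRank n r x∈ ex

    -- Descending through covers meets every rank from `ρ y` to 0, so there are at least `suc (ρ y)`
    -- distinct elements. Hence the fuel used by `height` is never exhausted.
    rank≤length : ∀ {y} → y ∈ elems X → suc (ρ y) ≤ length (elems X)
    rank≤length {y} y∈ = FinP.injective⇒≤ {f = λ r → index (proj₁ (proj₂ (at r)))} inj
      where
      at : (r : Fin (suc (ρ y))) → ∃ λ x → x ∈ elems X × ρ x ≡ toℕ r
      at r = ofRank (ρ y ∸ toℕ r) (toℕ r) y∈ (sym (m+[n∸m]≡n (FinP.toℕ≤pred[n] r)))
      inj : ∀ {r s} → index (proj₁ (proj₂ (at r))) ≡ index (proj₁ (proj₂ (at s))) → r ≡ s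
      inj {r} {s} e = FinP.toℕ-injective (trans (sym (proj₂ (proj₂ (at r)))) (trans (cong ρ
        (trans (lookup-index (proj₁ (proj₂ (at r)))) (trans (cong (lookup (elems X)) e)
          (sym (lookup-index (proj₁ (proj₂ (at s)))))))) (proj₂ (proj₂ (at s)))))

  height≡ : ∀ {y} → y ∈ elems X → height X y ≡ ρ y
  height≡ y∈ = trans (heightF≡ (length (elems X)) y∈) (m≥n⇒m⊓n≡n (≤-trans (n≤1+n _) (rank≤length y∈)))

  codim≡ : ∀ {t} → t ∈ elems X → (∀ x → x ∈ elems X → ρ x ≤ ρ t) → ∀ {y} → y ∈ elems X → codim X y ≡ ρ t ∸ ρ y
  codim≡ {t} t∈ top y∈ = cong₂ _∸_ dim (height≡ y∈)
    where
    dim : dimP X ≡ ρ t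
    dim = ≤-antisym (maxList-≤ (height X) (elems X) (λ x x∈ → subst (_≤ ρ t) (sym (height≡ x∈)) (top x x∈)))
                    (subst (_≤ dimP X) (height≡ t∈) (≤-maxList (height X) t∈))

-- Counting vertices with a given property.

bit : Bool → ℕ
bit true  = 1
bit false = 0

count : ∀ {n} → (Fin n → Bool) → ℕ
count {zero}  p = 0
count {suc n} p = bit (p zero) + count (p ∘ suc)

bit-mono : ∀ {a b} → (a ≡ true → b ≡ true) → bit a ≤ bit b
bit-mono {true}  {b} f rewrite f refl = ≤-refl
bit-mono {false} f = z≤n

count-cong : ∀ {n} {p q : Fin n → Bool} → (∀ i → p i ≡ q i) → count p ≡ count q
count-cong {zero}  e = refl
count-cong {suc n} e = cong₂ _+_ (cong bit (e zero)) (count-cong (e ∘ suc))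

count-mono : ∀ {n} {p q : Fin n → Bool} → (∀ i → p i ≡ true → q i ≡ true) → count p ≤ count q
count-mono {zero}  f = z≤n
count-mono {suc n} f = +-mono-≤ (bit-mono (f zero)) (count-mono (f ∘ suc))

count-+ : ∀ {n} {p q r : Fin n → Bool} → (∀ i → bit (r i) ≡ bit (p i) + bit (q i)) → count r ≡ count p + count q
count-+ {zero}  e = refl
count-+ {suc n} {p} {q} {r} e = trans (cong₂ _+_ (e zero) (count-+ {p = p ∘ suc} {q ∘ suc} (e ∘ suc)))
  (interchange (bit (p zero)) (bit (q zero)) (count (p ∘ suc)) (count (q ∘ suc)))
  where
  interchange : ∀ a b c d → a + b + (c + d) ≡ a + c + (b + d)
  interchange = ℕSolver.solve-∀

count-true : ∀ n → count {n} (λ _ → true) ≡ n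
count-true zero    = refl
count-true (suc n) = cong suc (count-true n)

count-false : ∀ n → count {n} (λ _ → false) ≡ 0
count-false zero    = refl
count-false (suc n) = count-false n

==F-refl : ∀ {n} (i : Fin n) → (i ==F i) ≡ true
==F-refl i = does-intro {d = i Fin.≟ i} refl

==F-elim : ∀ {n} {i j : Fin n} → (i ==F j) ≡ true → i ≡ j
==F-elim {i = i} {j} = does-elim {d = i Fin.≟ j}

==F-suc : ∀ {n} (i j : Fin n) → (suc i ==F suc j) ≡ (i ==F j)
==F-suc i j = bool-ext
  (λ e → subst (λ k → (i ==F k) ≡ true) (FinP.suc-injective (==F-elim {i = suc i} {suc j} e)) (==F-refl i))
  (λ e → subst (λ k → (suc i ==F suc k) ≡ true) (==F-elim {i = i} {j} e) (==F-refl (suc i)))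

count-at : ∀ {n} (i : Fin n) → count (i ==F_) ≡ 1
count-at {suc n} zero    = cong suc (count-false n)
count-at {suc n} (suc i) = trans (count-cong (==F-suc i)) (count-at i)

count-remove : ∀ {n} {p q : Fin n → Bool} s → q s ≡ true → ¬ (p s ≡ true) →
               (∀ i → ¬ i ≡ s → p i ≡ q i) → count q ≡ suc (count p)
count-remove {p = p} {q} s qs ¬ps e = trans (count-+ {p = s ==F_} {q = p} bits) (cong (_+ count p) (count-at s))
  where
  bits : ∀ i → bit (q i) ≡ bit (s ==F i) + bit (p i)
  bits i with s Fin.≟ i
  ... | no s≢i = cong bit (sym (e i (s≢i ∘ sym)))
  ... | yes refl = trans (cong bit qs)
      (cong (λ b → suc (bit b)) (sym ([ (λ ps → ⊥-elim (¬ps ps)) , id ]′ (true? (p s)))))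

count-pos : ∀ {n} {p : Fin n → Bool} i → p i ≡ true → 1 ≤ count p
count-pos {p = p} i pi = subst (_≤ count p) (count-at i)
    (count-mono {p = i ==F_} {p} (λ j e → subst (λ k → p k ≡ true) (==F-elim {i = i} {j} e) pi))

count-strict : ∀ {n} {p q : Fin n → Bool} s → (∀ i → p i ≡ true → q i ≡ true) → q s ≡ true → ¬ (p s ≡ true) →
               count p < count q
count-strict {p = p} {q} s f qs ¬ps = subst (_≤ count q) (trans (count-remove {p = p} {q = p′} s p′s ¬ps same) refl)
  (count-mono p′⊆q)
  where
  p′ : _ → Bool
  p′ i = (s ==F i) ∨ p i
  p′s : p′ s ≡ true
  p′s = ∨-introˡ (==F-refl s)
  same : ∀ i → ¬ i ≡ s → p i ≡ p′ i
  same i i≢s = bool-ext (∨-introʳ {s ==F i}) (λ e → [ (λ e′ → ⊥-elim (i≢s (sym (==F-elim e′)))) , id ]′ (∨-elim e))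
  p′⊆q : ∀ i → p′ i ≡ true → q i ≡ true
  p′⊆q i e = [ (λ e′ → subst (λ k → q k ≡ true) (==F-elim e′) qs) , f i ]′ (∨-elim e)

count-not : ∀ {n} (p : Fin n → Bool) → n ≡ count (not ∘ p) + count p
count-not {n} p = trans (sym (count-true n)) (count-+ {p = not ∘ p} {q = p} (λ i → bits (p i)))
  where
  bits : ∀ b → 1 ≡ bit (not b) + bit b
  bits true  = refl
  bits false = refl

-- Tubings as preorders.

Mat : ℕ → Set
Mat n = Vec (Vec Bool n) n

-- Opaque so that the matrix and the indices can be inferred from an entry.
opaque
  at : ∀ {n} → Mat n → Fin n → Fin n → Bool
  at R i j = Vec.lookup (Vec.lookup R i) j

  tab : ∀ {n} → (Fin n → Fin n → Bool) → Mat n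
  tab f = tabulate (λ i → tabulate (f i))

  at-tab : ∀ {n} (f : Fin n → Fin n → Bool) i j → at (tab f) i j ≡ f i j
  at-tab f i j = trans (cong (λ v → Vec.lookup v j) (lookup∘tabulate (λ i → tabulate (f i)) i))
      (lookup∘tabulate (f i) j)

  mat-ext : ∀ {n} {R Q : Mat n} → (∀ i j → at R i j ≡ at Q i j) → R ≡ Q
  mat-ext e = lookup-ext λ i → lookup-ext λ j → e i j

tab-intro : ∀ {n} {f : Fin n → Fin n → Bool} {i j} → f i j ≡ true → at (tab f) i j ≡ true
tab-intro {f = f} e = trans (at-tab f _ _) e

tab-elim : ∀ {n} {f : Fin n → Fin n → Bool} {i j} → at (tab f) i j ≡ true → f i j ≡ true
tab-elim {f = f} {i} {j} e = trans (sym (at-tab f i j)) e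

infix 4 _⊑_
-- Fewer relations mean more tubes, so this is inclusion of the face of `R` in the face of `Q`.
_⊑_ : ∀ {n} → Mat n → Mat n → Set
R ⊑ Q = ∀ i j → at R i j ≡ true → at Q i j ≡ true

⊑-antisym : ∀ {n} {R Q : Mat n} → R ⊑ Q → Q ⊑ R → R ≡ Q
⊑-antisym R⊑Q Q⊑R = mat-ext λ i j → bool-ext (R⊑Q i j) (Q⊑R i j)

-- The tubing without proper tubes: the whole polytope as a face of itself.
full : ∀ {n} → Mat n
full = tab (λ _ _ → true)

opaque
  -- The smallest tube containing `i` consists of the vertices below `i`; this asks whether it
  -- contains a hub.
  high : ∀ {n} → (Fin n → Bool) → Mat n → Fin n → Bool
  high {n} hub R i = any (λ h → hub h ∧ at R h i) (allFin n)

  high-intro : ∀ {n} {hub : Fin n → Bool} {R : Mat n} {i} h → hub h ≡ true → at R h i ≡ true → high hub R i ≡ true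
  high-intro h hubh h≤i = anyFin-intro h (∧-intro hubh h≤i)

  high-elim : ∀ {n} {hub : Fin n → Bool} {R : Mat n} {i} → high hub R i ≡ true → ∃ λ h → hub h ≡ true × at R h i ≡ true
  high-elim {hub = hub} e with anyFin-elim e
  ... | h , e′ = h , ∧-elim {hub h} e′

-- Faces of the graph associahedron of the graph in which distinct i, j are adjacent iff one of them is a
-- hub (all vertices are hubs: complete graph; one hub: star).  A face is encoded by the preorder
-- "every tube containing j contains i".
record Valid {n} (hub : Fin n → Bool) (R : Mat n) : Set where
  field
    rfl : ∀ i → at R i i ≡ true
    trn : ∀ {i j k} → at R i j ≡ true → at R j k ≡ true → at R i k ≡ true
    iso : ∀ {i j} → ¬ (high hub R i ≡ true) → at R j i ≡ true → j ≡ i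
    cmp : ∀ i j → high hub R i ≡ true → at R i j ≡ true ⊎ at R j i ≡ true
open Valid

-- A running maximum that starts at `c` and never leaves the part above it. Comparability is
-- demanded only there, because in a tubing preorder only vertices above a hub are comparable with
-- all others.
greatest : ∀ {n} (Q : Fin n → Fin n → Bool) (S : Fin n → Bool) (c : Fin n) → S c ≡ true →
           (∀ i → Q i i ≡ true) → (∀ {i j k} → Q i j ≡ true → Q j k ≡ true → Q i k ≡ true) →
           (∀ {m j} → S m ≡ true → S j ≡ true → Q c m ≡ true → Q m j ≡ true ⊎ Q j m ≡ true) →
           ∃ λ m → S m ≡ true × Q c m ≡ true × (∀ j → S j ≡ true → Q j m ≡ true)
greatest {n} Q S c Sc rf tr cm with go (allFin n)
  where
  go : ∀ xs → ∃ λ m → S m ≡ true × Q c m ≡ true × (∀ j → j ∈ xs → S j ≡ true → Q j m ≡ true)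
  go [] = c , Sc , rf c , λ _ ()
  go (x ∷ xs) with go xs | true? (S x)
  ... | m , Sm , cQm , f | inj₂ Sx = m , Sm , cQm ,
      λ { j (here refl) Sj → ⊥-elim (true≢false Sj Sx) ; j (there j∈) → f j j∈ }
  ... | m , Sm , cQm , f | inj₁ Sx with cm Sm Sx cQm
  ...   | inj₁ mQx = x , Sx , tr cQm mQx , λ { j (here refl) _ → rf x ; j (there j∈) Sj → tr (f j j∈ Sj) mQx }
  ...   | inj₂ xQm = m , Sm , cQm , λ { j (here refl) _ → xQm ; j (there j∈) → f j j∈ }
... | m , Sm , cQm , f = m , Sm , cQm , λ j → f j (∈-allFin j)

-- Colourings of the vertices and coordinates inside a colour.

-- The smallest tube T₁ containing a hub colours the vertices: low are those inside T₁ forming singleton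
-- tubes, mid the other elements of T₁, top those outside T₁.
data Colour : Set where
  low mid top : Colour

_is_ : Colour → Colour → Bool
low is low = true
mid is mid = true
top is top = true
_   is _   = false

size : ∀ {n} → Colour → Vec Colour n → ℕ
size k []      = 0
size k (c ∷ M) = bit (c is k) + size k M

private
  step : ∀ b {m n} → (Fin m → Fin n) → Fin (bit b + m) → Fin (suc n)
  step true  f zero    = zero
  step true  f (suc j) = suc (f j)
  step false f j       = suc (f j)

  first : ∀ c {m} → Fin (bit (c is c) + m)
  first low = zero
  first mid = zero
  first top = zero

  shift : ∀ b {m} → Fin m → Fin (bit b + m)
  shift true  = suc
  shift false = id

ι : ∀ {n} k (M : Vec Colour n) → Fin (size k M) → Fin n
ι k (c ∷ M) = step (c is k) (ι k M)

Place : ∀ {n} → Vec Colour n → Set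
Place M = Σ Colour (λ k → Fin (size k M))

idx : ∀ {n} (M : Vec Colour n) → Fin n → Place M
idx (c ∷ M) zero    = c , first c
idx (c ∷ M) (suc i) = proj₁ (idx M i) , shift (c is proj₁ (idx M i)) (proj₂ (idx M i))

private
  step-shift : ∀ b {m n} (f : Fin m → Fin n) j → step b f (shift b j) ≡ suc (f j)
  step-shift true  f j = refl
  step-shift false f j = refl

ι-idx : ∀ {n} (M : Vec Colour n) i → ι (proj₁ (idx M i)) M (proj₂ (idx M i)) ≡ i
ι-idx (low ∷ M) zero    = refl
ι-idx (mid ∷ M) zero    = refl
ι-idx (top ∷ M) zero    = refl
ι-idx (c ∷ M) (suc i) = trans (step-shift (c is proj₁ (idx M i)) _ _) (cong suc (ι-idx M i))

idx-ι : ∀ {n} k (M : Vec Colour n) j → idx M (ι k M j) ≡ (k , j)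
idx-ι low (low ∷ M) zero    = refl
idx-ι mid (mid ∷ M) zero    = refl
idx-ι top (top ∷ M) zero    = refl
idx-ι low (low ∷ M) (suc j) rewrite idx-ι low M j = refl
idx-ι mid (mid ∷ M) (suc j) rewrite idx-ι mid M j = refl
idx-ι top (top ∷ M) (suc j) rewrite idx-ι top M j = refl
idx-ι low (mid ∷ M) j       rewrite idx-ι low M j = refl
idx-ι low (top ∷ M) j       rewrite idx-ι low M j = refl
idx-ι mid (low ∷ M) j       rewrite idx-ι mid M j = refl
idx-ι mid (top ∷ M) j       rewrite idx-ι mid M j = refl
idx-ι top (low ∷ M) j       rewrite idx-ι top M j = refl
idx-ι top (mid ∷ M) j       rewrite idx-ι top M j = refl

lookup-idx : ∀ {n} (M : Vec Colour n) i → Vec.lookup M i ≡ proj₁ (idx M i)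
lookup-idx (c ∷ M) zero    = refl
lookup-idx (c ∷ M) (suc i) = lookup-idx M i

lookup-ι : ∀ {n} k (M : Vec Colour n) j → Vec.lookup M (ι k M j) ≡ k
lookup-ι k M j = trans (lookup-idx M (ι k M j)) (cong proj₁ (idx-ι k M j))

data View {n} (M : Vec Colour n) : Fin n → Set where
  place : ∀ k j → View M (ι k M j)

view : ∀ {n} (M : Vec Colour n) i → View M i
view M i = subst (View M) (ι-idx M i) (place _ _)

-- Monotonicity is needed because classes are counted by their members of least index (`nonrep`):
-- gluing must carry least members to least members.
ι-mono : ∀ {n} k (M : Vec Colour n) {i j} → toℕ i < toℕ j → toℕ (ι k M i) < toℕ (ι k M j)
ι-mono k (c ∷ M) = go (c is k)
  where
  go : ∀ b {i j : Fin (bit b + size k M)} → toℕ i < toℕ j → toℕ (step b (ι k M) i) < toℕ (step b (ι k M) j)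
  go true  {zero}  {suc j} _         = s≤s z≤n
  go true  {suc i} {suc j} (s≤s i<j) = s≤s (ι-mono k M i<j)
  go false         i<j               = s≤s (ι-mono k M i<j)

ι-mono⁻ : ∀ {n} k (M : Vec Colour n) {i j} → toℕ (ι k M i) < toℕ (ι k M j) → toℕ i < toℕ j
ι-mono⁻ k M {i} {j} lt with <-cmp (toℕ i) (toℕ j)
... | tri< i<j _ _ = i<j
... | tri≈ _ e _ = ⊥-elim (<-irrefl (cong (toℕ ∘ ι k M) (FinP.toℕ-injective e)) lt)
... | tri> _ _ j<i = ⊥-elim (<-asym lt (ι-mono k M j<i))

-- Restricting a preorder to a colour and gluing preorders together.

opaque
  restrict : ∀ {n} k (M : Vec Colour n) → Mat n → Mat (size k M)
  restrict k M R = tab (λ i j → at R (ι k M i) (ι k M j))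

  at-restrict : ∀ {n} k (M : Vec Colour n) R i j → at (restrict k M R) i j ≡ at R (ι k M i) (ι k M j)
  at-restrict k M R = at-tab _

restrict-intro : ∀ {n k} {M : Vec Colour n} {R i j} → at R (ι k M i) (ι k M j) ≡ true → at (restrict k M R) i j ≡ true
restrict-intro e = trans (at-restrict _ _ _ _ _) e

restrict-elim : ∀ {n k} {M : Vec Colour n} {R i j} → at (restrict k M R) i j ≡ true → at R (ι k M i) (ι k M j) ≡ true
restrict-elim e = trans (sym (at-restrict _ _ _ _ _)) e

allHubs : ∀ {n} → Fin n → Bool
allHubs _ = true

high-allHubs : ∀ {n} {R : Mat n} → (∀ i → at R i i ≡ true) → ∀ i → high allHubs R i ≡ true
high-allHubs r i = high-intro i refl (r i)

-- Puts the preorder p on mid below the preorder q on top, and the antichain low below whatever lies above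
-- a hub; a mid vertex above no hub is a singleton tube and stays incomparable to low.
module GlueAt {n : ℕ} (hub : Fin n → Bool) (M : Vec Colour n) where

  hubₘ : Fin (size mid M) → Bool
  hubₘ = hub ∘ ι mid M

  glueAt : Mat (size mid M) → Mat (size top M) → Place M → Place M → Bool
  glueAt p q (low , i) (low , j) = i ==F j
  glueAt p q (low , _) (mid , j) = high hubₘ p j
  glueAt p q (low , _) (top , _) = true
  glueAt p q (mid , _) (low , _) = false
  glueAt p q (mid , i) (mid , j) = at p i j
  glueAt p q (mid , _) (top , _) = true
  glueAt p q (top , _) (low , _) = false
  glueAt p q (top , _) (mid , _) = false
  glueAt p q (top , i) (top , j) = at q i j

  opaque
    glue : Mat (size mid M) → Mat (size top M) → Mat n
    glue p q = tab (λ i j → glueAt p q (idx M i) (idx M j))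

    at-glue′ : ∀ p q i j → at (glue p q) i j ≡ glueAt p q (idx M i) (idx M j)
    at-glue′ p q = at-tab _

  at-glue : ∀ p q k i l j → at (glue p q) (ι k M i) (ι l M j) ≡ glueAt p q (k , i) (l , j)
  at-glue p q k i l j = trans (at-glue′ p q (ι k M i) (ι l M j)) (cong₂ (glueAt p q) (idx-ι k M i) (idx-ι l M j))

  glue-intro : ∀ {p q k i l j} → glueAt p q (k , i) (l , j) ≡ true → at (glue p q) (ι k M i) (ι l M j) ≡ true
  glue-intro e = trans (at-glue _ _ _ _ _ _) e

  glue-elim : ∀ {p q k i l j} → at (glue p q) (ι k M i) (ι l M j) ≡ true → glueAt p q (k , i) (l , j) ≡ true
  glue-elim e = trans (sym (at-glue _ _ _ _ _ _)) e

module Glue {n : ℕ} (hub : Fin n → Bool) (M : Vec Colour n)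
            (hub≢low : ∀ i → ¬ (hub (ι low M i) ≡ true))
            (m₀ : Fin (size mid M)) (hub-m₀ : hub (ι mid M m₀) ≡ true) where

  open GlueAt hub M public

  -- The relations that every gluing lacks. For a valid preorder their absence is enough for it to
  -- be a gluing (`glue-restrict`): comparability of high vertices supplies the relations that a
  -- gluing must have. The conditions pass to everything below a gluing.
  record Fits (h : Mat n) : Set where
    field
      ll : ∀ {i j} → at h (ι low M i) (ι low M j) ≡ true → i ≡ j
      ml : ∀ {i j} → ¬ (at h (ι mid M i) (ι low M j) ≡ true)
      tl : ∀ {i j} → ¬ (at h (ι top M i) (ι low M j) ≡ true)
      tm : ∀ {i j} → ¬ (at h (ι top M i) (ι mid M j) ≡ true)
  open Fits

  ⊑-glue⇒Fits : ∀ {h p q} → h ⊑ glue p q → Fits h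
  ⊑-glue⇒Fits {h} {p} {q} h⊑ .ll e = ==F-elim (glue-elim {p} {q} {low} {_} {low} (h⊑ _ _ e))
  ⊑-glue⇒Fits {h} {p} {q} h⊑ .ml e with () ← glue-elim {p} {q} {mid} {_} {low} (h⊑ _ _ e)
  ⊑-glue⇒Fits {h} {p} {q} h⊑ .tl e with () ← glue-elim {p} {q} {top} {_} {low} (h⊑ _ _ e)
  ⊑-glue⇒Fits {h} {p} {q} h⊑ .tm e with () ← glue-elim {p} {q} {top} {_} {mid} (h⊑ _ _ e)

  -- Makes the highness of a mid vertex a matter of mid alone, so that it survives restriction.
  hub-below-mid : ∀ {h} → Fits h → ∀ {x j} → hub x ≡ true → at h x (ι mid M j) ≡ true →
                  ∃ λ m → hubₘ m ≡ true × x ≡ ι mid M m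
  hub-below-mid f {x} hubx e with view M x
  ... | place low a = ⊥-elim (hub≢low a hubx)
  ... | place mid a = a , hubx , refl
  ... | place top a = ⊥-elim (tm f e)

  module Restrict {h : Mat n} (vh : Valid hub h) (fits : Fits h) where

    private
      p = restrict mid M h
      q = restrict top M h

    high-hub : ∀ {x} → hub x ≡ true → high hub h x ≡ true
    high-hub {x} hubx = high-intro x hubx (rfl vh x)

    m₀≤top : ∀ j → at h (ι mid M m₀) (ι top M j) ≡ true
    m₀≤top j = [ id , ⊥-elim ∘ tm fits ]′ (cmp vh _ (ι top M j) (high-hub hub-m₀))

    low≤hub : ∀ i {m} → hubₘ m ≡ true → at h (ι low M i) (ι mid M m) ≡ true
    low≤hub i hubm = [ ⊥-elim ∘ ml fits , id ]′ (cmp vh _ (ι low M i) (high-hub hubm))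

    top-high : ∀ j → high hub h (ι top M j) ≡ true
    top-high j = high-intro _ hub-m₀ (m₀≤top j)

    restrict-high : ∀ {i} → high hub h (ι mid M i) ≡ true → high hubₘ p i ≡ true
    restrict-high e with high-elim {hub = hub} {h} e
    ... | x , hubx , x≤ with hub-below-mid fits hubx x≤
    ...   | m , hubm , refl = high-intro m hubm (restrict-intro x≤)

    restrict-high⁻ : ∀ {i} → high hubₘ p i ≡ true → high hub h (ι mid M i) ≡ true
    restrict-high⁻ e with high-elim {hub = hubₘ} {p} e
    ... | m , hubm , m≤ = high-intro _ hubm (restrict-elim m≤)

    ι-injective : ∀ k {i j} → ι k M i ≡ ι k M j → i ≡ j
    ι-injective k {i} {j} e with trans (sym (idx-ι k M i)) (trans (cong (idx M) e) (idx-ι k M j))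
    ... | refl = refl

    restrict-mid-valid : Valid hubₘ p
    restrict-mid-valid .rfl i = restrict-intro (rfl vh _)
    restrict-mid-valid .trn a b = restrict-intro (trn vh (restrict-elim a) (restrict-elim b))
    restrict-mid-valid .iso ¬hi j≤i = ι-injective mid (iso vh (λ e → ¬hi (restrict-high e)) (restrict-elim j≤i))
    restrict-mid-valid .cmp i j hi = [ inj₁ ∘ restrict-intro , inj₂ ∘ restrict-intro ]′ (cmp vh _ _ (restrict-high⁻ hi))

    -- All top vertices lie above the hub `m₀` and are therefore mutually comparable. This is why a
    -- total preorder, a face of a permutohedron, appears on top whatever `hub` is.
    restrict-top-valid : Valid allHubs q
    restrict-top-valid .rfl i = restrict-intro (rfl vh _)
    restrict-top-valid .trn a b = restrict-intro (trn vh (restrict-elim a) (restrict-elim b))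
    restrict-top-valid .iso ¬hi _ = ⊥-elim (¬hi (high-allHubs {R = q} (λ i → restrict-intro (rfl vh _)) _))
    restrict-top-valid .cmp i j _ = [ inj₁ ∘ restrict-intro , inj₂ ∘ restrict-intro ]′ (cmp vh _ _ (top-high i))

    mid≤top : ∀ i j → at h (ι mid M i) (ι top M j) ≡ true
    mid≤top i j = [ ⊥-elim ∘ tm fits , id ]′ (cmp vh _ (ι mid M i) (top-high j))

    glue-restrict : glue p q ≡ h
    glue-restrict = ⊑-antisym to from
      where
      to : glue p q ⊑ h
      to i j e with view M i | view M j
      ... | place low a | place low b with refl ← ==F-elim {i = a} {b} (glue-elim {p} {q} {low} {a} {low} {b} e) =
          rfl vh _
      ... | place low a | place mid b with high-elim {hub = hubₘ} {p} (glue-elim {p} {q} {low} {a} {mid} {b} e)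
      ...   | m , hubm , m≤b = trn vh (low≤hub a hubm) (restrict-elim m≤b)
      to i j e | place low a | place top b = trn vh (low≤hub a hub-m₀) (m₀≤top b)
      to i j e | place mid a | place low b with () ← glue-elim {p} {q} {mid} {a} {low} {b} e
      to i j e | place mid a | place mid b = restrict-elim (glue-elim {p} {q} {mid} {a} {mid} {b} e)
      to i j e | place mid a | place top b = mid≤top a b
      to i j e | place top a | place low b with () ← glue-elim {p} {q} {top} {a} {low} {b} e
      to i j e | place top a | place mid b with () ← glue-elim {p} {q} {top} {a} {mid} {b} e
      to i j e | place top a | place top b = restrict-elim (glue-elim {p} {q} {top} {a} {top} {b} e)
      from : h ⊑ glue p q
      from i j e with view M i | view M j
      ... | place low a | place low b with refl ← ll fits e = glue-intro {p} {q} {low} {a} {low} {b} (==F-refl a)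
      ... | place low a | place mid b with true? (high hub h (ι mid M b))
      ...   | inj₁ hi = glue-intro {p} {q} {low} {a} {mid} {b} (restrict-high hi)
      -- A vertex above no hub has nothing else below it, so `iso` would identify a low vertex with
      -- a mid one; the colours differ.
      ...   | inj₂ lo with trans (sym (lookup-ι low M a))
          (trans (cong (Vec.lookup M) (iso vh (λ hi → true≢false hi lo) e)) (lookup-ι mid M b))
      ...     | ()
      from i j e | place low a | place top b = glue-intro {p} {q} {low} {a} {top} {b} refl
      from i j e | place mid a | place low b = ⊥-elim (ml fits e)
      from i j e | place mid a | place mid b = glue-intro {p} {q} {mid} {a} {mid} {b} (restrict-intro e)
      from i j e | place mid a | place top b = glue-intro {p} {q} {mid} {a} {top} {b} refl
      from i j e | place top a | place low b = ⊥-elim (tl fits e)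
      from i j e | place top a | place mid b = ⊥-elim (tm fits e)
      from i j e | place top a | place top b = glue-intro {p} {q} {top} {a} {top} {b} (restrict-intro e)

  restrict-mid-glue : ∀ p q → restrict mid M (glue p q) ≡ p
  restrict-mid-glue p q = mat-ext λ i j → trans (at-restrict _ M _ i j) (at-glue p q mid i mid j)

  restrict-top-glue : ∀ p q → restrict top M (glue p q) ≡ q
  restrict-top-glue p q = mat-ext λ i j → trans (at-restrict _ M _ i j) (at-glue p q top i top j)

  restrict-mono : ∀ k {R Q : Mat n} → R ⊑ Q → restrict k M R ⊑ restrict k M Q
  restrict-mono k R⊑Q i j e = restrict-intro (R⊑Q _ _ (restrict-elim e))

  high-mono : ∀ {p p′ : Mat (size mid M)} → p ⊑ p′ → ∀ {i} → high hubₘ p i ≡ true → high hubₘ p′ i ≡ true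
  high-mono {p} p⊑ e with high-elim {hub = hubₘ} {p} e
  ... | m , hubm , m≤ = high-intro m hubm (p⊑ _ _ m≤)

  glue-mono : ∀ {p p′ q q′} → p ⊑ p′ → q ⊑ q′ → glue p q ⊑ glue p′ q′
  glue-mono {p} {p′} {q} {q′} p⊑ q⊑ i j e with view M i | view M j
  ... | place low a | place low b = glue-intro {p′} {q′} {low} {a} {low} {b} (glue-elim {p} {q} {low} {a} {low} {b} e)
  ... | place low a | place mid b = glue-intro {p′} {q′} {low} {a} {mid} {b}
      (high-mono p⊑ (glue-elim {p} {q} {low} {a} {mid} {b} e))
  ... | place low a | place top b = glue-intro {p′} {q′} {low} {a} {top} {b} refl
  ... | place mid a | place low b with () ← glue-elim {p} {q} {mid} {a} {low} {b} e
  ... | place mid a | place mid b = glue-intro {p′} {q′} {mid} {a} {mid} {b}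
      (p⊑ a b (glue-elim {p} {q} {mid} {a} {mid} {b} e))
  ... | place mid a | place top b = glue-intro {p′} {q′} {mid} {a} {top} {b} refl
  ... | place top a | place low b with () ← glue-elim {p} {q} {top} {a} {low} {b} e
  ... | place top a | place mid b with () ← glue-elim {p} {q} {top} {a} {mid} {b} e
  ... | place top a | place top b = glue-intro {p′} {q′} {top} {a} {top} {b}
      (q⊑ a b (glue-elim {p} {q} {top} {a} {top} {b} e))

  ⊑-full : ∀ {m} {p : Mat m} → p ⊑ full
  ⊑-full i j _ = tab-intro refl

  module Valid-glue {p : Mat (size mid M)} {q : Mat (size top M)} (vp : Valid hubₘ p) (vq : Valid allHubs q) where

    private
      G = glue p q

    high-low : ∀ a → ¬ (high hub G (ι low M a) ≡ true)
    high-low a e with high-elim {hub = hub} {G} e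
    ... | x , hubx , x≤ with view M x
    ...   | place low b = hub≢low b hubx
    ...   | place mid b with () ← glue-elim {p} {q} {mid} {b} {low} {a} x≤
    ...   | place top b with () ← glue-elim {p} {q} {top} {b} {low} {a} x≤

    high-mid : ∀ a → high hub G (ι mid M a) ≡ true → high hubₘ p a ≡ true
    high-mid a e with high-elim {hub = hub} {G} e
    ... | x , hubx , x≤ with view M x
    ...   | place low b = ⊥-elim (hub≢low b hubx)
    ...   | place mid b = high-intro b hubx (glue-elim {p} {q} {mid} {b} {mid} {a} x≤)
    ...   | place top b with () ← glue-elim {p} {q} {top} {b} {mid} {a} x≤

    high-mid⁻ : ∀ a → high hubₘ p a ≡ true → high hub G (ι mid M a) ≡ true
    high-mid⁻ a e with high-elim {hub = hubₘ} {p} e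
    ... | m , hubm , m≤ = high-intro _ hubm (glue-intro {p} {q} {mid} {m} {mid} {a} m≤)

    high-top : ∀ a → high hub G (ι top M a) ≡ true
    high-top a = high-intro _ hub-m₀ (glue-intro {p} {q} {mid} {m₀} {top} {a} refl)

    total-q : ∀ i j → at q i j ≡ true ⊎ at q j i ≡ true
    total-q i j = cmp vq i j (high-allHubs {R = q} (rfl vq) i)

    glueAt-trans : ∀ x y z → glueAt p q x y ≡ true → glueAt p q y z ≡ true → glueAt p q x z ≡ true
    glueAt-trans (low , a) (low , b) z e f with refl ← ==F-elim {i = a} {b} e = f
    glueAt-trans (low , a) (mid , b) (mid , c) e f with high-elim {hub = hubₘ} {p} e
    ... | m , hubm , m≤b = high-intro m hubm (trn vp m≤b f)
    glueAt-trans (low , a) (mid , b) (top , c) e f = refl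
    glueAt-trans (low , a) (top , b) (top , c) e f = refl
    glueAt-trans (mid , a) (mid , b) (mid , c) e f = trn vp e f
    glueAt-trans (mid , a) (mid , b) (top , c) e f = refl
    glueAt-trans (mid , a) (top , b) (top , c) e f = refl
    glueAt-trans (top , a) (top , b) (top , c) e f = trn vq e f

    glue-valid : Valid hub G
    glue-valid .rfl i with view M i
    ... | place low a = glue-intro {p} {q} {low} {a} {low} {a} (==F-refl a)
    ... | place mid a = glue-intro {p} {q} {mid} {a} {mid} {a} (rfl vp a)
    ... | place top a = glue-intro {p} {q} {top} {a} {top} {a} (rfl vq a)
    glue-valid .trn {i} {j} {k} e f = trans (at-glue′ p q i k)
      (glueAt-trans (idx M i) (idx M j) (idx M k) (trans (sym (at-glue′ p q i j)) e) (trans (sym (at-glue′ p q j k)) f))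
    glue-valid .iso {i} {j} ¬hi j≤i with view M i | view M j
    ... | place low a | place low b = cong (ι low M) (==F-elim (glue-elim {p} {q} {low} {b} {low} {a} j≤i))
    ... | place low a | place mid b with () ← glue-elim {p} {q} {mid} {b} {low} {a} j≤i
    ... | place low a | place top b with () ← glue-elim {p} {q} {top} {b} {low} {a} j≤i
    ... | place mid a | place low b = ⊥-elim (¬hi (high-mid⁻ a (glue-elim {p} {q} {low} {b} {mid} {a} j≤i)))
    ... | place mid a | place mid b = cong (ι mid M)
        (iso vp (λ e → ¬hi (high-mid⁻ a e)) (glue-elim {p} {q} {mid} {b} {mid} {a} j≤i))
    ... | place mid a | place top b with () ← glue-elim {p} {q} {top} {b} {mid} {a} j≤i
    ... | place top a | _ = ⊥-elim (¬hi (high-top a))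
    glue-valid .cmp i j hi with view M i | view M j
    ... | place low a | _ = ⊥-elim (high-low a hi)
    ... | place mid a | place low b = inj₂ (glue-intro {p} {q} {low} {b} {mid} {a} (high-mid a hi))
    ... | place mid a | place mid b =
        [ inj₁ ∘ glue-intro {p} {q} {mid} {a} {mid} {b} , inj₂ ∘ glue-intro {p} {q} {mid} {b} {mid} {a} ]′
        (cmp vp a b (high-mid a hi))
    ... | place mid a | place top b = inj₁ (glue-intro {p} {q} {mid} {a} {top} {b} refl)
    ... | place top a | place low b = inj₂ (glue-intro {p} {q} {low} {b} {top} {a} refl)
    ... | place top a | place mid b = inj₂ (glue-intro {p} {q} {mid} {b} {top} {a} refl)
    ... | place top a | place top b =
        [ inj₁ ∘ glue-intro {p} {q} {top} {a} {top} {b} , inj₂ ∘ glue-intro {p} {q} {top} {b} {top} {a} ]′ (total-q a b)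

-- Classes, ranks and codimension.

high-self : ∀ {n} {hub : Fin n → Bool} {R} → Valid hub R → ∀ {h} → hub h ≡ true → high hub R h ≡ true
high-self v {h} hubh = high-intro h hubh (rfl v h)

high-up : ∀ {n} {hub : Fin n → Bool} {R} → Valid hub R → ∀ {i j} → high hub R i ≡ true → at R i j ≡ true → high hub
    R j ≡ true
high-up v hi i≤j with high-elim hi
... | h , hubh , h≤i = high-intro h hubh (trn v h≤i i≤j)

full-valid : ∀ {n} {hub : Fin n → Bool} {h} → hub h ≡ true → Valid hub full
full-valid hubh .rfl i = tab-intro refl
full-valid hubh .trn _ _ = tab-intro refl
full-valid hubh .iso ¬hi _ = ⊥-elim (¬hi (high-intro _ hubh (tab-intro refl)))
full-valid hubh .cmp i j _ = inj₁ (tab-intro refl)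

Valid-cong : ∀ {n} {hub hub′ : Fin n → Bool} {R} → (∀ i → hub i ≡ hub′ i) → Valid hub R → Valid hub′ R
Valid-cong {n} {hub} {hub′} {R} e v = record
  { rfl = rfl v ; trn = trn v ; iso = λ ¬hi → iso v (¬hi ∘ high→) ; cmp = λ i j hi → cmp v i j (high← hi) }
  where
  high→ : ∀ {i} → high hub R i ≡ true → high hub′ R i ≡ true
  high→ hi with high-elim hi
  ... | h , hubh , h≤ = high-intro h (trans (sym (e h)) hubh) h≤
  high← : ∀ {i} → high hub′ R i ≡ true → high hub R i ≡ true
  high← hi with high-elim hi
  ... | h , hubh , h≤ = high-intro h (trans (e h) hubh) h≤

⋢-witness : ∀ {n} {R Q : Mat n} → ¬ (R ⊑ Q) → ∃ λ i → ∃ λ j → at R i j ≡ true × ¬ (at Q i j ≡ true)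
⋢-witness {n} {R} {Q} ¬sub with anyFin? (λ i → any (λ j → at R i j ∧ not (at Q i j)) (allFin n))
... | inj₁ (i , e) with anyFin-elim e
...   | j , e′ = i , j , proj₁ (∧-elim e′) , not-elim (proj₂ (∧-elim {at R i j} e′))
⋢-witness {n} {R} {Q} ¬sub | inj₂ f = ⊥-elim (¬sub λ i j Rij →
  ∧-not-elim (λ e → f i (anyFin-intro j e)) Rij)

-- Classes of mutually comparable elements are counted by their members of least index.
opaque
  nonrep : ∀ {n} → Mat n → Fin n → Bool
  nonrep {n} R i = any (λ j → (toℕ j <ᵇ toℕ i) ∧ (at R j i ∧ at R i j)) (allFin n)

  nonrep-intro : ∀ {n} {R : Mat n} {i} j → toℕ j < toℕ i → at R j i ≡ true → at R i j ≡ true → nonrep R i ≡ true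
  nonrep-intro j j<i ji ij = anyFin-intro j (∧-intro (Equivalence.to T-≡ (<⇒<ᵇ j<i)) (∧-intro ji ij))

  nonrep-elim : ∀ {n} {R : Mat n} {i} → nonrep R i ≡ true → ∃ λ j → toℕ j < toℕ i × at R j i ≡ true × at R i j ≡ true
  nonrep-elim {R = R} {i} e with anyFin-elim e
  ... | j , e′ = j , <ᵇ⇒< _ _ (Equivalence.from T-≡ (proj₁ (∧-elim e′))) , ∧-elim (proj₂ (∧-elim {toℕ j <ᵇ toℕ i} e′))

-- A tubing with k proper tubes has k + 1 classes, so the number `rank` of remaining vertices is n -
-- 1 - k, the dimension of the face.
rank classes : ∀ {n} → Mat n → ℕ
rank R = count (nonrep R)
classes R = count (not ∘ nonrep R)

nonrep-mono : ∀ {n} {R Q : Mat n} → R ⊑ Q → ∀ i → nonrep R i ≡ true → nonrep Q i ≡ true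
nonrep-mono R⊑Q i e with nonrep-elim e
... | j , j<i , ji , ij = nonrep-intro j j<i (R⊑Q j i ji) (R⊑Q i j ij)

rank-mono : ∀ {n} {R Q : Mat n} → R ⊑ Q → rank R ≤ rank Q
rank-mono {R = R} {Q} R⊑Q = count-mono {p = nonrep R} {nonrep Q} (nonrep-mono R⊑Q)

module _ {n : ℕ} {hub : Fin n → Bool} {R : Mat n} (v : Valid hub R) where

  representative : ∀ i → ∃ λ r → ¬ (nonrep R r ≡ true) × at R r i ≡ true × at R i r ≡ true
  representative i = go i (<-wellFounded (toℕ i))
    where
    go : ∀ i → Acc _<_ (toℕ i) → ∃ λ r → ¬ (nonrep R r ≡ true) × at R r i ≡ true × at R i r ≡ true
    go i (acc rs) with true? (nonrep R i)
    ... | inj₂ f = i , (λ t → true≢false t f) , rfl v i , rfl v i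
    ... | inj₁ t with nonrep-elim t
    ...   | j , j<i , ji , ij with go j (rs j<i)
    ...     | r , ¬nr , rj , jr = r , ¬nr , trn v rj ji , trn v ij jr

module _ {n : ℕ} {hub : Fin n → Bool} {R Q : Mat n} (vR : Valid hub R) (vQ : Valid hub Q)
         {h₀ : Fin n} (hub-h₀ : hub h₀ ≡ true) (R⊑Q : R ⊑ Q) (¬Q⊑R : ¬ (Q ⊑ R)) where

  private
    low≤ : ∀ {i h} → ¬ (high hub R i ≡ true) → hub h ≡ true → at R i h ≡ true
    low≤ {i} {h} ¬hi hubh = [ (λ e → ⊥-elim (¬hi (high-intro h hubh e))) , id ]′ (cmp vR h i (high-self vR hubh))

  -- Let `i ≤ j` be new in `Q`. If one of them is high in `R`, comparability in `R` gives the
  -- opposite relation, and the two merge. If neither is, then `iso` for `Q` forces `j` to become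
  -- high in `Q`, and `j` merges with a hub that it already lay below in `R`.
  merged : ∃ λ u → ∃ λ w → at Q u w ≡ true × at Q w u ≡ true × ¬ (at R u w ≡ true)
  merged with ⋢-witness ¬Q⊑R
  ... | i , j , Qij , ¬Rij with true? (high hub R i) | true? (high hub R j)
  ...   | inj₁ hi | _ = i , j , Qij , [ ⊥-elim ∘ ¬Rij , R⊑Q j i ]′ (cmp vR i j hi) , ¬Rij
  ...   | inj₂ _ | inj₁ hj = i , j , Qij , [ R⊑Q j i , ⊥-elim ∘ ¬Rij ]′ (cmp vR j i hj) , ¬Rij
  ...   | inj₂ li | inj₂ lj with true? (high hub Q j)
  ...     | inj₂ lQj = ⊥-elim (¬Rij (subst (λ k → at R i k ≡ true) (iso vQ (λ t → true≢false t lQj) Qij) (rfl vR i)))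
  ...     | inj₁ hQj with high-elim hQj
  ...       | h , hubh , Qhj = h , j , Qhj , R⊑Q j h (low≤ (λ t → true≢false t lj) hubh)
                              , λ Rhj → true≢false (high-intro h hubh Rhj) lj

  -- When two classes merge, the representative of larger index stops being one.
  rank-strict : rank R < rank Q
  rank-strict with merged
  ... | u , w , Quw , Qwu , ¬Ruw with representative vR u | representative vR w
  ...   | r , ¬nr , ru , ur | s , ¬ns , sw , ws with <-cmp (toℕ r) (toℕ s)
  ...     | tri≈ _ e _ with refl ← FinP.toℕ-injective e = ⊥-elim (¬Ruw (trn vR ur sw))
  ...     | tri< r<s _ _ = count-strict {p = nonrep R} {nonrep Q} s (nonrep-mono R⊑Q)
                             (nonrep-intro r r<s (trn vQ (R⊑Q _ _ ru) (trn vQ Quw (R⊑Q _ _ ws)))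
                                                 (trn vQ (R⊑Q _ _ sw) (trn vQ Qwu (R⊑Q _ _ ur)))) ¬ns
  ...     | tri> _ _ s<r = count-strict {p = nonrep R} {nonrep Q} r (nonrep-mono R⊑Q)
                             (nonrep-intro s s<r (trn vQ (R⊑Q _ _ sw) (trn vQ Qwu (R⊑Q _ _ ur)))
                                                 (trn vQ (R⊑Q _ _ ru) (trn vQ Quw (R⊑Q _ _ ws)))) ¬nr

-- Used when `Split` lifts a hub `s` out of its class: the smaller member `i₀` is then also a hub
-- and keeps the vertices above it high. For the star it holds because the centre is vertex zero.
HubsInitial : ∀ {n} → (Fin n → Bool) → Set
HubsInitial hub = ∀ {i j} → toℕ i < toℕ j → hub j ≡ true → hub i ≡ true

-- A face of positive dimension contains a facet of itself: move one element s that is not the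
-- representative of its class strictly above that class.
module Split {n : ℕ} {hub : Fin n → Bool} (initial : HubsInitial hub) {Q : Mat n} (v : Valid hub Q)
             {s : Fin n} (nr : nonrep Q s ≡ true) where

  private
    i₀ = proj₁ (nonrep-elim nr)
    i₀<s = proj₁ (proj₂ (nonrep-elim nr))
    i₀≤s = proj₁ (proj₂ (proj₂ (nonrep-elim nr)))
    s≤i₀ = proj₂ (proj₂ (proj₂ (nonrep-elim nr)))

    i₀≢s : ¬ (i₀ ≡ s)
    i₀≢s e = <-irrefl (cong toℕ e) i₀<s

  opaque
    split : Mat n
    -- Drops the relations from `s` to the other members of its class. Testing `at Q j s` suffices,
    -- since the other half of equivalence is the entry being dropped.
    split = tab (λ i j → at Q i j ∧ not ((i ==F s) ∧ (at Q j s ∧ not (j ==F s))))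

    split-intro : ∀ {i j} → at Q i j ≡ true → (i ≡ s → at Q j s ≡ true → j ≡ s) → at split i j ≡ true
    split-intro {i} {j} Qij f = tab-intro
        (∧-intro Qij (not-intro λ e → not-elim (proj₂ (∧-elim {at Q j s} (proj₂ (∧-elim {i ==F s} e))))
      (subst (λ k → (k ==F s) ≡ true)
          (sym (f (==F-elim (proj₁ (∧-elim e))) (proj₁ (∧-elim (proj₂ (∧-elim {i ==F s} e)))))) (==F-refl s))))

    split-elim : ∀ {i j} → at split i j ≡ true → at Q i j ≡ true × (i ≡ s → at Q j s ≡ true → j ≡ s)
    split-elim {i} {j} e = proj₁ (∧-elim (tab-elim e)) , λ { refl Qjs →
      [ ==F-elim , (λ f → ⊥-elim (not-elim (proj₂ (∧-elim {at Q s j} (tab-elim e)))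
          (∧-intro (==F-refl s) (∧-intro Qjs (not-intro λ t → true≢false t f))))) ]′ (true? (j ==F s)) }

  split-⊑ : split ⊑ Q
  split-⊑ i j e = proj₁ (split-elim e)

  ¬⊑-split : ¬ (Q ⊑ split)
  ¬⊑-split f = i₀≢s (proj₂ (split-elim (f s i₀ s≤i₀)) refl i₀≤s)

  private
    high-split : ∀ {i} → high hub Q i ≡ true → high hub split i ≡ true
    high-split {i} e with high-elim e
    ... | h , hubh , h≤i with h Fin.≟ s
    ...   | no h≢s = high-intro h hubh (split-intro h≤i (λ h≡s → ⊥-elim (h≢s h≡s)))
    ...   | yes refl = high-intro i₀ (initial i₀<s hubh) (split-intro (trn v i₀≤s h≤i) (λ e → ⊥-elim (i₀≢s e)))

    high-split⁻ : ∀ {i} → high hub split i ≡ true → high hub Q i ≡ true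
    high-split⁻ e with high-elim e
    ... | h , hubh , h≤i = high-intro h hubh (split-⊑ _ _ h≤i)

    split-total : ∀ {i j} → at Q i j ≡ true → at split i j ≡ true ⊎ at split j i ≡ true
    split-total {i} {j} Qij with i Fin.≟ s | j Fin.≟ s
    ... | no i≢s | _ = inj₁ (split-intro Qij (λ e → ⊥-elim (i≢s e)))
    ... | yes _ | yes j≡s = inj₁ (split-intro Qij (λ _ _ → j≡s))
    ... | yes refl | no j≢s with true? (at Q j s)
    ...   | inj₁ Qjs = inj₂ (split-intro Qjs (λ e → ⊥-elim (j≢s e)))
    ...   | inj₂ f = inj₁ (split-intro Qij (λ _ t → ⊥-elim (true≢false t f)))

  split-valid : Valid hub split
  split-valid .rfl i = split-intro (rfl v i) (λ e _ → e)
  split-valid .trn {i} {j} {k} a b = split-intro (trn v (proj₁ (split-elim a)) (proj₁ (split-elim b))) ks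
    where
    ks : i ≡ s → at Q k s ≡ true → k ≡ s
    ks e Qks with proj₂ (split-elim a) e (trn v (proj₁ (split-elim b)) Qks)
    ... | j≡s = proj₂ (split-elim b) j≡s Qks
  split-valid .iso ¬hi j≤i = iso v (¬hi ∘ high-split) (split-⊑ _ _ j≤i)
  split-valid .cmp i j hi with cmp v i j (high-split⁻ hi)
  ... | inj₁ Qij = split-total Qij
  ... | inj₂ Qji = [ inj₂ , inj₁ ]′ (split-total Qji)

  rank-split : rank Q ≡ suc (rank split)
  rank-split = count-remove {p = nonrep split} {nonrep Q} s nr s-rep same
    where
    s-rep : ¬ (nonrep split s ≡ true)
    s-rep e with nonrep-elim e
    ... | j , j<s , js , sj = <-irrefl (cong toℕ (proj₂ (split-elim sj) refl (split-⊑ _ _ js))) j<s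
    same : ∀ i → ¬ i ≡ s → nonrep split i ≡ nonrep Q i
    same i i≢s = bool-ext (nonrep-mono split-⊑ i) back
      where
      back : nonrep Q i ≡ true → nonrep split i ≡ true
      back e with nonrep-elim e
      ... | j , j<i , ji , ij with j Fin.≟ s
      ...   | no j≢s = nonrep-intro j j<i (split-intro ji (λ e → ⊥-elim (j≢s e)))
          (split-intro ij (λ e → ⊥-elim (i≢s e)))
      -- If the smaller witness was `s` itself, `i₀` in the same class of `Q` is smaller still and
      -- has not been moved.
      ...   | yes refl = nonrep-intro i₀ (<-trans i₀<s j<i) (split-intro (trn v i₀≤s ji) (λ e → ⊥-elim (i₀≢s e)))
                                      (split-intro (trn v ij s≤i₀) (λ e → ⊥-elim (i≢s e)))

classes-full : ∀ {n} → Fin n → classes {n} full ≡ 1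
classes-full {suc n} _ = trans (count-cong {p = not ∘ nonrep full} {zero ==F_} (λ i → bool-ext (to i) (from i)))
    (count-at {n = suc n} zero)
  where
  to : ∀ i → not (nonrep full i) ≡ true → (zero ==F i) ≡ true
  to zero    e = refl
  to (suc i) e = ⊥-elim (not-elim e (nonrep-intro zero (s≤s z≤n) (tab-intro refl) (tab-intro refl)))
  from : ∀ i → (zero ==F i) ≡ true → not (nonrep full i) ≡ true
  from i e with refl ← ==F-elim {i = zero} {i} e = not-intro λ nr → ⊥-elim
      (n≮0 (proj₁ (proj₂ (nonrep-elim {R = full} nr))))

rank≤full : ∀ {n} (R : Mat n) → rank R ≤ rank {n} full
rank≤full R = rank-mono {R = R} {full} (λ i j _ → tab-intro refl)

-- Classes and rank add up to n both for `R` and for `full`, and `full` has a single class. The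
-- argument of type `Fin n` excludes n = 0, where there is no class at all.
suc-corank : ∀ {n} → Fin n → (R : Mat n) → suc (rank {n} full ∸ rank R) ≡ classes R
suc-corank {n} i R = begin
  suc (rank {n} full ∸ rank R)             ≡⟨ sym (+-∸-assoc 1 (rank≤full R)) ⟩
  suc (rank {n} full) ∸ rank R             ≡⟨ cong (λ k → k + rank {n} full ∸ rank R) (sym (classes-full i)) ⟩
  classes {n} full + rank {n} full ∸ rank R
      ≡⟨ cong (_∸ rank R) (trans (sym (count-not (nonrep (full {n})))) (count-not (nonrep R))) ⟩
  classes R + rank R ∸ rank R              ≡⟨ m+n∸n≡m (classes R) (rank R) ⟩
  classes R ∎
  where open ≡-Reasoning

count-colours : ∀ {n} (M : Vec Colour n) (p : Fin n → Bool) →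
                count p ≡ count (p ∘ ι low M) + (count (p ∘ ι mid M) + count (p ∘ ι top M))
count-colours []        p = refl
count-colours (low ∷ M) p = trans (cong (bit (p zero) +_) (count-colours M (p ∘ suc)))
  (sym (+-assoc (bit (p zero)) (count (p ∘ suc ∘ ι low M)) _))
count-colours (mid ∷ M) p = trans (cong (bit (p zero) +_) (count-colours M (p ∘ suc)))
  (move (bit (p zero)) (count (p ∘ suc ∘ ι low M)) (count (p ∘ suc ∘ ι mid M)) (count (p ∘ suc ∘ ι top M)))
  where
  move : ∀ b l m t → b + (l + (m + t)) ≡ l + (b + m + t)
  move = ℕSolver.solve-∀
count-colours (top ∷ M) p = trans (cong (bit (p zero) +_) (count-colours M (p ∘ suc)))
  (move (bit (p zero)) (count (p ∘ suc ∘ ι low M)) (count (p ∘ suc ∘ ι mid M)) (count (p ∘ suc ∘ ι top M)))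
  where
  move : ∀ b l m t → b + (l + (m + t)) ≡ l + (m + (b + t))
  move = ℕSolver.solve-∀

-- The interface between geometry and combinatorics. `dec` and `enc` are inverse only between listed
-- faces and valid preorders, because a carrier such as `List Bool` also has elements that are no
-- faces.
record IsModel {n} (hub : Fin n → Bool) (X : FinPoset) : Set where
  field
    unique    : Unique (elems X)
    dec       : Carrier X → Mat n
    enc       : Mat n → Carrier X
    dec-valid : ∀ {x} → x ∈ elems X → Valid hub (dec x)
    enc-∈     : ∀ {R} → Valid hub R → enc R ∈ elems X
    dec-enc   : ∀ {R} → Valid hub R → dec (enc R) ≡ R
    enc-dec   : ∀ {x} → x ∈ elems X → enc (dec x) ≡ x
    ≼⇒⊑       : ∀ {x y} → x ∈ elems X → y ∈ elems X → _≼_ X x y ≡ true → dec x ⊑ dec y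
    ⊑⇒≼       : ∀ {x y} → x ∈ elems X → y ∈ elems X → dec x ⊑ dec y → _≼_ X x y ≡ true
open IsModel

module _ {n : ℕ} {hub : Fin n → Bool} (initial : HubsInitial hub) {h₀ : Fin n} (hub-h₀ : hub h₀ ≡ true)
         {X : FinPoset} (mX : IsModel hub X) where

  private
    cover : ∀ {y r} → y ∈ elems X → rank (dec mX y) ≡ suc r →
            ∃ λ x → x ∈ elems X × _≼_ X x y ≡ true × ¬ (_≼_ X y x ≡ true) × rank (dec mX x) ≡ r
    cover {y} {r} y∈ e with anyFin? (nonrep (dec mX y))
    ... | inj₂ none = ⊥-elim (0≢1+n (trans (sym (n≤0⇒n≡0 (≤-trans
            (count-mono {p = nonrep (dec mX y)} {λ _ → false} (λ i t → ⊥-elim (none i t)))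
                (≤-reflexive (count-false n))))) e))
    ... | inj₁ (s , nr) = enc mX split , enc-∈ mX split-valid
          , ⊑⇒≼ mX (enc-∈ mX split-valid) y∈ (subst (_⊑ dec mX y) (sym (dec-enc mX split-valid)) split-⊑)
          , (λ y≼ → ¬⊑-split (subst (dec mX y ⊑_) (dec-enc mX split-valid) (≼⇒⊑ mX y∈ (enc-∈ mX split-valid) y≼)))
          , trans (cong rank (dec-enc mX split-valid)) (suc-injective (trans (sym rank-split) e))
      where open Split initial (dec-valid mX y∈) nr

    module R = Rank X (rank ∘ dec mX)
      (λ x∈ y∈ x≼y ¬y≼x → rank-strict (dec-valid mX x∈) (dec-valid mX y∈) hub-h₀ (≼⇒⊑ mX x∈ y∈ x≼y)
          (¬y≼x ∘ ⊑⇒≼ mX y∈ x∈))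
      cover

  -- `Rank` applied to `rank ∘ dec`, with `enc full` as the greatest face. The successor stands for
  -- the improper tube, which the classes count as well.
  suc-codim : ∀ {y} → y ∈ elems X → suc (codim X y) ≡ classes (dec mX y)
  suc-codim {y} y∈ = trans (cong suc
      (trans (R.codim≡ (enc-∈ mX vf) (λ x _ → subst (rank (dec mX x) ≤_) (sym (cong rank (dec-enc mX vf)))
      (rank≤full (dec mX x))) y∈)
      (cong (λ r → rank r ∸ rank (dec mX y)) (dec-enc mX vf))))
    (suc-corank h₀ (dec mX y))
    where vf = full-valid {hub = hub} hub-h₀

-- The colouring of a face, and the face as a product.

-- Membership in T₁: `at R i h` says that every tube containing `h` contains `i`, and over all hubs
-- this leaves the smallest tube containing a hub.
belowHubs : ∀ {n} → (Fin n → Bool) → Mat n → Fin n → Bool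
belowHubs {n} hub R i = all (λ h → not (hub h) ∨ at R i h) (allFin n)

-- The arguments are `high` and `belowHubs`. A vertex above no hub is comparable with every hub,
-- hence below all of them and inside T₁; failing to be high thus already makes it low.
colourOf : Bool → Bool → Colour
colourOf false _     = low
colourOf true  true  = mid
colourOf true  false = top

colouring : ∀ {n} → (Fin n → Bool) → Mat n → Vec Colour n
colouring hub R = tabulate (λ i → colourOf (high hub R i) (belowHubs hub R i))

module _ {n : ℕ} {hub : Fin n → Bool} {R : Mat n} where

  belowHubs-elim : ∀ {i} → belowHubs hub R i ≡ true → ∀ {h} → hub h ≡ true → at R i h ≡ true
  belowHubs-elim e {h} hubh = ⇒-elim (allFin-elim e h) hubh

  belowHubs-intro : ∀ {i} → (∀ h → hub h ≡ true → at R i h ≡ true) → belowHubs hub R i ≡ true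
  belowHubs-intro f = allFin-intro λ h → ⇒-intro (f h)

  lookup-colouring : ∀ i → Vec.lookup (colouring hub R) i ≡ colourOf (high hub R i) (belowHubs hub R i)
  lookup-colouring i = lookup∘tabulate _ i

colourOf-low : ∀ {a b} → colourOf a b ≡ low → ¬ (a ≡ true)
colourOf-low {true} {true} () _
colourOf-low {true} {false} () _

colourOf-mid : ∀ {a b} → colourOf a b ≡ mid → a ≡ true × b ≡ true
colourOf-mid {true} {true} _ = refl , refl

colourOf-top : ∀ {a b} → colourOf a b ≡ top → a ≡ true × ¬ (b ≡ true)
colourOf-top {true} {false} _ = refl , λ ()

-- Characterises the colourings that come from faces: a hub lies above itself, so it is not low, and
-- T₁ contains a hub, which is then mid. `colouring-glue` gives the converse.
record Admissible {n} (hub : Fin n → Bool) (M : Vec Colour n) : Set where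
  field
    hub≢low : ∀ i → ¬ (hub (ι low M i) ≡ true)
    m₀      : Fin (size mid M)
    hub-m₀  : hub (ι mid M m₀) ≡ true

ι-surj : ∀ {n} k (M : Vec Colour n) {i} → Vec.lookup M i ≡ k → ∃ λ j → i ≡ ι k M j
ι-surj k M {i} e with view M i
... | place l j with trans (sym (lookup-ι l M j)) e
...   | refl = j , refl

module Colouring {n : ℕ} {hub : Fin n → Bool} {R : Mat n} (v : Valid hub R) where

  private
    M = colouring hub R

    colour-ι : ∀ k j → colourOf (high hub R (ι k M j)) (belowHubs hub R (ι k M j)) ≡ k
    colour-ι k j = trans (sym (lookup-colouring {hub = hub} {R} (ι k M j))) (lookup-ι k M j)

    low-elim : ∀ j → ¬ (high hub R (ι low M j) ≡ true)
    low-elim j = colourOf-low {b = belowHubs hub R (ι low M j)} (colour-ι low j)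

    mid-elim : ∀ j → high hub R (ι mid M j) ≡ true × belowHubs hub R (ι mid M j) ≡ true
    mid-elim j = colourOf-mid (colour-ι mid j)

    top-elim : ∀ j → high hub R (ι top M j) ≡ true × ¬ (belowHubs hub R (ι top M j) ≡ true)
    top-elim j = colourOf-top (colour-ι top j)

  module _ {c : Fin n} (hub-c : hub c ≡ true) where

    -- `greatest` for the opposite relation finds a least hub. It lies below all hubs, so it is mid.
    admissible : Admissible hub M
    admissible with greatest (λ i j → at R j i) hub c hub-c (rfl v) (λ a b → trn v b a)
                      (λ {m} {j} hubm hubj _ → [ inj₂ , inj₁ ]′ (cmp v m j (high-self v hubm)))
    ... | h , hubh , _ , h≤ with ι-surj mid M (trans (lookup-colouring {hub = hub} {R} h)
            (cong₂ colourOf (high-self v hubh) (belowHubs-intro {hub = hub} {R} h≤)))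
    ...   | m , refl = record { hub≢low = λ i e → low-elim i (high-self v e) ; m₀ = m ; hub-m₀ = hubh }

    open Admissible admissible
    open Glue hub M hub≢low m₀ hub-m₀

    private
      fits : Fits R
      fits .Fits.ll {i} {j} e = trans (sym (cong proj₂′ (idx-ι low M i)))
          (trans (cong (λ x → proj₂′ (idx M x)) (iso v (low-elim j) e)) (cong proj₂′ (idx-ι low M j)))
        where
        -- Only the low case matters; the value `i` for the other colours is an arbitrary default
        -- that makes the function total.
        proj₂′ : Place M → Fin (size low M)
        proj₂′ (low , a) = a
        proj₂′ (mid , _) = i
        proj₂′ (top , _) = i
      fits .Fits.ml {i} {j} e = low-elim j (high-up v (proj₁ (mid-elim i)) e)
      fits .Fits.tl {i} {j} e = low-elim j (high-up v (proj₁ (top-elim i)) e)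
      fits .Fits.tm {i} {j} e = proj₂ (top-elim i)
          (belowHubs-intro λ h hubh → trn v e (belowHubs-elim (proj₂ (mid-elim j)) hubh))

      module r = Restrict v fits

    -- A mid vertex lies above some hub and below every hub, so any two are related through a hub.
    -- The face is therefore determined by its colouring and its preorder on top.
    restrict-mid-full : restrict mid M R ≡ full
    restrict-mid-full = ⊑-antisym ⊑-full λ i j _ → restrict-intro (mid≤ i j)
      where
      mid≤ : ∀ i j → at R (ι mid M i) (ι mid M j) ≡ true
      mid≤ i j with high-elim (proj₁ (mid-elim j))
      ... | h , hubh , h≤j = trn v (belowHubs-elim (proj₂ (mid-elim i)) hubh) h≤j

    top-valid : Valid allHubs (restrict top M R)
    top-valid = r.restrict-top-valid

    glue-top : glue full (restrict top M R) ≡ R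
    glue-top = trans (cong (λ p → glue p (restrict top M R)) (sym restrict-mid-full)) r.glue-restrict

module _ {n : ℕ} {hub : Fin n → Bool} {M : Vec Colour n} (adm : Admissible hub M) where
  open Admissible adm
  open Glue hub M hub≢low m₀ hub-m₀ public

  glue-full-valid : ∀ {q} → Valid allHubs q → Valid hub (glue full q)
  glue-full-valid vq = Valid-glue.glue-valid (full-valid {hub = hubₘ} hub-m₀) vq

  -- Makes the lists of faces belonging to different colourings disjoint.
  colouring-glue : ∀ {q} → Valid allHubs q → colouring hub (glue full q) ≡ M
  colouring-glue {q} vq = lookup-ext λ i → trans (lookup-colouring {hub = hub} {glue full q} i) (colour (view M i))
    where
    open Valid-glue (full-valid {hub = hubₘ} hub-m₀) vq
    b = belowHubs hub (glue full q)
    h = high hub (glue full q)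
    colour : ∀ {i} → View M i → colourOf (h i) (b i) ≡ Vec.lookup M i
    colour (place low a) = trans (cong (λ x → colourOf x (b (ι low M a))) (¬-not (high-low a))) (sym (lookup-ι low M a))
    colour (place mid a) = trans (cong₂ colourOf (high-mid⁻ a (high-intro m₀ hub-m₀ (tab-intro refl)))
        (belowHubs-intro {hub = hub} {glue full q} mid≤))
                             (sym (lookup-ι mid M a))
      where
      mid≤ : ∀ x → hub x ≡ true → at (glue full q) (ι mid M a) x ≡ true
      mid≤ x hubx with view M x
      ... | place low c = ⊥-elim (hub≢low c hubx)
      ... | place mid c = glue-intro {full} {q} {mid} {a} {mid} {c} (tab-intro refl)
      ... | place top c = glue-intro {full} {q} {mid} {a} {top} {c} refl
    colour (place top a) = trans (cong₂ colourOf (high-top a) (¬-not ¬below)) (sym (lookup-ι top M a))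
      where
      ¬below : ¬ (b (ι top M a) ≡ true)
      ¬below e with () ← glue-elim {full} {q} {top} {a} {mid} {m₀} (belowHubs-elim {hub = hub} {glue full q} e hub-m₀)

  -- Relations between different colours go one way only, so no class meets two colours: each low
  -- vertex is a class, mid is one class, and top has those of `q`.
  classes-glue : ∀ q → classes (glue full q) ≡ suc (size low M + classes q)
  classes-glue q = begin
    classes G ≡⟨ count-colours M (not ∘ nonrep G) ⟩
    count (not ∘ nonrep G ∘ ι low M) + (count (not ∘ nonrep G ∘ ι mid M) + count (not ∘ nonrep G ∘ ι top M))
      ≡⟨ cong₂ _+_ (trans (count-cong {p = not ∘ nonrep G ∘ ι low M} {λ _ → true} lows) (count-true (size low M)))
           (cong₂ _+_ (trans (count-cong {p = not ∘ nonrep G ∘ ι mid M} {not ∘ nonrep full} mids) (classes-full m₀))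
                      (count-cong {p = not ∘ nonrep G ∘ ι top M} {not ∘ nonrep q} tops)) ⟩
    size low M + suc (classes q) ≡⟨ +-suc (size low M) (classes q) ⟩
    suc (size low M + classes q) ∎
    where
    open ≡-Reasoning
    G = glue full q
    lows : ∀ i → not (nonrep G (ι low M i)) ≡ true
    lows i = not-intro ¬nr
      where
      ¬nr : ¬ (nonrep G (ι low M i) ≡ true)
      ¬nr e with nonrep-elim e
      ... | x , x<i , xi , ix with view M x
      ...   | place low a = <-irrefl (cong (toℕ ∘ ι low M) (==F-elim (glue-elim {full} {q} {low} {a} {low} {i} xi))) x<i
      ...   | place mid a with () ← glue-elim {full} {q} {mid} {a} {low} {i} xi
      ...   | place top a with () ← glue-elim {full} {q} {top} {a} {low} {i} xi
    mids : ∀ i → not (nonrep G (ι mid M i)) ≡ not (nonrep full i)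
    mids i = cong not (bool-ext to from)
      where
      to : nonrep G (ι mid M i) ≡ true → nonrep full i ≡ true
      to e with nonrep-elim e
      ... | x , x<i , xi , ix with view M x
      ...   | place low a with () ← glue-elim {full} {q} {mid} {i} {low} {a} ix
      ...   | place mid a = nonrep-intro a (ι-mono⁻ mid M x<i) (tab-intro refl) (tab-intro refl)
      ...   | place top a with () ← glue-elim {full} {q} {top} {a} {mid} {i} xi
      from : nonrep full i ≡ true → nonrep G (ι mid M i) ≡ true
      from e with nonrep-elim e
      ... | a , a<i , ai , ia = nonrep-intro (ι mid M a) (ι-mono mid M a<i)
              (glue-intro {full} {q} {mid} {a} {mid} {i} ai) (glue-intro {full} {q} {mid} {i} {mid} {a} ia)
    tops : ∀ i → not (nonrep G (ι top M i)) ≡ not (nonrep q i)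
    tops i = cong not (bool-ext to from)
      where
      to : nonrep G (ι top M i) ≡ true → nonrep q i ≡ true
      to e with nonrep-elim e
      ... | x , x<i , xi , ix with view M x
      ...   | place low a with () ← glue-elim {full} {q} {top} {i} {low} {a} ix
      ...   | place mid a with () ← glue-elim {full} {q} {top} {i} {mid} {a} ix
      ...   | place top a = nonrep-intro a (ι-mono⁻ top M x<i) (glue-elim {full} {q} {top} {a} {top} {i} xi)
                              (glue-elim {full} {q} {top} {i} {top} {a} ix)
      from : nonrep q i ≡ true → nonrep G (ι top M i) ≡ true
      from e with nonrep-elim e
      ... | a , a<i , ai , ia = nonrep-intro (ι top M a) (ι-mono top M a<i)
              (glue-intro {full} {q} {top} {a} {top} {i} ai) (glue-intro {full} {q} {top} {i} {top} {a} ia)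

  module _ {X Y Z : FinPoset}
           (mX : IsModel hub X) (mY : IsModel {size top M} allHubs Y) (mZ : IsModel hubₘ Z) where

    -- Whatever lies below a gluing is again a gluing, of its own restrictions. On mid the bound is
    -- `full`, so every tubing of the induced graph occurs; on top the restriction must stay below
    -- `dec mY g`. The two choices are independent.
    faceP-≅ : ∀ {g} → g ∈ elems Y → faceP X (enc mX (glue full (dec mY g))) ≅ (faceP Y g ×P Z)
    faceP-≅ {g} g∈ = ≅-intro (faceP X f) (faceP Y g ×P Z)
      (UniqueP.filter⁺ (T? ∘ below-f) (unique mX))
      (UniqueP.cartesianProduct⁺ (UniqueP.filter⁺ (T? ∘ below-g) (unique mY)) (unique mZ))
      to from to∈ from∈ from∘to to∘from order
      where
      F = glue full (dec mY g)
      f = enc mX F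
      vF = glue-full-valid (dec-valid mY g∈)
      f∈ = enc-∈ mX vF
      below-f : Carrier X → Bool
      below-f x = _≼_ X x f
      below-g : Carrier Y → Bool
      below-g y = _≼_ Y y g

      to : Carrier X → Carrier Y × Carrier Z
      to x = enc mY (restrict top M (dec mX x)) , enc mZ (restrict mid M (dec mX x))
      from : Carrier Y × Carrier Z → Carrier X
      from (y , z) = enc mX (glue (dec mZ z) (dec mY y))

      module In {x : Carrier X} (x∈′ : x ∈ elems (faceP X f)) where
        x∈ = proj₁ (∈-filterᵇ⁻ {p = below-f} {xs = elems X} x∈′)
        h = dec mX x
        h⊑F : h ⊑ F
        h⊑F = subst (h ⊑_) (dec-enc mX vF) (≼⇒⊑ mX x∈ f∈ (proj₂ (∈-filterᵇ⁻ {p = below-f} {xs = elems X} x∈′)))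
        open Restrict (dec-valid mX x∈) (⊑-glue⇒Fits h⊑F) public
        v-top = restrict-top-valid
        v-mid = restrict-mid-valid

      module Out {y : Carrier Y} {z : Carrier Z} (yz∈ : (y , z) ∈ elems (faceP Y g ×P Z)) where
        y∈′ = proj₁ (∈-cartesianProduct⁻ (filterᵇ below-g (elems Y)) (elems Z) yz∈)
        z∈ = proj₂ (∈-cartesianProduct⁻ (filterᵇ below-g (elems Y)) (elems Z) yz∈)
        y∈ = proj₁ (∈-filterᵇ⁻ {p = below-g} {xs = elems Y} y∈′)
        G = glue (dec mZ z) (dec mY y)
        vG : Valid hub G
        vG = Valid-glue.glue-valid (dec-valid mZ z∈) (dec-valid mY y∈)
        y⊑g : dec mY y ⊑ dec mY g
        y⊑g = ≼⇒⊑ mY y∈ g∈ (proj₂ (∈-filterᵇ⁻ {p = below-g} {xs = elems Y} y∈′))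

      to∈ : ∀ x → x ∈ elems (faceP X f) → to x ∈ elems (faceP Y g ×P Z)
      to∈ x x∈′ = ∈-cartesianProduct⁺
          (∈-filterᵇ⁺ {p = below-g} {xs = elems Y} (enc-∈ mY v-top) (⊑⇒≼ mY (enc-∈ mY v-top) g∈
          (subst₂ _⊑_ (sym (dec-enc mY v-top)) (restrict-top-glue full (dec mY g)) (restrict-mono top h⊑F))))
              (enc-∈ mZ v-mid)
        where open In x∈′

      from∈ : ∀ yz → yz ∈ elems (faceP Y g ×P Z) → from yz ∈ elems (faceP X f)
      from∈ (y , z) yz∈ = ∈-filterᵇ⁺ {p = below-f} {xs = elems X} (enc-∈ mX vG) (⊑⇒≼ mX (enc-∈ mX vG) f∈
          (subst₂ _⊑_ (sym (dec-enc mX vG)) (sym (dec-enc mX vF)) (glue-mono ⊑-full y⊑g)))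
        where open Out yz∈

      from∘to : ∀ x → x ∈ elems (faceP X f) → from (to x) ≡ x
      from∘to x x∈′ = trans (cong (enc mX) (trans (cong₂ glue (dec-enc mZ v-mid) (dec-enc mY v-top)) glue-restrict))
          (enc-dec mX x∈)
        where open In x∈′

      to∘from : ∀ yz → yz ∈ elems (faceP Y g ×P Z) → to (from yz) ≡ yz
      to∘from (y , z) yz∈ = cong₂ _,_
          (trans (cong (enc mY) (trans (cong (restrict top M) (dec-enc mX vG)) (restrict-top-glue _ _)))
              (enc-dec mY y∈))
          (trans (cong (enc mZ) (trans (cong (restrict mid M) (dec-enc mX vG)) (restrict-mid-glue _ _)))
              (enc-dec mZ z∈))
        where open Out yz∈

      order : ∀ x x′ → x ∈ elems (faceP X f) → x′ ∈ elems (faceP X f) → _≼_ X x x′ ≡ _≼_ (faceP Y g ×P Z) (to x) (to x′)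
      order x x′ x∈′ x′∈′ = bool-ext fwd bwd
        where
        module A = In x∈′
        module B = In x′∈′
        fwd : _≼_ X x x′ ≡ true → _≼_ (faceP Y g ×P Z) (to x) (to x′) ≡ true
        fwd e = ∧-intro
          (⊑⇒≼ mY (enc-∈ mY A.v-top) (enc-∈ mY B.v-top)
              (subst₂ _⊑_ (sym (dec-enc mY A.v-top)) (sym (dec-enc mY B.v-top)) (restrict-mono top h⊑)))
          (⊑⇒≼ mZ (enc-∈ mZ A.v-mid) (enc-∈ mZ B.v-mid)
              (subst₂ _⊑_ (sym (dec-enc mZ A.v-mid)) (sym (dec-enc mZ B.v-mid)) (restrict-mono mid h⊑)))
          where h⊑ = ≼⇒⊑ mX A.x∈ B.x∈ e
        bwd : _≼_ (faceP Y g ×P Z) (to x) (to x′) ≡ true → _≼_ X x x′ ≡ true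
        bwd e = ⊑⇒≼ mX A.x∈ B.x∈ (subst₂ _⊑_ A.glue-restrict B.glue-restrict (glue-mono
          (subst₂ _⊑_ (dec-enc mZ A.v-mid) (dec-enc mZ B.v-mid)
              (≼⇒⊑ mZ (enc-∈ mZ A.v-mid) (enc-∈ mZ B.v-mid) (proj₂ (∧-elim {_≼_ Y (proj₁ (to x)) (proj₁ (to x′))} e))))
          (subst₂ _⊑_ (dec-enc mY A.v-top) (dec-enc mY B.v-top)
              (≼⇒⊑ mY (enc-∈ mY A.v-top) (enc-∈ mY B.v-top) (proj₁ (∧-elim e))))))

-- Evaluating combinations, and sums over all faces.

module _ {A B : Set} where

  map-unique : ∀ (f : A → B) {xs} → (∀ {x y} → x ∈ xs → y ∈ xs → f x ≡ f y → x ≡ y) → Unique xs → Unique (map f xs)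
  map-unique f inj [] = []
  map-unique f {x ∷ xs} inj (x∉ ∷ u) = All.tabulate disjoint ∷ map-unique f (λ a b → inj (there a) (there b)) u
    where
    disjoint : ∀ {z} → z ∈ map f xs → ¬ (f x ≡ z)
    disjoint z∈ e with ∈-map⁻ f z∈
    ... | y , y∈ , refl = All.lookup x∉ y∈ (inj (here refl) (there y∈) e)

  -- `key` recovers from an entry the list it came from, so lists with different indices cannot
  -- overlap.
  concatMap-unique : ∀ (f : A → List B) (key : B → A) {xs} → Unique xs → (∀ {x} → x ∈ xs → Unique (f x)) →
                     (∀ {x y} → x ∈ xs → y ∈ f x → key y ≡ x) → Unique (concatMap f xs)
  concatMap-unique f key [] uf k = []
  concatMap-unique f key {x ∷ xs} (x∉ ∷ u) uf k =
    UniqueP.++⁺ (uf (here refl)) (concatMap-unique f key u (uf ∘ there) (k ∘ there)) disjoint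
    where
    disjoint : ∀ {y} → ¬ (y ∈ f x × y ∈ concatMap f xs)
    disjoint (y∈ , y∈′) with find (∈-concatMap⁻ f {xs = xs} y∈′)
    ... | x′ , x′∈ , y∈fx′ = All.lookup x∉ x′∈ (trans (sym (k (here refl) y∈)) (k (there x′∈) y∈fx′))

sgn-+ : ∀ a b → sgn (a + b) ≡ sgn a ℤ.* sgn b
sgn-+ zero    b = sym (ℤP.*-identityˡ (sgn b))
sgn-+ (suc a) b = trans (cong ℤ.-_ (sgn-+ a b)) (ℤP.neg-distribˡ-* (sgn a) (sgn b))

module _ (φ : FinPoset → ℤ) where

  evalC-++ : ∀ L M → evalC φ (L ++ M) ≡ evalC φ L ℤ.+ evalC φ M
  evalC-++ []            M = sym (ℤP.+-identityˡ _)
  evalC-++ ((c , X) ∷ L) M = trans (cong (ℤ._+_ (c ℤ.* φ X)) (evalC-++ L M)) (sym (ℤP.+-assoc (c ℤ.* φ X) _ _))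

  evalC-sumC : ∀ {A : Set} (f : A → Comb) xs → evalC φ (sumC (map f xs)) ≡ sumℤ (λ x → evalC φ (f x)) xs
  evalC-sumC f []       = refl
  evalC-sumC f (x ∷ xs) = trans (evalC-++ (f x) _) (cong (ℤ._+_ (evalC φ (f x))) (evalC-sumC f xs))

  evalC-scale : ∀ c L → evalC φ (scale c L) ≡ c ℤ.* evalC φ L
  evalC-scale c []            = sym (ℤP.*-zeroʳ c)
  evalC-scale c ((d , X) ∷ L) = trans (cong₂ ℤ._+_ (ℤP.*-assoc c d (φ X)) (evalC-scale c L))
      (sym (ℤP.*-distribˡ-+ c (d ℤ.* φ X) _))

  evalC-interior : ∀ X → evalC φ (interior X) ≡ sumℤ (λ f → sgn (codim X f) ℤ.* φ (faceP X f)) (elems X)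
  evalC-interior X = go (elems X)
    where
    go : ∀ xs → evalC φ (map (λ f → sgn (codim X f) , faceP X f) xs) ≡ sumℤ (λ f → sgn (codim X f) ℤ.* φ (faceP X f)) xs
    go []       = refl
    go (x ∷ xs) = cong (ℤ._+_ (sgn (codim X x) ℤ.* φ (faceP X x))) (go xs)

  -- The factor `Y` is absorbed into the functional. All products in the two identities have a
  -- single polytope on the right.
  evalC-⊗-single : ∀ L Y → evalC φ (L ⊗ single Y) ≡ evalC (λ X → φ (X ×P Y)) L
  evalC-⊗-single []            Y = refl
  evalC-⊗-single ((c , X) ∷ L) Y = cong₂ ℤ._+_ (cong (ℤ._* φ (X ×P Y)) (ℤP.*-identityʳ c)) (evalC-⊗-single L Y)

-- Summing over all faces of X by the colouring M of the first tube: the faces with colouring M are the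
-- gluings along M of a face of the permutohedron on the top vertices.
module Faces {n : ℕ} {hub : Fin n → Bool} (initial : HubsInitial hub) {h₀ : Fin n} (hub-h₀ : hub h₀ ≡ true)
             {X : FinPoset} (mX : IsModel hub X)
             (Π : ℕ → FinPoset) (mΠ : ∀ b → IsModel {b} allHubs (Π b))
             (Ms : List (Vec Colour n)) (Ms-unique : Unique Ms)
             (Ms-admissible : ∀ {M} → M ∈ Ms → Admissible hub M) (Ms-complete : ∀ {M} → Admissible hub M → M ∈ Ms)
             (Z : Vec Colour n → FinPoset) (mZ : ∀ {M} → M ∈ Ms → IsModel (hub ∘ ι mid M) (Z M))
             (φ : FinPoset → ℤ) (φ-inv : Invariant φ) where

  private
    face : ∀ M → Carrier (Π (size top M)) → Carrier X
    face M g = enc mX (GlueAt.glue hub M full (dec (mΠ _) g))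

    faces : Vec Colour n → List (Carrier X)
    faces M = map (face M) (elems (Π (size top M)))

    module At {M : Vec Colour n} (M∈ : M ∈ Ms) where
      adm = Ms-admissible M∈
      module _ {g : Carrier (Π (size top M))} (g∈ : g ∈ elems (Π (size top M))) where
        v-g : Valid allHubs (dec (mΠ _) g)
        v-g = dec-valid (mΠ _) g∈
        v : Valid hub (GlueAt.glue hub M full (dec (mΠ _) g))
        v = glue-full-valid adm v-g

    faces-unique : Unique (concatMap faces Ms)
    faces-unique = concatMap-unique faces (λ x → colouring hub (dec mX x)) Ms-unique
      (λ {M} M∈ → let open At M∈ in map-unique (face M) (λ {g} {g′} g∈ g′∈ e → trans (sym (enc-dec (mΠ _) g∈)) (trans
          (cong (enc (mΠ _)) (trans (sym (restrict-top-glue adm full _)) (trans (cong (restrict top M)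
            (trans (sym (dec-enc mX (v g∈))) (trans (cong (dec mX) e) (dec-enc mX (v g′∈)))))
                (restrict-top-glue adm full _))))
          (enc-dec (mΠ _) g′∈))) (unique (mΠ _)))
      key
      where
      key : ∀ {M x} → M ∈ Ms → x ∈ faces M → colouring hub (dec mX x) ≡ M
      key {M} M∈ x∈ with ∈-map⁻ (face M) x∈
      ... | g , g∈ , refl = trans (cong (colouring hub) (dec-enc mX (v g∈))) (colouring-glue adm (v-g g∈))
        where open At M∈

    to-faces : ∀ {x} → x ∈ elems X → x ∈ concatMap faces Ms
    to-faces {x} x∈ = ∈-concatMap⁺ faces
        (lose (Ms-complete (admissible hub-h₀))
        (subst (_∈ faces M) (trans (cong (λ q → enc mX (GlueAt.glue hub M full q))
        (dec-enc (mΠ _) (top-valid hub-h₀))) (trans (cong (enc mX) (glue-top hub-h₀)) (enc-dec mX x∈)))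
          (∈-map⁺ (face M) (enc-∈ (mΠ _) (top-valid hub-h₀)))))
      where
      M = colouring hub (dec mX x)
      open Colouring (dec-valid mX x∈)

    from-faces : ∀ {x} → x ∈ concatMap faces Ms → x ∈ elems X
    from-faces x∈ with find (∈-concatMap⁻ faces {xs = Ms} x∈)
    ... | M , M∈ , x∈M with ∈-map⁻ (face M) x∈M
    ...   | g , g∈ , refl = enc-∈ mX (v g∈)
      where open At M∈

    weight : Carrier X → ℤ
    weight f = sgn (codim X f) ℤ.* φ (faceP X f)

  faces-sum : evalC φ (interior X) ≡ sumℤ (λ M → sgn (size low M) ℤ.*
                sumℤ (λ g → sgn (classes (dec (mΠ (size top M)) g)) ℤ.* φ (faceP (Π (size top M)) g ×P Z M))
                    (elems (Π (size top M)))) Ms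
  faces-sum = begin
    evalC φ (interior X)              ≡⟨ evalC-interior φ X ⟩
    sumℤ weight (elems X)             ≡⟨ sumℤ-set weight (unique mX) faces-unique to-faces from-faces ⟩
    sumℤ weight (concatMap faces Ms)  ≡⟨ sumℤ-concatMap weight faces Ms ⟩
    sumℤ (λ M → sumℤ weight (faces M)) Ms ≡⟨ sumℤ-cong Ms fibre ⟩
    _ ∎
    where
    open ≡-Reasoning
    fibre : ∀ M → M ∈ Ms → sumℤ weight (faces M) ≡ sgn (size low M) ℤ.*
              sumℤ (λ g → sgn (classes (dec (mΠ (size top M)) g)) ℤ.* φ (faceP (Π (size top M)) g ×P Z M))
                  (elems (Π (size top M)))
    fibre M M∈ = trans (sumℤ-map weight (face M) (elems (Π (size top M))))
        (trans (sumℤ-cong (elems (Π (size top M))) term) (sym (sumℤ-* (sgn (size low M)) _ (elems (Π (size top M))))))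
      where
      open At M∈
      term : ∀ g → g ∈ elems (Π (size top M)) → weight (face M g) ≡
             sgn (size low M) ℤ.* (sgn (classes (dec (mΠ (size top M)) g)) ℤ.* φ (faceP (Π (size top M)) g ×P Z M))
      term g g∈ = trans (cong₂ ℤ._*_ (trans (cong sgn codim-f) (sgn-+ (size low M) _))
          (φ-inv _ _ (faceP-≅ adm mX (mΠ _) (mZ M∈) g∈)))
                        (ℤP.*-assoc (sgn (size low M)) _ _)
        where
        codim-f : codim X (face M g) ≡ size low M + classes (dec (mΠ (size top M)) g)
        codim-f = suc-injective (trans (suc-codim initial hub-h₀ mX (enc-∈ mX (v g∈)))
                    (trans (cong classes (dec-enc mX (v g∈))) (classes-glue adm _)))

-- Sums over words and multinomial coefficients

sumℤ-+ : ∀ {A : Set} (f g : A → ℤ) xs → sumℤ (λ x → f x ℤ.+ g x) xs ≡ sumℤ f xs ℤ.+ sumℤ g xs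
sumℤ-+ f g []       = refl
sumℤ-+ f g (x ∷ xs) = trans (cong (ℤ._+_ (f x ℤ.+ g x)) (sumℤ-+ f g xs))
    (interchange (f x) (g x) (sumℤ f xs) (sumℤ g xs))
  where
  interchange : ∀ a b c d → a ℤ.+ b ℤ.+ (c ℤ.+ d) ≡ a ℤ.+ c ℤ.+ (b ℤ.+ d)
  interchange = ℤSolver.solve-∀

-- The coefficient of x^n/n! in a product of two exponential generating functions, with `K a b` for
-- the product of their coefficients.
binomialSum : ℕ → (ℕ → ℕ → ℤ) → ℤ
binomialSum n K = sumℤ (λ a → ℤ.+ (n C a) ℤ.* K a (n ∸ a)) (upTo (suc n))

binomialSum-cong : ∀ n {K L : ℕ → ℕ → ℤ} → (∀ a b → K a b ≡ L a b) → binomialSum n K ≡ binomialSum n L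
binomialSum-cong n e = sumℤ-cong (upTo (suc n)) λ a _ → cong (ℤ._*_ (ℤ.+ (n C a))) (e a (n ∸ a))

binomialSum-+ : ∀ n (K L : ℕ → ℕ → ℤ) → binomialSum n (λ a b → K a b ℤ.+ L a b) ≡ binomialSum n K ℤ.+ binomialSum n L
binomialSum-+ n K L = trans (sumℤ-cong (upTo (suc n)) λ a _ → ℤP.*-distribˡ-+ (ℤ.+ (n C a)) (K a (n ∸ a)) (L a (n ∸ a)))
  (sumℤ-+ (λ a → ℤ.+ (n C a) ℤ.* K a (n ∸ a)) (λ a → ℤ.+ (n C a) ℤ.* L a (n ∸ a)) (upTo (suc n)))

private
  sum-upTo-suc : ∀ (f : ℕ → ℤ) n → sumℤ f (upTo (suc n)) ≡ f 0 ℤ.+ sumℤ (f ∘ suc) (upTo n)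
  sum-upTo-suc f n = cong (ℤ._+_ (f 0)) (trans (cong (sumℤ f) (sym (ListP.map-upTo suc n))) (sumℤ-map f suc (upTo n)))

  sum-upTo-last : ∀ (f : ℕ → ℤ) n → sumℤ f (upTo (suc n)) ≡ sumℤ f (upTo n) ℤ.+ f n
  sum-upTo-last f n = trans (cong (sumℤ f) (sym (ListP.upTo-∷ʳ n)))
    (trans (sumℤ-++ f (upTo n) (n ∷ [])) (cong (ℤ._+_ (sumℤ f (upTo n))) (ℤP.+-identityʳ (f n))))

  nC0≡1 : ∀ n → n C 0 ≡ 1
  nC0≡1 n = trans (nCk≡nC[n∸k] {0} {n} z≤n) (nCn≡1 n)

-- Pascal's rule, or the Leibniz rule for the derivative of a product. It mirrors the choice of the
-- first letter of a word.
binomialSum-suc : ∀ n K → binomialSum (suc n) K ≡ binomialSum n (λ a b → K (suc a) b) ℤ.+ binomialSum n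
    (λ a b → K a (suc b))
binomialSum-suc n K = begin
  binomialSum (suc n) K
    ≡⟨ sum-upTo-suc (λ a → ℤ.+ (suc n C a) ℤ.* K a (suc n ∸ a)) (suc n) ⟩
  first′ (suc n) ℤ.+ sumℤ (λ a → ℤ.+ (suc n C suc a) ℤ.* K (suc a) (n ∸ a)) (upTo (suc n))
    ≡⟨ cong₂ ℤ._+_ (cong (λ c → ℤ.+ c ℤ.* K 0 (suc n)) (trans (nC0≡1 (suc n)) (sym (nC0≡1 n))))
         (trans (sumℤ-cong (upTo (suc n)) (λ a _ → pascal a)) (sumℤ-+ left right (upTo (suc n)))) ⟩
  first′ n ℤ.+ (sumℤ left (upTo (suc n)) ℤ.+ sumℤ right (upTo (suc n)))
    ≡⟨ left-comm (first′ n) (sumℤ left (upTo (suc n))) (sumℤ right (upTo (suc n))) ⟩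
  sumℤ left (upTo (suc n)) ℤ.+ (first′ n ℤ.+ sumℤ right (upTo (suc n)))
    ≡⟨ cong (λ r → sumℤ left (upTo (suc n)) ℤ.+ (first′ n ℤ.+ r)) drop-last ⟩
  sumℤ left (upTo (suc n)) ℤ.+ (first′ n ℤ.+ sumℤ (λ a → ℤ.+ (n C suc a) ℤ.* K (suc a) (suc (n ∸ suc a))) (upTo n))
    ≡⟨ cong (ℤ._+_ (sumℤ left (upTo (suc n)))) (sym (sum-upTo-suc (λ a → ℤ.+ (n C a) ℤ.* K a (suc (n ∸ a))) n)) ⟩
  binomialSum n (λ a b → K (suc a) b) ℤ.+ binomialSum n (λ a b → K a (suc b)) ∎
  where
  open ≡-Reasoning
  first′ : ℕ → ℤ
  first′ m = ℤ.+ (m C 0) ℤ.* K 0 (suc n)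
  left right : ℕ → ℤ
  left a = ℤ.+ (n C a) ℤ.* K (suc a) (n ∸ a)
  right a = ℤ.+ (n C suc a) ℤ.* K (suc a) (n ∸ a)
  pascal : ∀ a → ℤ.+ (suc n C suc a) ℤ.* K (suc a) (n ∸ a) ≡ left a ℤ.+ right a
  pascal a = trans (cong (λ c → ℤ.+ c ℤ.* K (suc a) (n ∸ a)) (sym (nCk+nC[k+1]≡[n+1]C[k+1] n a)))
    (ℤP.*-distribʳ-+ (K (suc a) (n ∸ a)) (ℤ.+ (n C a)) (ℤ.+ (n C suc a)))
  left-comm : ∀ x y z → x ℤ.+ (y ℤ.+ z) ≡ y ℤ.+ (x ℤ.+ z)
  left-comm = ℤSolver.solve-∀
  drop-last : sumℤ right (upTo (suc n)) ≡ sumℤ (λ a → ℤ.+ (n C suc a) ℤ.* K (suc a) (suc (n ∸ suc a))) (upTo n)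
  -- The last term carries n C (n + 1) = 0; in the others a < n, so `n ∸ a` is a successor.
  drop-last = trans (sum-upTo-last right n) (trans (cong₂ ℤ._+_
      (sumℤ-cong (upTo n) (λ a a∈ → cong (λ b → ℤ.+ (n C suc a) ℤ.* K (suc a) b)
          (+-∸-assoc 1 {n} {suc a} (∈-upTo⁻ a∈))))
      (cong (λ c → ℤ.+ c ℤ.* K (suc n) (n ∸ n)) (k>n⇒nCk≡0 (n<1+n n))))
    (ℤP.+-identityʳ _))

words : List Colour → ∀ n → List (Vec Colour n)
words cs zero    = [] ∷ []
words cs (suc n) = concatMap (λ c → map (c ∷_) (words cs n)) cs

private
  tail-unique : ∀ {n} (c : Colour) {Ms : List (Vec Colour n)} → Unique Ms → Unique (map (c ∷_) Ms)
  tail-unique c = UniqueP.map⁺ (λ { refl → refl })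

words-unique : ∀ {cs} → Unique cs → ∀ n → Unique (words cs n)
words-unique u zero    = [] ∷ []
words-unique {cs} u (suc n) = concatMap-unique (λ c → map (c ∷_) (words cs n)) Vec.head u
    (λ {c} _ → tail-unique c (words-unique u n)) key
  where
  key : ∀ {c M} → c ∈ cs → M ∈ map (c ∷_) (words cs n) → Vec.head M ≡ c
  key {c} _ M∈ with ∈-map⁻ (c ∷_) M∈
  ... | _ , _ , refl = refl

∈-words : ∀ {cs n} (M : Vec Colour n) → (∀ i → Vec.lookup M i ∈ cs) → M ∈ words cs n
∈-words []      f = here refl
∈-words (c ∷ M) f = ∈-concatMap⁺ _ (lose (f zero) (∈-map⁺ (c ∷_) (∈-words M (f ∘ suc))))

words-∈ : ∀ {cs} n {M} → M ∈ words cs n → ∀ i → Vec.lookup M i ∈ cs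
words-∈ {cs} (suc n) M∈ i with find (∈-concatMap⁻ (λ c → map (c ∷_) (words cs n)) {xs = cs} M∈)
... | c , c∈ , M∈′ with ∈-map⁻ (c ∷_) M∈′
words-∈ (suc n) M∈ zero    | c , c∈ , M∈′ | M , M∈″ , refl = c∈
words-∈ (suc n) M∈ (suc i) | c , c∈ , M∈′ | M , M∈″ , refl = words-∈ n M∈″ i

words₂ words₃ : ∀ n → List (Vec Colour n)
words₂ = words (top ∷ mid ∷ [])
words₃ = words (low ∷ top ∷ mid ∷ [])

sum-words₂ : ∀ n (K : ℕ → ℕ → ℤ) → sumℤ (λ M → K (size top M) (size mid M)) (words₂ n) ≡ binomialSum n K
sum-words₂ zero    K = cong (ℤ._+ ℤ.0ℤ) (sym (ℤP.*-identityˡ (K 0 0)))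
sum-words₂ (suc n) K = begin
  sumℤ F (words₂ (suc n)) ≡⟨ sumℤ-concatMap F (λ c → map (c ∷_) (words₂ n)) (top ∷ mid ∷ []) ⟩
  sumℤ F (map (top ∷_) (words₂ n)) ℤ.+ (sumℤ F (map (mid ∷_) (words₂ n)) ℤ.+ ℤ.0ℤ)
    ≡⟨ cong₂ ℤ._+_ (trans (sumℤ-map F (top ∷_) (words₂ n)) (sum-words₂ n (λ a b → K (suc a) b)))
         (trans (ℤP.+-identityʳ _) (trans (sumℤ-map F (mid ∷_) (words₂ n)) (sum-words₂ n (λ a b → K a (suc b))))) ⟩
  binomialSum n (λ a b → K (suc a) b) ℤ.+ binomialSum n (λ a b → K a (suc b)) ≡⟨ sym (binomialSum-suc n K) ⟩
  binomialSum (suc n) K ∎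
  where
  open ≡-Reasoning
  F : ∀ {m} → Vec Colour m → ℤ
  F M = K (size top M) (size mid M)

-- The multinomial coefficient as a product of binomials: first the positions of `low`, then those
-- of `top` among the rest. This is the nesting of the sums in `rhs1`.
sum-words₃ : ∀ n (H : ℕ → ℕ → ℕ → ℤ) →
             sumℤ (λ M → H (size low M) (size top M) (size mid M)) (words₃ n) ≡ binomialSum n
                 (λ a r → binomialSum r (H a))
sum-words₃ zero    H = trans (ℤP.+-identityʳ (H 0 0 0)) (sym (trans (ℤP.+-identityʳ _) (trans (ℤP.*-identityˡ _)
  (trans (ℤP.+-identityʳ _) (ℤP.*-identityˡ _)))))
sum-words₃ (suc n) H = begin
  sumℤ F (words₃ (suc n)) ≡⟨ sumℤ-concatMap F (λ c → map (c ∷_) (words₃ n)) (low ∷ top ∷ mid ∷ []) ⟩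
  sumℤ F (map (low ∷_) (words₃ n)) ℤ.+
      (sumℤ F (map (top ∷_) (words₃ n)) ℤ.+ (sumℤ F (map (mid ∷_) (words₃ n)) ℤ.+ ℤ.0ℤ))
    ≡⟨ cong₂ ℤ._+_ (trans (sumℤ-map F (low ∷_) (words₃ n)) (sum-words₃ n (λ a b c → H (suc a) b c)))
        (cong₂ ℤ._+_ (trans (sumℤ-map F (top ∷_) (words₃ n)) (sum-words₃ n (λ a b c → H a (suc b) c)))
         (trans (ℤP.+-identityʳ _) (trans (sumℤ-map F (mid ∷_) (words₃ n)) (sum-words₃ n (λ a b c → H a b (suc c)))))) ⟩
  binomialSum n (λ a r → binomialSum r (H (suc a))) ℤ.+
    (binomialSum n (λ a r → binomialSum r (λ b c → H a (suc b) c)) ℤ.+ binomialSum n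
        (λ a r → binomialSum r (λ b c → H a b (suc c))))
    ≡⟨ cong (ℤ._+_ (binomialSum n (λ a r → binomialSum r (H (suc a)))))
         (trans (sym (binomialSum-+ n (λ a r → binomialSum r (λ b c → H a (suc b) c))
             (λ a r → binomialSum r (λ b c → H a b (suc c)))))
                (binomialSum-cong n (λ a r → sym (binomialSum-suc r (H a))))) ⟩
  binomialSum n (λ a r → binomialSum r (H (suc a))) ℤ.+ binomialSum n (λ a r → binomialSum (suc r) (H a))
    ≡⟨ sym (binomialSum-suc n (λ a r → binomialSum r (H a))) ⟩
  binomialSum (suc n) (λ a r → binomialSum r (H a)) ∎
  where
  open ≡-Reasoning
  F : ∀ {m} → Vec Colour m → ℤ
  F M = H (size low M) (size top M) (size mid M)

-- The words with at least one `mid`, which are the admissible colourings when every vertex is a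
-- hub.
words₂⁺ : ∀ n → List (Vec Colour n)
words₂⁺ zero    = []
words₂⁺ (suc n) = map (top ∷_) (words₂⁺ n) ++ map (mid ∷_) (words₂ n)

sum-words₂⁺ : ∀ n (K : ℕ → ℕ → ℤ) → sumℤ (λ M → K (size top M) (size mid M)) (words₂ n) ≡
              K n 0 ℤ.+ sumℤ (λ M → K (size top M) (size mid M)) (words₂⁺ n)
sum-words₂⁺ zero    K = refl
sum-words₂⁺ (suc n) K = begin
  sumℤ F (words₂ (suc n)) ≡⟨ sumℤ-concatMap F (λ c → map (c ∷_) (words₂ n)) (top ∷ mid ∷ []) ⟩
  sumℤ F (map (top ∷_) (words₂ n)) ℤ.+ (sumℤ F (map (mid ∷_) (words₂ n)) ℤ.+ ℤ.0ℤ)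
    ≡⟨ cong₂ ℤ._+_ (trans (sumℤ-map F (top ∷_) (words₂ n)) (trans (sum-words₂⁺ n (λ a b → K (suc a) b))
         (cong (ℤ._+_ (K (suc n) 0)) (sym (sumℤ-map F (top ∷_) (words₂⁺ n)))))) (ℤP.+-identityʳ _) ⟩
  K (suc n) 0 ℤ.+ sumℤ F (map (top ∷_) (words₂⁺ n)) ℤ.+ sumℤ F (map (mid ∷_) (words₂ n))
    ≡⟨ trans (ℤP.+-assoc (K (suc n) 0) _ _)
        (cong (ℤ._+_ (K (suc n) 0)) (sym (sumℤ-++ F (map (top ∷_) (words₂⁺ n)) _))) ⟩
  K (suc n) 0 ℤ.+ sumℤ F (words₂⁺ (suc n)) ∎
  where
  open ≡-Reasoning
  F : ∀ {m} → Vec Colour m → ℤ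
  F M = K (size top M) (size mid M)

-- Rational sums over vertex sets, and inequalities between powers of three.

-- Given in lowest terms, so that numerator and denominator are visible by computation; `ℕtoℚ`
-- passes through a normalisation.
nat : ℕ → ℚ
nat k = mkℚ (ℤ.+ k) 0 (Coprimality.sym (Coprimality.1-coprimeTo k))

ℕtoℚ≡nat : ∀ k → ℕtoℚ k ≡ nat k
ℕtoℚ≡nat k = ℚP.normalize-coprime (Coprimality.sym (Coprimality.1-coprimeTo k))

nat-+ : ∀ k l → nat (k + l) ≡ nat k ℚ.+ nat l
nat-+ k l = ℚP.toℚᵘ-injective (ℚᵘP.≃-trans (ℚᵘ.*≡* (ring (ℤ.+ k) (ℤ.+ l))) (ℚᵘP.≃-sym (ℚP.toℚᵘ-homo-+ (nat k) (nat l))))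
  where
  ring : ∀ a b → (a ℤ.+ b) ℤ.* ℤ.1ℤ ≡ (a ℤ.* ℤ.1ℤ ℤ.+ b ℤ.* ℤ.1ℤ) ℤ.* ℤ.1ℤ
  ring = ℤSolver.solve-∀

nat-* : ∀ k l → nat (k * l) ≡ nat k ℚ.* nat l
nat-* k l = ℚP.toℚᵘ-injective (ℚᵘP.≃-trans (ℚᵘ.*≡* (cong (ℤ._* ℤ.1ℤ) (ℤP.pos-* k l)))
    (ℚᵘP.≃-sym (ℚP.toℚᵘ-homo-* (nat k) (nat l))))

nat-≤ : ∀ {k l} → k ≤ l → nat k ℚ.≤ nat l
nat-≤ {k} {l} k≤l = ℚ.*≤* (subst₂ ℤ._≤_ (sym (ℤP.*-identityʳ (ℤ.+ k))) (sym (ℤP.*-identityʳ (ℤ.+ l))) (ℤ.+≤+ k≤l))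

nat-≤⁻ : ∀ {k l} → nat k ℚ.≤ nat l → k ≤ l
nat-≤⁻ {k} {l} (ℚ.*≤* e) = ℤP.drop‿+≤+ (subst₂ ℤ._≤_ (ℤP.*-identityʳ (ℤ.+ k)) (ℤP.*-identityʳ (ℤ.+ l)) e)

nat-< : ∀ {k l} → k < l → nat k ℚ.< nat l
nat-< {k} {l} k<l = ℚ.*<* (subst₂ ℤ._<_ (sym (ℤP.*-identityʳ (ℤ.+ k))) (sym (ℤP.*-identityʳ (ℤ.+ l))) (ℤ.+<+ k<l))

Σℚ : ∀ {n} → (Fin n → ℚ) → ℚ
Σℚ {zero}  f = 0ℚ
Σℚ {suc n} f = f zero ℚ.+ Σℚ (f ∘ suc)

Σℚ-cong : ∀ {n} {f g : Fin n → ℚ} → (∀ i → f i ≡ g i) → Σℚ f ≡ Σℚ g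
Σℚ-cong {zero}  e = refl
Σℚ-cong {suc n} e = cong₂ ℚ._+_ (e zero) (Σℚ-cong (e ∘ suc))

Σℚ-mono : ∀ {n} {f g : Fin n → ℚ} → (∀ i → f i ℚ.≤ g i) → Σℚ f ℚ.≤ Σℚ g
Σℚ-mono {zero}  h = ℚP.≤-refl
Σℚ-mono {suc n} h = ℚP.+-mono-≤ (h zero) (Σℚ-mono (h ∘ suc))

Σℚ-+ : ∀ {n} (f g : Fin n → ℚ) → Σℚ (λ i → f i ℚ.+ g i) ≡ Σℚ f ℚ.+ Σℚ g
Σℚ-+ {zero}  f g = sym (ℚP.+-identityˡ 0ℚ)
Σℚ-+ {suc n} f g = trans (cong (ℚ._+_ (f zero ℚ.+ g zero)) (Σℚ-+ (f ∘ suc) (g ∘ suc)))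
  (interchange (f zero) (g zero) (Σℚ (f ∘ suc)) (Σℚ (g ∘ suc)))
  where
  interchange : ∀ a b c d → a ℚ.+ b ℚ.+ (c ℚ.+ d) ≡ a ℚ.+ c ℚ.+ (b ℚ.+ d)
  interchange a b c d = trans (ℚP.+-assoc a b _) (trans (cong (ℚ._+_ a) (trans (sym (ℚP.+-assoc b c d))
    (trans (cong (ℚ._+ d) (ℚP.+-comm b c)) (ℚP.+-assoc c b d)))) (sym (ℚP.+-assoc a c _)))

on : Bool → ℚ → ℚ
on b q = if b then q else 0ℚ

Σ⟨_⟩ : ∀ {n} → (Fin n → Bool) → (Fin n → ℚ) → ℚ
Σ⟨ p ⟩ x = Σℚ (λ i → on (p i) (x i))

Σ⟨⟩-at : ∀ {n} (i : Fin n) x → Σ⟨ i ==F_ ⟩ x ≡ x i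
Σ⟨⟩-at {suc n} zero    x = trans (cong (ℚ._+_ (x zero)) (Σ-0 n)) (ℚP.+-identityʳ (x zero))
  where
  Σ-0 : ∀ m → Σℚ {m} (λ _ → 0ℚ) ≡ 0ℚ
  Σ-0 zero    = refl
  Σ-0 (suc m) = trans (ℚP.+-identityˡ _) (Σ-0 m)
Σ⟨⟩-at (suc i) x = trans (ℚP.+-identityˡ _)
    (trans (Σℚ-cong (λ j → cong (λ b → on b (x (suc j))) (==F-suc i j))) (Σ⟨⟩-at i (x ∘ suc)))

on-∨ : ∀ b c {q} → 0ℚ ℚ.≤ q → on (b ∨ c) q ℚ.≤ on b q ℚ.+ on c q
on-∨ true  true  {q} q≥0 = ℚP.≤-trans (ℚP.≤-reflexive (sym (ℚP.+-identityʳ q))) (ℚP.+-mono-≤ (ℚP.≤-refl {q}) q≥0)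
on-∨ true  false {q} q≥0 = ℚP.≤-reflexive (sym (ℚP.+-identityʳ q))
on-∨ false c     {q} q≥0 = ℚP.≤-reflexive (sym (ℚP.+-identityˡ (on c q)))

sumOver-Σ : ∀ {n} (S : SubsetB n) x → sumOver S x ≡ Σ⟨ memb S ⟩ x
sumOver-Σ S x = trans (cong (foldr ℚ._+_ 0ℚ) (ListP.map-tabulate id (λ i → on (memb S i) (x i))))
    (go (λ i → on (memb S i) (x i)))
  where
  go : ∀ {n} (f : Fin n → ℚ) → foldr ℚ._+_ 0ℚ (List.tabulate f) ≡ Σℚ f
  go {zero}  f = refl
  go {suc n} f = cong (ℚ._+_ (f zero)) (go (f ∘ suc))

Σ⟨⟩-const : ∀ {n} (p : Fin n → Bool) c → Σ⟨ p ⟩ (λ _ → c) ≡ nat (count p) ℚ.* c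
Σ⟨⟩-const {zero}  p c = sym (ℚP.*-zeroˡ c)
Σ⟨⟩-const {suc n} p c = begin
  on (p zero) c ℚ.+ Σ⟨ p ∘ suc ⟩ (λ _ → c)
      ≡⟨ cong₂ ℚ._+_ (bit-* (p zero)) (Σ⟨⟩-const (p ∘ suc) c) ⟩
  nat (bit (p zero)) ℚ.* c ℚ.+ nat (count (p ∘ suc)) ℚ.* c
      ≡⟨ sym (ℚP.*-distribʳ-+ c (nat (bit (p zero))) (nat (count (p ∘ suc)))) ⟩
  (nat (bit (p zero)) ℚ.+ nat (count (p ∘ suc))) ℚ.* c
      ≡⟨ cong (ℚ._* c) (sym (nat-+ (bit (p zero)) (count (p ∘ suc)))) ⟩
  nat (bit (p zero) + count (p ∘ suc)) ℚ.* c ∎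
  where
  open ≡-Reasoning
  bit-* : ∀ b → on b c ≡ nat (bit b) ℚ.* c
  bit-* true  = sym (ℚP.*-identityˡ c)
  bit-* false = sym (ℚP.*-zeroˡ c)

card≡count : ∀ {n} (S : SubsetB n) → card S ≡ count (memb S)
card≡count []          = refl
card≡count (true ∷ S)  = cong suc (card≡count S)
card≡count (false ∷ S) = card≡count S

_⊆_ : ∀ {n} → SubsetB n → SubsetB n → Set
S ⊆ T = ∀ i → memb S i ≡ true → memb T i ≡ true

⊆-antisym : ∀ {n} {S T : SubsetB n} → S ⊆ T → T ⊆ S → S ≡ T
⊆-antisym a b = lookup-ext λ i → bool-ext (a i) (b i)

setOf : ∀ {n} → (Fin n → Bool) → SubsetB n
setOf p = tabulate p

module _ {n : ℕ} {p : Fin n → Bool} {i : Fin n} where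

  setOf-intro : p i ≡ true → memb (setOf p) i ≡ true
  setOf-intro e = trans (lookup∘tabulate p i) e

  setOf-elim : memb (setOf p) i ≡ true → p i ≡ true
  setOf-elim e = trans (sym (lookup∘tabulate p i)) e

fullB-∈ : ∀ {n} i → memb (fullB n) i ≡ true
fullB-∈ i = lookup-replicate i true

∈-subsets : ∀ {n} (S : SubsetB n) → S ∈ subsets n
∈-subsets []          = here refl
∈-subsets (true ∷ S)  = ∈-++⁺ˡ (∈-map⁺ (true ∷_) (∈-subsets S))
∈-subsets (false ∷ S) = ∈-++⁺ʳ (map (true ∷_) (subsets _)) (∈-map⁺ (false ∷_) (∈-subsets S))

-- Two vertices of such a graph are joined through any hub, while the non-hubs are pairwise non-adjacent.
Conn : ∀ {n} → (Fin n → Bool) → SubsetB n → Set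
Conn hub S = (∃ λ h → hub h ≡ true × memb S h ≡ true) ⊎ (∃ λ i → memb S i ≡ true × (∀ j → memb S j ≡ true → j ≡ i))

zipWith-map : ∀ {A : Set} (f : Bool → A → Bool) (t : A → Bool) xs → zipWith f (map t xs) xs ≡ map (λ x → f (t x) x) xs
zipWith-map f t []       = refl
zipWith-map f t (x ∷ xs) = cong (f (t x) x ∷_) (zipWith-map f t xs)

-- Because 3^v + 3^v < 3^(v+1). With this, two crossing tight tubes would violate the inequality of
-- their union.
3^-+-< : ∀ {s t u} → s < u → t < u → 3 ^ s + 3 ^ t < 3 ^ u
3^-+-< {s} {t} {suc v} (s≤s s≤v) (s≤s t≤v) = begin-strict
  3 ^ s + 3 ^ t             ≤⟨ +-mono-≤ (^-monoʳ-≤ 3 s≤v) (^-monoʳ-≤ 3 t≤v) ⟩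
  3 ^ v + 3 ^ v             <⟨ +-monoʳ-< (3 ^ v)
      (m<m+n (3 ^ v) (subst (0 <_) (sym (+-identityʳ (3 ^ v))) (m^n>0 3 v))) ⟩
  3 ^ suc v                 ∎
  where open ≤-Reasoning

-- Above a hub of `U` all vertices are comparable, so a maximum can be found starting there; a
-- hub-free tube is a single vertex.
conn-top : ∀ {n} {hub : Fin n → Bool} {R} → Valid hub R → ∀ U → Conn hub U →
           ∃ λ m → memb U m ≡ true × (∀ j → memb U j ≡ true → at R j m ≡ true)
conn-top {R = R} v U (inj₂ (i , i∈U , f)) = i , i∈U , λ j j∈ → subst (λ k → at R k i ≡ true) (sym (f j j∈)) (rfl v i)
conn-top {R = R} v U (inj₁ (h , hubh , h∈)) with greatest (at R) (memb U) h h∈ (rfl v) (trn v)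
       (λ {m} {j} _ _ h≤m → cmp v m j (high-intro h hubh h≤m))
... | m , m∈ , _ , f = m , m∈ , f

n<3^n : ∀ n → n < 3 ^ n
n<3^n zero    = s≤s z≤n
n<3^n (suc n) = begin-strict
  suc n                    ≤⟨ n<3^n n ⟩
  3 ^ n                    <⟨ m<m+n (3 ^ n) (≤-trans (m^n>0 3 n) (m≤m+n (3 ^ n) _)) ⟩
  3 ^ suc n                ∎
  where open ≤-Reasoning

3*n≤3^n : ∀ n → 3 * n ≤ 3 ^ n
3*n≤3^n zero    = z≤n
3*n≤3^n (suc n) = *-monoʳ-≤ 3 (n<3^n n)

-- Strict convexity of m ↦ 3 ^ m - 1: its slope from 0 to t is below its slope from 0 to k.
slope-< : ∀ t e → let k = suc (suc t) + e in k * 3 ^ suc t + suc t < suc t * 3 ^ k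
slope-< t zero = begin-strict
  (2 + t + 0) * P + suc t       <⟨ +-monoʳ-< ((2 + t + 0) * P) (n<3^n (suc t)) ⟩
  (2 + t + 0) * P + P           ≡⟨ lhs t P ⟩
  (3 + t) * P                   ≤⟨ m≤m+n ((3 + t) * P) (2 * t * P) ⟩
  (3 + t) * P + 2 * t * P       ≡⟨ rhs t P ⟩
  suc t * (3 * P)               ≡⟨ cong (λ m → suc t * 3 ^ m) (sym (+-identityʳ (2 + t))) ⟩
  suc t * 3 ^ (2 + t + 0)       ∎
  where
  open ≤-Reasoning
  P = 3 ^ suc t
  lhs : ∀ t P → (2 + t + 0) * P + P ≡ (3 + t) * P
  lhs = ℕSolver.solve-∀
  rhs : ∀ t P → (3 + t) * P + 2 * t * P ≡ suc t * (3 * P)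
  rhs = ℕSolver.solve-∀
slope-< t (suc e) = begin-strict
  (2 + t + suc e) * P + suc t         ≡⟨ lhs t e P ⟩
  (k * P + suc t) + P                 <⟨ +-mono-<-≤ (slope-< t e) P≤ ⟩
  suc t * Q + suc t * Q               ≤⟨ m≤m+n _ (suc t * Q) ⟩
  suc t * Q + suc t * Q + suc t * Q   ≡⟨ rhs t Q ⟩
  suc t * (3 * Q)                     ≡⟨ cong (λ m → suc t * 3 ^ m) (sym (+-suc (2 + t) e)) ⟩
  suc t * 3 ^ (2 + t + suc e)         ∎
  where
  open ≤-Reasoning
  P = 3 ^ suc t
  k = 2 + t + e
  Q = 3 ^ k
  P≤ : P ≤ suc t * Q
  P≤ = ≤-trans (^-monoʳ-≤ 3 (≤-trans (n≤1+n (suc t)) (m≤m+n (2 + t) e))) (m≤m+n Q (t * Q))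
  lhs : ∀ t e P → (2 + t + suc e) * P + suc t ≡ ((2 + t + e) * P + suc t) + P
  lhs = ℕSolver.solve-∀
  rhs : ∀ t Q → suc t * Q + suc t * Q + suc t * Q ≡ suc t * (3 * Q)
  rhs = ℕSolver.solve-∀

-- Here `k` elements share what `w` leaves of 3^(d+k), and `t` of them belong to a set of size `s`:
-- their part must exceed 3^s. As w ≤ 3^d, it suffices that k * 3^s + t * 3^d < t * 3^(d+k). For t =
-- k this is `3^-+-<`; for t < k, after s ≤ d + t and division by 3^d, it is `slope-<`.
share-< : ∀ {s d t k w} → 1 ≤ t → t ≤ k → s < d + k → s ≤ d + t → w ≤ 3 ^ d → k * 3 ^ s < t * (3 ^ (d + k) ∸ w)
share-< {s} {d} {t} {k} {w} 1≤t t≤k s<D s≤ w≤ = begin-strict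
  k * 3 ^ s                       <⟨ m+n≤o⇒m≤o∸n (suc (k * 3 ^ s))
      (≤-trans (s≤s (+-monoʳ-≤ (k * 3 ^ s) (*-monoʳ-≤ t w≤))) (add t≤k 1≤t)) ⟩
  t * 3 ^ (d + k) ∸ t * w         ≡⟨ sym (*-distribˡ-∸ t (3 ^ (d + k)) w) ⟩
  t * (3 ^ (d + k) ∸ w)           ∎
  where
  open ≤-Reasoning
  add : t ≤ k → 1 ≤ t → k * 3 ^ s + t * 3 ^ d < t * 3 ^ (d + k)
  add t≤k 1≤t with m≤n⇒m<n∨m≡n t≤k
  add t≤k (s≤s {n = t′} _) | inj₂ refl = begin-strict
    k * 3 ^ s + k * 3 ^ d   ≡⟨ sym (*-distribˡ-+ k (3 ^ s) (3 ^ d)) ⟩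
    k * (3 ^ s + 3 ^ d)     <⟨ *-monoʳ-< k (3^-+-< s<D (m<m+n d (s≤s z≤n))) ⟩
    k * 3 ^ (d + k)         ∎
  add t≤k (s≤s {n = t′} _) | inj₁ t<k = begin-strict
    k * 3 ^ s + t * 3 ^ d           ≤⟨ +-monoˡ-≤ (t * 3 ^ d) (*-monoʳ-≤ k (^-monoʳ-≤ 3 s≤)) ⟩
    k * 3 ^ (d + t) + t * 3 ^ d     ≡⟨ cong (λ q → k * q + t * 3 ^ d) (^-distribˡ-+-* 3 d t) ⟩
    k * (3 ^ d * 3 ^ t) + t * 3 ^ d ≡⟨ collect k (3 ^ d) (3 ^ t) t ⟩
    3 ^ d * (k * 3 ^ t + t)         <⟨ *-monoʳ-< (3 ^ d) {{m^n≢0 3 d}}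
        (subst (λ k → k * 3 ^ t + t < t * 3 ^ k) (m+[n∸m]≡n t<k) (slope-< t′ (k ∸ suc t))) ⟩
    3 ^ d * (t * 3 ^ k)             ≡⟨ spread (3 ^ d) t (3 ^ k) ⟩
    t * (3 ^ d * 3 ^ k)             ≡⟨ cong (t *_) (sym (^-distribˡ-+-* 3 d k)) ⟩
    t * 3 ^ (d + k)                 ∎
    where
    collect : ∀ k a b t → k * (a * b) + t * a ≡ a * (k * b + t)
    collect = ℕSolver.solve-∀
    spread : ∀ a t b → a * (t * b) ≡ t * (a * b)
    spread = ℕSolver.solve-∀

-- 3^D - w distributed evenly among k elements; suc (pred k) = k, as k is positive whenever this is used.
share : ℕ → ℕ → ℕ → ℚ
share D w k = nat (3 ^ D ∸ w) ℚ.* ℚ.1/ nat (suc (pred k))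

k*share : ∀ D w {k} → 1 ≤ k → nat k ℚ.* share D w k ≡ nat (3 ^ D ∸ w)
k*share D w {suc k} (s≤s _) = begin
  nat (suc k) ℚ.* (q ℚ.* r) ≡⟨ cong (ℚ._*_ (nat (suc k))) (ℚP.*-comm q r) ⟩
  nat (suc k) ℚ.* (r ℚ.* q) ≡⟨ sym (ℚP.*-assoc (nat (suc k)) r q) ⟩
  nat (suc k) ℚ.* r ℚ.* q   ≡⟨ cong (ℚ._* q) (ℚP.*-inverseʳ (nat (suc k))) ⟩
  ℚ.1ℚ ℚ.* q                ≡⟨ ℚP.*-identityˡ q ⟩
  q ∎
  where
  open ≡-Reasoning
  q = nat (3 ^ D ∸ w)
  r = ℚ.1/ nat (suc k)

share≥0 : ∀ D w {k} → 1 ≤ k → 0ℚ ℚ.≤ share D w k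
share≥0 D w {suc k} 1≤k = ℚP.*-cancelˡ-≤-pos (nat (suc k))
    (subst₂ ℚ._≤_ (sym (ℚP.*-zeroʳ (nat (suc k)))) (sym (k*share D w {suc k} 1≤k)) (nat-≤ {0} z≤n))

-- A point whose tight tubes are exactly the lower sets of R: the total 3^|T| of each tube T is reached by
-- sharing what the tubes strictly inside T leave over equally among the remaining elements of T.
module Realise {n : ℕ} {hub : Fin n → Bool} {R : Mat n} (v : Valid hub R) where

  -- `dn u` is the smallest tube containing `u`, `sd u` the union of the tubes strictly inside it,
  -- and `cl u` the class of `u`, which shares the remainder.
  dn sd cl : Fin n → Fin n → Bool
  dn u j = at R j u
  sd u j = at R j u ∧ not (at R u j)
  cl u j = at R j u ∧ at R u j

  dn-bits : ∀ u j → bit (dn u j) ≡ bit (sd u j) + bit (cl u j)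
  dn-bits u j with at R j u | at R u j
  ... | true  | true  = refl
  ... | true  | false = refl
  ... | false | _     = refl

  D≡d+k : ∀ u → count (dn u) ≡ count (sd u) + count (cl u)
  D≡d+k u = count-+ {p = sd u} {cl u} (dn-bits u)

  1≤k : ∀ u → 1 ≤ count (cl u)
  1≤k u = count-pos {p = cl u} u (∧-intro (rfl v u) (rfl v u))

  hasHub : (Fin n → Bool) → Bool
  hasHub p = any (λ h → hub h ∧ p h) (allFin n)

  -- the value of x on a lower set
  weight : (Fin n → Bool) → ℕ
  weight p = if hasHub p then 3 ^ count p else 3 * count p

  weight-hub : ∀ {p h} → hub h ≡ true → p h ≡ true → weight p ≡ 3 ^ count p
  weight-hub {p} {h} hubh ph rewrite anyFin-intro {p = λ h → hub h ∧ p h} h (∧-intro hubh ph) = refl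

  weight-nohub : ∀ {p} → (∀ h → hub h ≡ true → ¬ (p h ≡ true)) → weight p ≡ 3 * count p
  weight-nohub {p} none with true? (hasHub p)
  ... | inj₂ e rewrite e = refl
  ... | inj₁ e with anyFin-elim {p = λ h → hub h ∧ p h} e
  ...   | h , e′ = ⊥-elim (none h (proj₁ (∧-elim e′)) (proj₂ (∧-elim {hub h} e′)))

  -- A lower set without hubs consists of singleton tubes, each of value 3. The bound shows that the
  -- subtraction in `x` is not truncated, and it is the hypothesis w ≤ 3^d of `share-<`.
  weight-≤ : ∀ p → weight p ≤ 3 ^ count p
  weight-≤ p with hasHub p
  ... | true  = ≤-refl
  ... | false = 3*n≤3^n (count p)

  weight-cong : ∀ {p q} → (∀ i → p i ≡ q i) → weight p ≡ weight q
  weight-cong {p} {q} e with anyFin? (λ h → hub h ∧ p h)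
  ... | inj₁ (h , e′) = trans (weight-hub {p} (proj₁ (∧-elim e′)) (proj₂ (∧-elim {hub h} e′)))
          (trans (cong (3 ^_) (count-cong e))
              (sym (weight-hub {q} (proj₁ (∧-elim e′)) (trans (sym (e h)) (proj₂ (∧-elim {hub h} e′))))))
  ... | inj₂ none = trans (weight-nohub {p} (λ h hubh ph → none h (∧-intro hubh ph)))
          (trans (cong (3 *_) (count-cong e))
              (sym (weight-nohub {q} (λ h hubh qh → none h (∧-intro hubh (trans (e h) qh))))))

  x : Fin n → ℚ
  x u = share (count (dn u)) (weight (sd u)) (count (cl u))

  x≥0 : ∀ u → 0ℚ ℚ.≤ x u
  x≥0 u = share≥0 (count (dn u)) (weight (sd u)) (1≤k u)

  x-class : ∀ {u w} → at R u w ≡ true → at R w u ≡ true → x u ≡ x w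
  x-class {u} {w} uw wu = cong₃ (count-cong dn≡) (weight-cong sd≡) (count-cong cl≡)
    where
    cong₃ : ∀ {a a′ b b′ c c′} → a ≡ a′ → b ≡ b′ → c ≡ c′ → share a b c ≡ share a′ b′ c′
    cong₃ refl refl refl = refl
    dn≡ : ∀ j → dn u j ≡ dn w j
    dn≡ j = bool-ext (λ e → trn v e uw) (λ e → trn v e wu)
    up≡ : ∀ j → at R u j ≡ at R w j
    up≡ j = bool-ext (λ e → trn v wu e) (λ e → trn v uw e)
    sd≡ : ∀ j → sd u j ≡ sd w j
    sd≡ j = cong₂ _∧_ (dn≡ j) (cong not (up≡ j))
    cl≡ : ∀ j → cl u j ≡ cl w j
    cl≡ j = cong₂ _∧_ (dn≡ j) (up≡ j)

  Σ-class : ∀ u p → (∀ j → p j ≡ true → cl u j ≡ true) → Σ⟨ p ⟩ x ≡ nat (count p) ℚ.* x u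
  Σ-class u p f = trans (Σℚ-cong same) (Σ⟨⟩-const p (x u))
    where
    same : ∀ j → on (p j) (x j) ≡ on (p j) (x u)
    same j with p j in e
    ... | false = refl
    ... | true  = x-class (proj₁ (∧-elim (f j e))) (proj₂ (∧-elim {at R j u} (f j e)))

  on-bits : ∀ a b c {q} → bit a ≡ bit b + bit c → on a q ≡ on b q ℚ.+ on c q
  on-bits true  true  false {q} _ = sym (ℚP.+-identityʳ q)
  on-bits true  false true  {q} _ = sym (ℚP.+-identityˡ q)
  on-bits false false false {q} _ = sym (ℚP.+-identityˡ 0ℚ)

  -- Induction on size. Without a hub each coordinate is 3. With a hub `p` has a greatest element
  -- `m`, so `p` is `dn m`: the induction hypothesis covers `sd m`, and the class of `m` fills up
  -- the total by construction.
  Σ-lower : ∀ p → (∀ {i j} → p j ≡ true → at R i j ≡ true → p i ≡ true) → Σ⟨ p ⟩ x ≡ nat (weight p)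
  Σ-lower p = go p (<-wellFounded (count p))
    where
    go : ∀ p → Acc _<_ (count p) → (∀ {i j} → p j ≡ true → at R i j ≡ true → p i ≡ true) → Σ⟨ p ⟩ x ≡ nat (weight p)
    go p (acc rs) lo with anyFin? (λ h → hub h ∧ p h)
    ... | inj₂ none = begin
        Σ⟨ p ⟩ x                   ≡⟨ Σℚ-cong const ⟩
        Σ⟨ p ⟩ (λ _ → nat 3)       ≡⟨ Σ⟨⟩-const p (nat 3) ⟩
        nat (count p) ℚ.* nat 3    ≡⟨ sym (nat-* (count p) 3) ⟩
        nat (count p * 3)          ≡⟨ cong nat
            (trans (*-comm (count p) 3) (sym (weight-nohub {p} (λ h hubh ph → none h (∧-intro hubh ph))))) ⟩
        nat (weight p) ∎
      where
      open ≡-Reasoning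
      const : ∀ j → on (p j) (x j) ≡ on (p j) (nat 3)
      const j with p j in pj
      ... | false = refl
      ... | true  = x≡3
        where
        ¬hi : ¬ (high hub R j ≡ true)
        ¬hi e with high-elim e
        ... | h , hubh , h≤j = none h (∧-intro hubh (lo pj h≤j))
        D≡1 : count (dn j) ≡ 1
        D≡1 = trans (count-cong {p = dn j} {j ==F_}
            (λ i → bool-ext (λ e → subst (λ k → (j ==F k) ≡ true) (sym (iso v ¬hi e)) (==F-refl j))
                (λ e → subst (λ k → at R k j ≡ true) (==F-elim {i = j} {i} e) (rfl v j)))) (count-at j)
        d≡0 : count (sd j) ≡ 0
        d≡0 = n≤0⇒n≡0 (+-cancelʳ-≤ 1 (count (sd j)) 0
            (≤-trans (+-monoʳ-≤ (count (sd j)) (1≤k j)) (≤-reflexive (trans (sym (D≡d+k j)) D≡1))))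
        k≡1 : count (cl j) ≡ 1
        k≡1 = trans (sym (cong (_+ count (cl j)) d≡0)) (trans (sym (D≡d+k j)) D≡1)
        w≡0 : weight (sd j) ≡ 0
        w≡0 = trans (weight-nohub {sd j} (λ h hubh e → ¬hi (high-intro h hubh (proj₁ (∧-elim e)))))
            (trans (cong (3 *_) d≡0) refl)
        x≡3 : x j ≡ nat 3
        -- The vertex is a tube of its own, and `share 1 0 1` computes to 3.
        x≡3 rewrite D≡1 | w≡0 | k≡1 = refl
    ... | inj₁ (h , e) with greatest (at R) p h (proj₂ (∧-elim {hub h} e)) (rfl v) (trn v)
             (λ {m} {j} _ _ h≤m → cmp v m j (high-intro h (proj₁ (∧-elim e)) h≤m))
    ...   | m , pm , h≤m , f = begin
        Σ⟨ p ⟩ x                                  ≡⟨ Σℚ-cong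
            (λ j → on-bits (p j) (sd m j) (cl m j) (trans (cong bit (p≡ j)) (dn-bits m j))) ⟩
        Σℚ (λ j → on (sd m j) (x j) ℚ.+ on (cl m j) (x j)) ≡⟨ Σℚ-+ (λ j → on (sd m j) (x j)) (λ j → on (cl m j) (x j)) ⟩
        Σ⟨ sd m ⟩ x ℚ.+ Σ⟨ cl m ⟩ x               ≡⟨ cong₂ ℚ._+_ (go (sd m) (rs smaller) sd-lower)
                                                      (trans (Σ-class m (cl m) (λ _ c → c))
                                                          (k*share (count (dn m)) (weight (sd m)) (1≤k m))) ⟩
        nat (weight (sd m)) ℚ.+ nat (3 ^ count (dn m) ∸ weight (sd m))
            ≡⟨ sym (nat-+ (weight (sd m)) (3 ^ count (dn m) ∸ weight (sd m))) ⟩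
        nat (weight (sd m) + (3 ^ count (dn m) ∸ weight (sd m))) ≡⟨ cong nat (m+[n∸m]≡n w≤) ⟩
        nat (3 ^ count (dn m))                    ≡⟨ cong (λ c → nat (3 ^ c)) (sym (count-cong p≡)) ⟩
        nat (3 ^ count p)                         ≡⟨ cong nat
            (sym (weight-hub {p} (proj₁ (∧-elim e)) (proj₂ (∧-elim {hub h} e)))) ⟩
        nat (weight p) ∎
      where
      open ≡-Reasoning
      p≡ : ∀ j → p j ≡ dn m j
      p≡ j = bool-ext (f j) (lo pm)
      w≤ : weight (sd m) ≤ 3 ^ count (dn m)
      w≤ = ≤-trans (weight-≤ (sd m)) (^-monoʳ-≤ 3
          (≤-trans (m≤m+n (count (sd m)) (count (cl m))) (≤-reflexive (sym (D≡d+k m)))))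
      smaller : count (sd m) < count p
      smaller = subst (count (sd m) <_) (trans (sym (D≡d+k m)) (sym (count-cong p≡))) (m<m+n (count (sd m)) (1≤k m))
      sd-lower : ∀ {i j} → sd m j ≡ true → at R i j ≡ true → sd m i ≡ true
      sd-lower {i} {j} e ij = ∧-intro (trn v ij (proj₁ (∧-elim e)))
          (not-intro λ mi → not-elim (proj₂ (∧-elim {at R j m} e)) (trn v mi ij))

  -- `S` has a greatest element `m` but misses something below it. The members of `S` in the class
  -- of `m` alone already exceed 3^|S|, and the other coordinates are nonnegative.
  Σ-not-lower : ∀ S → Conn hub S → ¬ (∀ {i j} → memb S j ≡ true → at R i j ≡ true → memb S i ≡ true) →
                nat (3 ^ count (memb S)) ℚ.< Σ⟨ memb S ⟩ x
  Σ-not-lower S c ¬lo with conn-top v S c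
  ... | m , m∈ , f with counterexample (dn m) (memb S) (λ g → ¬lo λ {i} {j} j∈ ij → g i (trn v ij (f j j∈)))
  ...   | i , i≤m , i∉ = ℚP.<-≤-trans strict mono
    where
    top∩ low∩ : Fin n → Bool
    top∩ j = memb S j ∧ at R m j
    low∩ j = memb S j ∧ not (at R m j)
    t = count top∩
    d = count (sd m)
    k = count (cl m)
    top⊆cl : ∀ j → top∩ j ≡ true → cl m j ≡ true
    top⊆cl j e = ∧-intro (f j (proj₁ (∧-elim e))) (proj₂ (∧-elim {memb S j} e))
    bits : ∀ a b → bit a ≡ bit (a ∧ not b) + bit (a ∧ b)
    bits true  true  = refl
    bits true  false = refl
    bits false _     = refl
    s≤d+t : count (memb S) ≤ d + t
    s≤d+t = ≤-trans (≤-reflexive (count-+ {p = low∩} {top∩} (λ j → bits (memb S j) (at R m j))))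
      (+-monoˡ-≤ t (count-mono {p = low∩} {sd m}
          (λ j e → ∧-intro (f j (proj₁ (∧-elim e))) (proj₂ (∧-elim {memb S j} e)))))
    s<d+k : count (memb S) < d + k
    s<d+k = subst (count (memb S) <_) (D≡d+k m) (count-strict {p = memb S} {dn m} i f i≤m i∉)
    key : k * 3 ^ count (memb S) < t * (3 ^ count (dn m) ∸ weight (sd m))
    key = subst (λ D → k * 3 ^ count (memb S) < t * (3 ^ D ∸ weight (sd m))) (sym (D≡d+k m))
      (share-< {count (memb S)} {d} (count-pos {p = top∩} m (∧-intro m∈ (rfl v m)))
          (count-mono {p = top∩} {cl m} top⊆cl) s<d+k s≤d+t (weight-≤ (sd m)))
    strict : nat (3 ^ count (memb S)) ℚ.< Σ⟨ top∩ ⟩ x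
    -- Multiplication by `k` clears the denominator of `x m` and leaves the inequality `key` between
    -- natural numbers.
    strict = ℚP.*-cancelˡ-<-nonNeg (nat k) (subst₂ ℚ._<_ (nat-* k (3 ^ count (memb S))) (sym scaled) (nat-< key))
      where
      open ≡-Reasoning
      scaled : nat k ℚ.* Σ⟨ top∩ ⟩ x ≡ nat (t * (3 ^ count (dn m) ∸ weight (sd m)))
      scaled = begin
        nat k ℚ.* Σ⟨ top∩ ⟩ x            ≡⟨ cong (ℚ._*_ (nat k)) (Σ-class m top∩ top⊆cl) ⟩
        nat k ℚ.* (nat t ℚ.* x m)        ≡⟨ sym (ℚP.*-assoc (nat k) (nat t) (x m)) ⟩
        nat k ℚ.* nat t ℚ.* x m          ≡⟨ cong (ℚ._* x m) (ℚP.*-comm (nat k) (nat t)) ⟩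
        nat t ℚ.* nat k ℚ.* x m          ≡⟨ ℚP.*-assoc (nat t) (nat k) (x m) ⟩
        nat t ℚ.* (nat k ℚ.* x m)        ≡⟨ cong (ℚ._*_ (nat t)) (k*share (count (dn m)) (weight (sd m)) (1≤k m)) ⟩
        nat t ℚ.* nat (3 ^ count (dn m) ∸ weight (sd m)) ≡⟨ sym (nat-* t _) ⟩
        nat (t * (3 ^ count (dn m) ∸ weight (sd m))) ∎
    mono : Σ⟨ top∩ ⟩ x ℚ.≤ Σ⟨ memb S ⟩ x
    mono = Σℚ-mono λ j → on-∧ (memb S j) (at R m j) (x≥0 j)
      where
      on-∧ : ∀ a b {q} → 0ℚ ℚ.≤ q → on (a ∧ b) q ℚ.≤ on a q
      on-∧ true  true  _   = ℚP.≤-refl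
      on-∧ true  false q≥0 = q≥0
      on-∧ false _     _   = ℚP.≤-refl

-- Tight sets of the polytope correspond to tubing preorders.

module Tubes {n : ℕ} (Γ : Graph n) (hub : Fin n → Bool) (Γ-hub : ∀ i j → Γ i j ≡ not (i ==F j) ∧ (hub i ∨ hub j))
             {h₀ : Fin n} (hub-h₀ : hub h₀ ≡ true) where

  private
    Γ-intro : ∀ {i j} → ¬ (i ≡ j) → hub i ≡ true ⊎ hub j ≡ true → Γ i j ≡ true
    Γ-intro {i} {j} i≢j h = trans (Γ-hub i j)
        (∧-intro (not-intro (i≢j ∘ ==F-elim)) ([ ∨-introˡ , ∨-introʳ {hub i} ]′ h))

    Γ-elim : ∀ {i j} → Γ i j ≡ true → hub i ≡ true ⊎ hub j ≡ true
    Γ-elim {i} {j} e = ∨-elim (proj₂ (∧-elim {not (i ==F j)} (trans (sym (Γ-hub i j)) e)))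

    module _ (S : SubsetB n) where

      step-self : ∀ R {j} → memb R j ≡ true → memb (stepR Γ S R) j ≡ true
      step-self R {j} e = setOf-intro {p = λ j → memb R j ∨ (memb S j ∧ any (λ i → memb R i ∧ Γ i j) (allFin n))}
          (∨-introˡ e)

      step-edge : ∀ R {i j} → memb R i ≡ true → Γ i j ≡ true → memb S j ≡ true → memb (stepR Γ S R) j ≡ true
      step-edge R {i} {j} i∈R ij j∈S = setOf-intro
          {p = λ j → memb R j ∨ (memb S j ∧ any (λ i → memb R i ∧ Γ i j) (allFin n))}
          (∨-introʳ {memb R j} (∧-intro j∈S (anyFin-intro {p = λ i → memb R i ∧ Γ i j} i (∧-intro i∈R ij))))

      step-elim : ∀ R {j} → memb (stepR Γ S R) j ≡ true → memb R j ≡ true ⊎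
          (memb S j ≡ true × ∃ λ i → memb R i ≡ true × Γ i j ≡ true)
      step-elim R {j} e with ∨-elim {memb R j}
          (setOf-elim {p = λ j → memb R j ∨ (memb S j ∧ any (λ i → memb R i ∧ Γ i j) (allFin n))} e)
      ... | inj₁ r = inj₁ r
      ... | inj₂ r with anyFin-elim {p = λ i → memb R i ∧ Γ i j} (proj₂ (∧-elim {memb S j} r))
      ...   | i , e′ = inj₂ (proj₁ (∧-elim r) , i , ∧-elim {memb R i} e′)

      iter-self : ∀ k R {j} → memb R j ≡ true → memb (iterR k Γ S R) j ≡ true
      iter-self zero    R e = e
      iter-self (suc k) R e = iter-self k (stepR Γ S R) (step-self R e)

      -- Every edge has a hub at one end, so inside a hub-free set the search cannot leave its
      -- starting vertex.
      stuck : (∀ h → hub h ≡ true → ¬ (memb S h ≡ true)) → ∀ {i} → memb S i ≡ true → ∀ k R →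
              (∀ j → memb R j ≡ true → j ≡ i) → ∀ j → memb (iterR k Γ S R) j ≡ true → j ≡ i
      stuck nohub i∈S zero    R f j e = f j e
      stuck nohub {i} i∈S (suc k) R f j e = stuck nohub i∈S k (stepR Γ S R) f′ j e
        where
        f′ : ∀ j → memb (stepR Γ S R) j ≡ true → j ≡ i
        f′ j e with step-elim R e
        ... | inj₁ r = f j r
        ... | inj₂ (j∈S , x , x∈R , xj) with refl ← f x x∈R =
          ⊥-elim ([ (λ hx → nohub x hx i∈S) , (λ hj → nohub j hj j∈S) ]′ (Γ-elim xj))

    reach : ∀ {S : SubsetB n} {h i j} → hub h ≡ true → memb S h ≡ true → memb S i ≡ true → memb S j ≡ true →
            memb (iterR n Γ S (singletonB i)) j ≡ true
    reach {S} {h} {i} {j} hubh h∈ i∈ j∈ with i Fin.≟ j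
    ... | yes refl = iter-self S n (singletonB i) (setOf-intro {p = i ==F_} (==F-refl i))
    -- Distinct vertices force n ≥ 2, so the n rounds of the search include the two that lead
    -- through the hub.
    ... | no i≢j = two (two≤ i≢j)
      where
      two≤ : ∀ {m} {a b : Fin m} → ¬ (a ≡ b) → ∃ λ k → m ≡ suc (suc k)
      two≤ {suc zero} {zero} {zero} ne = ⊥-elim (ne refl)
      two≤ {suc (suc k)} _ = k , refl
      near : ∀ R {a b} → memb R a ≡ true → memb S b ≡ true → hub a ≡ true ⊎ hub b ≡ true → memb (stepR Γ S R) b ≡ true
      near R {a} {b} a∈R b∈S hubs with a Fin.≟ b
      ... | yes refl = step-self S R a∈R
      ... | no a≢b = step-edge S R a∈R (Γ-intro a≢b hubs) b∈S
      two : (∃ λ k → n ≡ suc (suc k)) → memb (iterR n Γ S (singletonB i)) j ≡ true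
      two (k , e) = subst (λ m → memb (iterR m Γ S (singletonB i)) j ≡ true) (sym e)
        (iter-self S k _ (near (stepR Γ S (singletonB i)) {h} {j}
            (near (singletonB i) {i} {h} (setOf-intro {p = i ==F_} (==F-refl i)) h∈ (inj₂ hubh)) j∈ (inj₁ hubh)))

  connected-elim : ∀ {S} → connectedB Γ S ≡ true → Conn hub S
  connected-elim {S} e with anyFin-elim {p = memb S} (proj₁ (∧-elim e)) | anyFin? (λ h → hub h ∧ memb S h)
  ... | _ | inj₁ (h , e′) = inj₁ (h , ∧-elim {hub h} e′)
  ... | i , i∈ | inj₂ none = inj₂
      (i , i∈ , λ j j∈ → stuck S (λ h hubh h∈ → none h (∧-intro hubh h∈)) i∈ n (singletonB i)
          (λ k k∈ → sym (==F-elim {i = i} {k} (setOf-elim {p = i ==F_} k∈))) j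
          (⇒-elim {memb S j} (allFin-elim {p = λ j → not (memb S j) ∨ to i j}
              (⇒-elim {memb S i} (allFin-elim {p = λ i → not (memb S i) ∨ from i}
            (proj₂ (∧-elim {any (memb S) (allFin n)} e)) i) i∈) j) j∈))
    where
    to : Fin n → Fin n → Bool
    to i j = memb (iterR n Γ S (singletonB i)) j
    from : Fin n → Bool
    from i = all (λ j → not (memb S j) ∨ to i j) (allFin n)

  connected-intro : ∀ {S} → Conn hub S → connectedB Γ S ≡ true
  connected-intro {S} c = ∧-intro (anyFin-intro {p = memb S} (proj₁ (inhabitant c)) (proj₂ (inhabitant c)))
    (allFin-intro {p = λ i → not (memb S i) ∨ from i} λ i → ⇒-intro {b = from i} λ i∈ →
      allFin-intro {p = λ j → not (memb S j) ∨ to i j} λ j → ⇒-intro {b = to i j} λ j∈ → go c i∈ j∈)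
    where
    to : Fin n → Fin n → Bool
    to i j = memb (iterR n Γ S (singletonB i)) j
    from : Fin n → Bool
    from i = all (λ j → not (memb S j) ∨ to i j) (allFin n)
    inhabitant : Conn hub S → ∃ λ i → memb S i ≡ true
    inhabitant (inj₁ (h , _ , h∈)) = h , h∈
    inhabitant (inj₂ (i , i∈ , _)) = i , i∈
    go : Conn hub S → ∀ {i j} → memb S i ≡ true → memb S j ≡ true → memb (iterR n Γ S (singletonB i)) j ≡ true
    go (inj₁ (h , hubh , h∈)) i∈ j∈ = reach hubh h∈ i∈ j∈
    go (inj₂ (k , _ , f)) {i} {j} i∈ j∈ = iter-self S n (singletonB i)
        (setOf-intro {p = i ==F_} (subst (λ l → (i ==F l) ≡ true) (trans (f i i∈) (sym (f j j∈))) (==F-refl i)))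

  tube-intro : ∀ {S k} → Conn hub S → ¬ (memb S k ≡ true) → S ∈ constraints n Γ
  tube-intro {S} {k} c k∉ = ∈-filterᵇ⁺ {p = λ S → connectedB Γ S ∧ not (card S ≡ᵇ n)} (∈-subsets S)
      (∧-intro (connected-intro c) (not-intro λ e →
    <-irrefl (trans (sym (card≡count S)) (trans (≡ᵇ⇒≡ _ _ (Equivalence.from T-≡ e)) (sym (count-true n))))
             (count-strict {p = memb S} {λ _ → true} k (λ _ _ → refl) refl k∉)))

  tube-elim : ∀ {S} → S ∈ constraints n Γ → Conn hub S × ∃ λ k → ¬ (memb S k ≡ true)
  tube-elim {S} S∈ with ∧-elim {connectedB Γ S}
      (proj₂ (∈-filterᵇ⁻ {p = λ S → connectedB Γ S ∧ not (card S ≡ᵇ n)} {xs = subsets n} S∈))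
  ... | c , e with anyFin? (λ k → not (memb S k))
  ...   | inj₁ (k , k∉) = connected-elim c , k , not-elim k∉
  ...   | inj₂ none = ⊥-elim (not-elim e (Equivalence.to T-≡ (≡⇒≡ᵇ _ _ (trans (card≡count S)
            (trans (count-cong {p = memb S} {λ _ → true} (λ i → ∧-not-elim {true} (none i) refl))
                   (count-true n))))))

  tubes : List (SubsetB n)
  tubes = constraints n Γ

  decode : List Bool → Mat n
  decode T = tab (λ i j → and (zipWith (λ b S → not b ∨ (not (memb S j) ∨ memb S i)) T tubes))

  -- Stated for lists `map t tubes`, the form of every tight set, since `zipWith` cuts off lists of
  -- unequal length.
  decode-elim : ∀ t {i j} → at (decode (map t tubes)) i j ≡ true → ∀ S → S ∈ tubes → t S ≡ true → memb S j ≡ true →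
      memb S i ≡ true
  decode-elim t {i} {j} e S S∈ tS j∈ = ⇒-elim {memb S j}
      (⇒-elim {t S} (all-elim {p = λ S → not (t S) ∨ (not (memb S j) ∨ memb S i)} {tubes}
    (trans (cong and (sym (zipWith-map _ t tubes))) (tab-elim e)) S∈) tS) j∈

  decode-intro : ∀ t {i j} → (∀ S → S ∈ tubes → t S ≡ true → memb S j ≡ true → memb S i ≡ true) → at
      (decode (map t tubes)) i j ≡ true
  decode-intro t {i} {j} f = tab-intro (trans (cong and (zipWith-map _ t tubes))
    (all-intro {p = λ S → not (t S) ∨ (not (memb S j) ∨ memb S i)} tubes
        (λ S S∈ → ⇒-intro {t S} (λ tS → ⇒-intro {memb S j} (f S S∈ tS)))))

  lower : Mat n → SubsetB n → Bool
  lower R S = all (λ j → all (λ i → not (memb S j ∧ at R i j) ∨ memb S i) (allFin n)) (allFin n)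

  lower-elim : ∀ R S → lower R S ≡ true → ∀ {i j} → memb S j ≡ true → at R i j ≡ true → memb S i ≡ true
  lower-elim R S e {i} {j} j∈ ij = ⇒-elim {memb S j ∧ at R i j}
      (allFin-elim {p = λ i → not (memb S j ∧ at R i j) ∨ memb S i}
    (allFin-elim {p = λ j → all (λ i → not (memb S j ∧ at R i j) ∨ memb S i) (allFin n)} e j) i) (∧-intro j∈ ij)

  lower-intro : ∀ R S → (∀ {i j} → memb S j ≡ true → at R i j ≡ true → memb S i ≡ true) → lower R S ≡ true
  lower-intro R S f = allFin-intro {p = λ j → all (λ i → not (memb S j ∧ at R i j) ∨ memb S i) (allFin n)} λ j →
    allFin-intro {p = λ i → not (memb S j ∧ at R i j) ∨ memb S i} λ i →
    ⇒-intro {memb S j ∧ at R i j} (λ e → f (proj₁ (∧-elim e)) (proj₂ (∧-elim {memb S j} e)))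

  encode : Mat n → List Bool
  encode R = map (lower R) tubes

  -- Nestedness is required only if one of the two tubes contains a hub: hub-free tubes are single
  -- vertices, equal or else disjoint and non-adjacent.
  module Nested (t : SubsetB n → Bool)
    (nested : ∀ S T → S ∈ tubes → T ∈ tubes → t S ≡ true → t T ≡ true →
              ∀ {h} → hub h ≡ true → memb S h ≡ true ⊎ memb T h ≡ true → S ⊆ T ⊎ T ⊆ S) where

    private
      R : Mat n
      R = decode (map t tubes)

    -- The smallest selected tube around `i`, with the full vertex set as default. Minimality is
    -- relative to `Ts` so that `build` can add one tube at a time.
    record Principal (i : Fin n) (Ts : List (SubsetB n)) : Set where
      field
        S     : SubsetB n
        i∈    : memb S i ≡ true
        conn  : Conn hub S
        kind  : S ≡ fullB n ⊎ (S ∈ tubes × t S ≡ true)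
        least : ∀ T → T ∈ Ts → t T ≡ true → memb T i ≡ true → S ⊆ T
    open Principal

    private
      nested′ : ∀ {i Ts} (P : Principal i Ts) T → T ∈ tubes → t T ≡ true → memb T i ≡ true → S P ⊆ T ⊎ T ⊆ S P
      nested′ P T T∈ tT i∈T with kind P | conn P
      ... | inj₁ e | _ = inj₂ (λ j _ → subst (λ U → memb U j ≡ true) (sym e) (fullB-∈ j))
      ... | inj₂ (S∈ , tS) | inj₁ (h , hubh , h∈) = nested (S P) T S∈ T∈ tS tT hubh (inj₁ h∈)
      -- A one-vertex principal tube is just {i}, contained in every tube around `i`.
      ... | inj₂ _ | inj₂ (k , k∈ , f) = inj₁
          (λ j j∈ → subst (λ l → memb T l ≡ true) (trans (f _ (i∈ P)) (sym (f j j∈))) i∈T)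

      build : ∀ i Ts → (∀ {T} → T ∈ Ts → T ∈ tubes) → Principal i Ts
      build i [] _ = record { S = fullB n ; i∈ = fullB-∈ i ; conn = inj₁ (h₀ , hub-h₀ , fullB-∈ h₀) ; kind = inj₁
          refl ; least = λ _ () }
      build i (T ∷ Ts) sub with build i Ts (sub ∘ there) | true? (t T) | true? (memb T i)
      ... | P | inj₂ tF | _ = record { S = S P ; i∈ = i∈ P ; conn = conn P ; kind = kind P
              ; least = λ { U (here refl) tU → ⊥-elim (true≢false tU tF) ; U (there U∈) → least P U U∈ } }
      ... | P | inj₁ tT | inj₂ iF = record { S = S P ; i∈ = i∈ P ; conn = conn P ; kind = kind P
              ; least = λ { U (here refl) _ i∈U → ⊥-elim (true≢false i∈U iF) ; U (there U∈) → least P U U∈ } }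
      ... | P | inj₁ tT | inj₁ i∈T with nested′ P T (sub (here refl)) tT i∈T
      ...   | inj₁ P⊆T = record { S = S P ; i∈ = i∈ P ; conn = conn P ; kind = kind P
              ; least = λ { U (here refl) _ _ → P⊆T ; U (there U∈) → least P U U∈ } }
      ...   | inj₂ T⊆P = record { S = T ; i∈ = i∈T ; conn = proj₁ (tube-elim (sub (here refl))) ; kind = inj₂
          (sub (here refl) , tT)
              ; least = λ { U (here refl) _ _ j j∈ → j∈ ; U (there U∈) tU i∈U j j∈ → least P U U∈ tU i∈U j
                  (T⊆P j j∈) } }

    principal : ∀ i → Principal i tubes
    principal i = build i tubes id

    below⇒∈ : ∀ {i j} → at R j i ≡ true → memb (S (principal i)) j ≡ true
    below⇒∈ {i} {j} e with kind (principal i)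
    ... | inj₁ eq = subst (λ U → memb U j ≡ true) (sym eq) (fullB-∈ j)
    ... | inj₂ (S∈ , tS) = decode-elim t e (S (principal i)) S∈ tS (i∈ (principal i))

    ∈⇒below : ∀ {i j} → memb (S (principal i)) j ≡ true → at R j i ≡ true
    ∈⇒below {i} {j} j∈ = decode-intro t λ T T∈ tT i∈T → least (principal i) T T∈ tT i∈T j j∈

    private
      comparable : ∀ i j {h} → hub h ≡ true → memb (S (principal i)) h ≡ true →
                   S (principal i) ⊆ S (principal j) ⊎ S (principal j) ⊆ S (principal i)
      comparable i j hubh h∈ with kind (principal i) | kind (principal j)
      ... | inj₁ e | _ = inj₂ (λ k _ → subst (λ U → memb U k ≡ true) (sym e) (fullB-∈ k))
      ... | _ | inj₁ e = inj₁ (λ k _ → subst (λ U → memb U k ≡ true) (sym e) (fullB-∈ k))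
      ... | inj₂ (S∈ , tS) | inj₂ (T∈ , tT) = nested _ _ S∈ T∈ tS tT hubh (inj₁ h∈)

    decode-valid : Valid hub R
    decode-valid .rfl i = decode-intro t λ _ _ _ i∈ → i∈
    decode-valid .trn e f = decode-intro t λ T T∈ tT k∈ → decode-elim t e T T∈ tT (decode-elim t f T T∈ tT k∈)
    decode-valid .iso {i} {j} ¬hi j≤i with conn (principal i)
    ... | inj₁ (h , hubh , h∈) = ⊥-elim (¬hi (high-intro h hubh (∈⇒below h∈)))
    ... | inj₂ (k , _ , f) = trans (f j (below⇒∈ j≤i)) (sym (f i (i∈ (principal i))))
    decode-valid .cmp i j hi with high-elim hi
    ... | h , hubh , h≤i with comparable i j hubh (below⇒∈ h≤i)
    ...   | inj₁ i⊆j = inj₁ (∈⇒below (i⊆j i (i∈ (principal i))))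
    ...   | inj₂ j⊆i = inj₂ (∈⇒below (j⊆i j (i∈ (principal j))))

    t⇒lower : ∀ S → S ∈ tubes → t S ≡ true → lower R S ≡ true
    t⇒lower S S∈ tS = lower-intro R S λ j∈ ij → decode-elim t ij S S∈ tS j∈

    -- A lower tube has a greatest vertex `m` and so equals the principal tube of `m`. That one is
    -- selected, because the default, the full set, is not a proper tube.
    lower⇒t : ∀ S → S ∈ tubes → lower R S ≡ true → t S ≡ true
    lower⇒t U U∈ lo = from-top (conn-top decode-valid U (proj₁ (tube-elim U∈)))
      where
      from-top : (∃ λ m → memb U m ≡ true × (∀ j → memb U j ≡ true → at R j m ≡ true)) → t U ≡ true
      from-top (m , m∈ , f) = conclude (kind (principal m))
        where
        U≡ : U ≡ S (principal m)
        U≡ = ⊆-antisym (λ j j∈ → below⇒∈ (f j j∈)) (λ j j∈ → lower-elim R U lo m∈ (∈⇒below j∈))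
        conclude : S (principal m) ≡ fullB n ⊎ (S (principal m) ∈ tubes × t (S (principal m)) ≡ true) → t U ≡ true
        conclude (inj₂ (_ , tS)) = subst (λ V → t V ≡ true) (sym U≡) tS
        conclude (inj₁ e) with tube-elim U∈
        ... | _ , k , k∉ = ⊥-elim (k∉ (subst (λ V → memb V k ≡ true) (sym (trans U≡ e)) (fullB-∈ k)))

    encode-decode-map : encode R ≡ map t tubes
    encode-decode-map = map-cong∈ tubes (λ S S∈ → bool-ext (lower⇒t S S∈) (t⇒lower S S∈))
      where
      map-cong∈ : ∀ {f g : SubsetB n → Bool} xs → (∀ x → x ∈ xs → f x ≡ g x) → map f xs ≡ map g xs
      map-cong∈ []       e = refl
      map-cong∈ (x ∷ xs) e = cong₂ _∷_ (e x (here refl)) (map-cong∈ xs (λ y → e y ∘ there))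

  module _ {R : Mat n} (v : Valid hub R) where

    down : Fin n → SubsetB n
    down i = setOf (λ j → at R j i)

    down-conn : ∀ i → Conn hub (down i)
    down-conn i with true? (high hub R i)
    ... | inj₁ hi with high-elim hi
    ...   | h , hubh , h≤i = inj₁ (h , hubh , setOf-intro {p = λ j → at R j i} h≤i)
    down-conn i | inj₂ lo = inj₂ (i , setOf-intro {p = λ j → at R j i} (rfl v i)
      , λ j j∈ → iso v (λ hi → true≢false hi lo) (setOf-elim {p = λ j → at R j i} j∈))

    down-lower : ∀ i → lower R (down i) ≡ true
    down-lower i = lower-intro R (down i) λ {k} {j} j∈ kj → setOf-intro {p = λ j → at R j i}
        (trn v kj (setOf-elim {p = λ j → at R j i} j∈))

    -- If `i` is not below `j`, the down-set of `j` is a lower tube containing `j` but not `i`; the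
    -- missing `i` also makes it proper.
    decode-encode : decode (encode R) ≡ R
    decode-encode = ⊑-antisym to λ i j ij → decode-intro (lower R) λ S S∈ lo j∈ → lower-elim R S lo j∈ ij
      where
      to : decode (encode R) ⊑ R
      to i j e with true? (at R i j)
      ... | inj₁ ij = ij
      ... | inj₂ f = setOf-elim {p = λ k → at R k j} (decode-elim (lower R) e (down j)
            (tube-intro {k = i} (down-conn j) (λ i∈ → true≢false (setOf-elim {p = λ k → at R k j} i∈) f))
            (down-lower j) (setOf-intro {p = λ k → at R k j} (rfl v j)))

  -- Opaque because abstracting over a with-expression normalises the types in the context, which for the
  -- decidable equality on ℚ are enormous.
  opaque
    isTight : (Fin n → ℚ) → SubsetB n → Bool
    isTight x S = ⌊ sumOver S x ℚP.≟ ℕtoℚ (3 ^ card S) ⌋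

    power : ∀ S → ℕtoℚ (3 ^ card S) ≡ nat (3 ^ count (memb {n} S))
    power S = trans (ℕtoℚ≡nat (3 ^ card S)) (cong (λ m → nat (3 ^ m)) (card≡count S))

    tight≡isTight : ∀ x → tight n Γ x ≡ map (isTight x) tubes
    tight≡isTight x = refl

    isTight-elim : ∀ x S → isTight x S ≡ true → Σ⟨ memb S ⟩ x ≡ nat (3 ^ count (memb S))
    isTight-elim x S t = trans (sym (sumOver-Σ S x))
        (trans (does-elim {d = sumOver S x ℚP.≟ ℕtoℚ (3 ^ card S)} t) (power S))

    isTight-intro : ∀ x S → Σ⟨ memb S ⟩ x ≡ nat (3 ^ count (memb S)) → isTight x S ≡ true
    isTight-intro x S e = does-intro {d = sumOver S x ℚP.≟ ℕtoℚ (3 ^ card S)}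
        (trans (sumOver-Σ S x) (trans e (sym (power S))))

    count-fullB : count (memb (fullB n)) ≡ n
    count-fullB = trans (count-cong {p = memb (fullB n)} {λ _ → true} fullB-∈) (count-true n)

    InP-total : ∀ x → InP n Γ x → Σ⟨ memb (fullB n) ⟩ x ≡ nat (3 ^ n)
    InP-total x p = trans (sym (sumOver-Σ (fullB n) x)) (trans (proj₁ p) (ℕtoℚ≡nat (3 ^ n)))

    InP-bound : ∀ x → InP n Γ x → ∀ S → S ∈ tubes → nat (3 ^ count (memb S)) ℚ.≤ Σ⟨ memb S ⟩ x
    InP-bound x p S S∈ = subst₂ ℚ._≤_ (power S) (sumOver-Σ S x) (All.lookup (proj₂ p) S∈)

    InP-intro : ∀ x → Σ⟨ memb (fullB n) ⟩ x ≡ nat (3 ^ n) →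
                (∀ S → S ∈ tubes → nat (3 ^ count (memb S)) ℚ.≤ Σ⟨ memb S ⟩ x) → InP n Γ x
    InP-intro x total bound = trans (sumOver-Σ (fullB n) x) (trans total (sym (ℕtoℚ≡nat (3 ^ n)))) ,
      All.tabulate (λ {S} S∈ → subst₂ ℚ._≤_ (sym (power S)) (sym (sumOver-Σ S x)) (bound S S∈))

  module Point {x : Fin n → ℚ} (total : Σ⟨ memb (fullB n) ⟩ x ≡ nat (3 ^ n))
               (tube-bound : ∀ S → S ∈ tubes → nat (3 ^ count (memb S)) ℚ.≤ Σ⟨ memb S ⟩ x) where

    -- Extends the inequalities to the full vertex set, since the union of two tight tubes may be
    -- everything.
    conn-bound : ∀ S → Conn hub S → nat (3 ^ count (memb S)) ℚ.≤ Σ⟨ memb S ⟩ x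
    conn-bound S c with anyFin? (λ k → not (memb S k))
    ... | inj₁ (k , k∉) = tube-bound S (tube-intro {S} {k} c (not-elim k∉))
    ... | inj₂ none = subst (λ U → nat (3 ^ count (memb U)) ℚ.≤ Σ⟨ memb U ⟩ x) (sym S≡)
            (ℚP.≤-reflexive (trans (cong (λ m → nat (3 ^ m)) count-fullB) (sym total)))
      where
      S≡ : S ≡ fullB n
      S≡ = ⊆-antisym (λ i _ → fullB-∈ i) (λ i _ → ∧-not-elim {true} (none i) refl)

    x≥0 : ∀ i → 0ℚ ℚ.≤ x i
    x≥0 i = ℚP.≤-trans (nat-≤ {0} z≤n) (ℚP.≤-trans (conn-bound (singletonB i) singleton)
              (ℚP.≤-reflexive (trans (Σℚ-cong (λ j → cong (λ b → on b (x j)) (lookup∘tabulate (i ==F_) j)))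
                  (Σ⟨⟩-at i x))))
      where
      singleton : Conn hub (singletonB i)
      singleton = inj₂ (i , setOf-intro {p = i ==F_} (==F-refl i) , λ j j∈ → sym
          (==F-elim {i = i} {j} (setOf-elim {p = i ==F_} j∈)))

    -- Otherwise S ∪ T is connected and 3^|S ∪ T| ≤ x(S ∪ T) ≤ x(S) + x(T) = 3^|S| + 3^|T| < 3^|S ∪ T|.
    tight-nested : ∀ S T → S ∈ tubes → T ∈ tubes → isTight x S ≡ true → isTight x T ≡ true →
                   ∀ {h} → hub h ≡ true → memb S h ≡ true ⊎ memb T h ≡ true → S ⊆ T ⊎ T ⊆ S
    tight-nested S T _ _ tS tT {h} hubh h∈ = nest (anyFin? (λ i → memb S i ∧ not (memb T i)))
        (anyFin? (λ i → memb T i ∧ not (memb S i)))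
      where
      p : Fin n → Bool
      p i = memb S i ∨ memb T i
      U = setOf p
      S⊆U : ∀ i → memb S i ≡ true → memb U i ≡ true
      S⊆U i e = setOf-intro {p = p} (∨-introˡ e)
      T⊆U : ∀ i → memb T i ≡ true → memb U i ≡ true
      T⊆U i e = setOf-intro {p = p} (∨-introʳ {memb S i} e)
      chain : nat (3 ^ count (memb U)) ℚ.≤ nat (3 ^ count (memb S) + 3 ^ count (memb T))
      chain = begin
        nat (3 ^ count (memb U))                       ≤⟨ conn-bound U (inj₁ (h , hubh , [ S⊆U h , T⊆U h ]′ h∈)) ⟩
        Σ⟨ memb U ⟩ x                                  ≤⟨ Σℚ-mono
            (λ i → subst (λ b → on b (x i) ℚ.≤ on (memb S i) (x i) ℚ.+ on (memb T i) (x i))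
                                                            (sym (lookup∘tabulate p i)) (on-∨ (memb S i) (memb T i)
                                                                (x≥0 i))) ⟩
        Σℚ (λ i → on (memb S i) (x i) ℚ.+ on (memb T i) (x i))
            ≡⟨ Σℚ-+ (λ i → on (memb S i) (x i)) (λ i → on (memb T i) (x i)) ⟩
        Σ⟨ memb S ⟩ x ℚ.+ Σ⟨ memb T ⟩ x                ≡⟨ cong₂ ℚ._+_ (isTight-elim x S tS) (isTight-elim x T tT) ⟩
        nat (3 ^ count (memb S)) ℚ.+ nat (3 ^ count (memb T)) ≡⟨ sym (nat-+ (3 ^ count (memb S)) (3 ^ count (memb T))) ⟩
        nat (3 ^ count (memb S) + 3 ^ count (memb T)) ∎
        where open ℚP.≤-Reasoning
      nest : (∃ λ a → memb S a ∧ not (memb T a) ≡ true) ⊎ (∀ i → ¬ (memb S i ∧ not (memb T i) ≡ true)) →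
                (∃ λ b → memb T b ∧ not (memb S b) ≡ true) ⊎ (∀ i → ¬ (memb T i ∧ not (memb S i) ≡ true)) → S ⊆ T ⊎
                    T ⊆ S
      nest (inj₂ none) _ = inj₁ (λ i i∈S → ∧-not-elim (none i) i∈S)
      nest (inj₁ _) (inj₂ none) = inj₂ (λ i i∈T →
        ∧-not-elim (none i) i∈T)
      nest (inj₁ (a , ea)) (inj₁ (b , eb)) = ⊥-elim (<⇒≱ (3^-+-<
        (count-strict {p = memb S} {memb U} b S⊆U (T⊆U b (proj₁ (∧-elim eb))) (not-elim (proj₂ (∧-elim {memb T b} eb))))
        (count-strict {p = memb T} {memb U} a T⊆U (S⊆U a (proj₁ (∧-elim ea)))
            (not-elim (proj₂ (∧-elim {memb S a} ea))))) (nat-≤⁻ chain))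

  private
    InP-nested : ∀ x → InP n Γ x → ∀ S T → S ∈ tubes → T ∈ tubes → isTight x S ≡ true → isTight x T ≡ true →
                 ∀ {h} → hub h ≡ true → memb S h ≡ true ⊎ memb T h ≡ true → S ⊆ T ⊎ T ⊆ S
    InP-nested x x∈P = Point.tight-nested (InP-total x x∈P) (InP-bound x x∈P)

  face-valid : ∀ {T} → IsFaceTightSet n Γ T → Valid hub (decode T)
  face-valid (x , x∈P , e) = subst (Valid hub ∘ decode) (trans (sym (tight≡isTight x)) e)
    (Nested.decode-valid (isTight x) (InP-nested x x∈P))

  encode-decode : ∀ {T} → IsFaceTightSet n Γ T → encode (decode T) ≡ T
  encode-decode (x , x∈P , e) = subst (λ T → encode (decode T) ≡ T) (trans (sym (tight≡isTight x)) e)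
    (Nested.encode-decode-map (isTight x) (InP-nested x x∈P))

  module _ {R : Mat n} (v : Valid hub R) where

    private
      x : Fin n → ℚ
      x = Realise.x v

      LowerSet : SubsetB n → Set
      LowerSet S = ∀ {i j} → memb S j ≡ true → at R i j ≡ true → memb S i ≡ true

      hub-lower : ∀ S {h} → hub h ≡ true → memb S h ≡ true → LowerSet S → Σ⟨ memb S ⟩ x ≡ nat (3 ^ count (memb S))
      hub-lower S hubh h∈ lo = trans (Realise.Σ-lower v (memb S) lo) (cong nat (Realise.weight-hub v {memb S} hubh h∈))

      -- Both formulas for `weight` give 3^|S| on a tube: a tube without hubs has one vertex, and 3
      -- * 1 = 3 ^ 1.
      conn-lower : ∀ S → Conn hub S → LowerSet S → Σ⟨ memb S ⟩ x ≡ nat (3 ^ count (memb S))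
      conn-lower S (inj₁ (h , hubh , h∈)) lo = hub-lower S hubh h∈ lo
      conn-lower S (inj₂ (k , k∈ , f)) lo = [ (λ hubk → hub-lower S hubk k∈ lo) , nohub ]′ (true? (hub k))
        where
        one : count (memb S) ≡ 1
        one = trans (count-cong {p = memb S} {k ==F_}
            (λ j → bool-ext (λ j∈ → subst (λ l → (k ==F l) ≡ true) (sym (f j j∈)) (==F-refl k))
                (λ e → subst (λ l → memb S l ≡ true) (==F-elim {i = k} {j} e) k∈))) (count-at k)
        nohub : hub k ≡ false → Σ⟨ memb S ⟩ x ≡ nat (3 ^ count (memb S))
        nohub ¬hubk = trans (Realise.Σ-lower v (memb S) lo) (cong nat (trans
          (Realise.weight-nohub v {memb S}
              (λ h hubh h∈ → true≢false hubh (subst (λ l → hub l ≡ false) (sym (f h h∈)) ¬hubk)))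
          (trans (cong (3 *_) one) (cong (3 ^_) (sym one)))))

      conn-not-lower : ∀ S → Conn hub S → lower R S ≡ false → nat (3 ^ count (memb S)) ℚ.< Σ⟨ memb S ⟩ x
      conn-not-lower S c lo = Realise.Σ-not-lower v S c (λ g → true≢false (lower-intro R S g) lo)

      bounds : ∀ S → S ∈ tubes → nat (3 ^ count (memb S)) ℚ.≤ Σ⟨ memb S ⟩ x
      bounds S S∈ = [ (λ lo → ℚP.≤-reflexive (sym (conn-lower S c (lower-elim R S lo)))) ,
          (λ lo → ℚP.<⇒≤ (conn-not-lower S c lo)) ]′ (true? (lower R S))
        where c = proj₁ (tube-elim S∈)

      isTight≡lower : ∀ Ss → (∀ S → S ∈ Ss → S ∈ tubes) → map (isTight x) Ss ≡ map (lower R) Ss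
      isTight≡lower []       sub = refl
      isTight≡lower (S ∷ Ss) sub = cong₂ _∷_ (bool-ext to from) (isTight≡lower Ss (λ T → sub T ∘ there))
        where
        c = proj₁ (tube-elim (sub S (here refl)))
        to : isTight x S ≡ true → lower R S ≡ true
        to e = [ id , (λ lo → ⊥-elim (ℚP.<-irrefl (sym (isTight-elim x S e)) (conn-not-lower S c lo))) ]′
            (true? (lower R S))
        from : lower R S ≡ true → isTight x S ≡ true
        from lo = isTight-intro x S (conn-lower S c (lower-elim R S lo))

    -- At the point `x` the inequality is an equality for lower tubes and strict for all others, so
    -- its tight tubes are exactly the lower ones.
    encode-face : IsFaceTightSet n Γ (encode R)
    encode-face = x , InP-intro x (trans (hub-lower (fullB n) hub-h₀ (fullB-∈ h₀) (λ {i} _ _ → fullB-∈ i))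
        (cong (λ m → nat (3 ^ m)) count-fullB)) bounds
      , trans (tight≡isTight x) (isTight≡lower tubes (λ _ S∈ → S∈))

  -- Removing relations can only create lower sets, so the smaller face has more tight tubes.
  subB-encode : ∀ {R Q} → R ⊑ Q → subB (encode Q) (encode R) ≡ true
  subB-encode {R} {Q} R⊑Q = go tubes
    where
    go : ∀ Ss → subB (map (lower Q) Ss) (map (lower R) Ss) ≡ true
    go []       = refl
    go (S ∷ Ss) = ∧-intro (⇒-intro (λ lo → lower-intro R S λ j∈ ij → lower-elim Q S lo j∈ (R⊑Q _ _ ij))) (go Ss)

  subB-decode : ∀ {R Q} → subB (encode Q) (encode R) ≡ true → decode (encode R) ⊑ decode (encode Q)
  subB-decode {R} {Q} e i j ij = decode-intro (lower Q) λ S S∈ lo j∈ → decode-elim (lower R) ij S S∈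
      (go tubes e S∈ lo) j∈
    where
    go : ∀ Ss → subB (map (lower Q) Ss) (map (lower R) Ss) ≡ true → ∀ {S} → S ∈ Ss → lower Q S ≡ true → lower R S ≡ true
    go (S ∷ Ss) e (here refl) lo = ⇒-elim (proj₁ (∧-elim e)) lo
    go (S ∷ Ss) e (there S∈)  lo = go Ss (proj₂ (∧-elim {not (lower Q S) ∨ lower R S} e)) S∈ lo

  assocP-model : (E : FaceEnum n Γ) → IsModel hub (assocP n Γ E)
  assocP-model (L , uL , complete , sound) = record
    { unique    = uL
    ; dec       = decode
    ; enc       = encode
    ; dec-valid = λ T∈ → face-valid (sound _ T∈)
    ; enc-∈     = λ v → complete _ (encode-face v)
    ; dec-enc   = decode-encode
    ; enc-dec   = λ T∈ → encode-decode (sound _ T∈)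
    ; ≼⇒⊑       = λ {T} {U} T∈ U∈ e → subst₂ _⊑_ (cong decode (enc-dec′ T∈)) (cong decode (enc-dec′ U∈))
                    (subB-decode {decode T} {decode U}
                        (subst₂ (λ U T → subB U T ≡ true) (sym (enc-dec′ U∈)) (sym (enc-dec′ T∈)) e))
    ; ⊑⇒≼       = λ {T} {U} T∈ U∈ T⊑U → subst₂ (λ U T → subB U T ≡ true) (enc-dec′ U∈) (enc-dec′ T∈)
        (subB-encode {decode T} {decode U} T⊑U)
    }
    where
    enc-dec′ : ∀ {T} → T ∈ L → encode (decode T) ≡ T
    enc-dec′ T∈ = encode-decode (sound _ T∈)

-- The star, the complete graph and the point.

isZero : ∀ {n} → Fin n → Bool
isZero zero    = true
isZero (suc _) = false

isZero-initial : ∀ {n} → HubsInitial (isZero {n})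
isZero-initial {j = suc _} _ ()

star-hub : ∀ m i j → star (suc m) i j ≡ not (i ==F j) ∧ (isZero i ∨ isZero j)
star-hub m i j = cong (not (i ==F j) ∧_) (cong₂ _∨_ (==zero i) (==zero j))
  where
  ==zero : ∀ i → (i ==F zero) ≡ isZero i
  ==zero zero    = refl
  ==zero (suc i) = refl

complete-hub : ∀ m i j → complete (suc m) i j ≡ not (i ==F j) ∧ true
complete-hub m i j with not (i ==F j)
... | true  = refl
... | false = refl

-- The point serves as the permutohedron on no vertices. Its only preorder is empty and has no
-- class, hence sign +1, in agreement with the constant term 1 of Π°.
pointP-model : IsModel {0} allHubs pointP
pointP-model = record
  { unique    = [] ∷ []
  ; dec       = λ _ → []
  ; enc       = λ _ → tt
  ; dec-valid = λ _ → record { rfl = λ () ; trn = λ { {()} } ; iso = λ { {()} } ; cmp = λ () }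
  ; enc-∈     = λ _ → here refl
  ; dec-enc   = λ { {[]} _ → refl }
  ; enc-dec   = λ _ → refl
  ; ≼⇒⊑       = λ _ _ _ ()
  ; ⊑⇒≼       = λ _ _ _ → refl
  }

IsModel-cong : ∀ {n} {hub hub′ : Fin n → Bool} {X} → (∀ i → hub i ≡ hub′ i) → IsModel hub X → IsModel hub′ X
IsModel-cong e m = record
  { unique = unique m ; dec = dec m ; enc = enc m
  ; dec-valid = λ x∈ → Valid-cong e (dec-valid m x∈)
  ; enc-∈ = λ v → enc-∈ m (Valid-cong (sym ∘ e) v)
  ; dec-enc = λ v → dec-enc m (Valid-cong (sym ∘ e) v)
  ; enc-dec = enc-dec m ; ≼⇒⊑ = ≼⇒⊑ m ; ⊑⇒≼ = ⊑⇒≼ m }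

star-admissible : ∀ {n} (M : Vec Colour n) → Admissible isZero (mid ∷ M)
star-admissible M = record { hub≢low = λ _ () ; m₀ = zero ; hub-m₀ = refl }

-- The centre is the only hub: it cannot be low, and if it were top then mid would contain no hub.
-- The colours of the leaves stay free.
star-admissible⁻ : ∀ {n c} {M : Vec Colour n} → Admissible isZero (c ∷ M) → c ≡ mid
star-admissible⁻ {c = low} adm = ⊥-elim (Admissible.hub≢low adm zero refl)
star-admissible⁻ {c = mid} adm = refl
star-admissible⁻ {c = top} adm = ⊥-elim (contra (Admissible.hub-m₀ adm))
  where
  contra : ¬ (false ≡ true)
  contra ()

words₂⁺-admissible : ∀ n {M} → M ∈ words₂⁺ n → Admissible allHubs M
words₂⁺-admissible n {M} M∈ = record { hub≢low = λ i _ → nolow n M∈ i ; m₀ = somemid n M∈ ; hub-m₀ = refl }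
  where
  nolow₂ : ∀ n {M} → M ∈ words₂ n → ¬ Fin (size low M)
  nolow₂ n {M} M∈ i with words-∈ n M∈ (ι low M i)
  ... | e with subst (_∈ (top ∷ mid ∷ [])) (lookup-ι low M i) e
  ...   | here ()
  ...   | there (here ())
  ...   | there (there ())
  nolow : ∀ n {M} → M ∈ words₂⁺ n → ¬ Fin (size low M)
  nolow (suc n) M∈ with ∈-++⁻ (map (top ∷_) (words₂⁺ n)) M∈
  ... | inj₁ p with ∈-map⁻ (top ∷_) p
  ...   | _ , M∈′ , refl = nolow n M∈′
  nolow (suc n) M∈ | inj₂ p with ∈-map⁻ (mid ∷_) p
  ...   | _ , M∈′ , refl = nolow₂ n M∈′
  somemid : ∀ n {M} → M ∈ words₂⁺ n → Fin (size mid M)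
  somemid (suc n) M∈ with ∈-++⁻ (map (top ∷_) (words₂⁺ n)) M∈
  ... | inj₁ p with ∈-map⁻ (top ∷_) p
  ...   | _ , M∈′ , refl = somemid n M∈′
  somemid (suc n) M∈ | inj₂ p with ∈-map⁻ (mid ∷_) p
  ...   | _ , M∈′ , refl = zero

words₂⁺-complete : ∀ {n} (M : Vec Colour n) → ¬ Fin (size low M) → Fin (size mid M) → M ∈ words₂⁺ n
words₂⁺-complete (low ∷ M) nolow _ = ⊥-elim (nolow zero)
words₂⁺-complete (top ∷ M) nolow m = ∈-++⁺ˡ (∈-map⁺ (top ∷_) (words₂⁺-complete M nolow m))
words₂⁺-complete {suc n} (mid ∷ M) nolow m = ∈-++⁺ʳ (map (top ∷_) (words₂⁺ n)) (∈-map⁺ (mid ∷_) (∈-words M colours))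
  where
  colours : ∀ i → Vec.lookup M i ∈ (top ∷ mid ∷ [])
  colours i with Vec.lookup M i in e
  ... | top = here refl
  ... | mid = there (here refl)
  ... | low = ⊥-elim (nolow (proj₁ (ι-surj low M e)))

words₂⁺-unique : ∀ n → Unique (words₂⁺ n)
words₂⁺-unique zero    = []
words₂⁺-unique (suc n) = UniqueP.++⁺ (UniqueP.map⁺ (λ { refl → refl }) (words₂⁺-unique n))
  (UniqueP.map⁺ (λ { refl → refl }) (words-unique (((λ ()) ∷ []) ∷ [] ∷ []) n)) disjoint
  where
  disjoint : ∀ {M} → ¬ (M ∈ map (top ∷_) (words₂⁺ n) × M ∈ map (mid ∷_) (words₂ n))
  disjoint (p , q) with ∈-map⁻ (top ∷_) p | ∈-map⁻ (mid ∷_) q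
  ... | _ , _ , refl | _ , _ , ()

words₂⁺-low : ∀ n {M} → M ∈ words₂⁺ n → size low M ≡ 0
words₂⁺-low n {M} M∈ = empty (size low M) (λ i → Admissible.hub≢low (words₂⁺-admissible n M∈) i refl)
  where
  empty : ∀ k → ¬ Fin k → k ≡ 0
  empty zero    _ = refl
  empty (suc k) f = ⊥-elim (f zero)

star-words-admissible : ∀ {n M} → M ∈ map (mid ∷_) (words₃ n) → Admissible isZero M
star-words-admissible M∈ with ∈-map⁻ (mid ∷_) M∈
... | M , _ , refl = star-admissible M

star-words-complete : ∀ {n M} → Admissible isZero M → M ∈ map (mid ∷_) (words₃ n)
star-words-complete {M = c ∷ M} a with refl ← star-admissible⁻ a = ∈-map⁺ (mid ∷_)
    (∈-words M (λ i → any-colour (Vec.lookup M i)))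
  where
  any-colour : ∀ c → c ∈ (low ∷ top ∷ mid ∷ [])
  any-colour low = here refl
  any-colour top = there (here refl)
  any-colour mid = there (there (here refl))

star-words-model : (S : ℕ → FinPoset) → (∀ m → IsModel {suc m} isZero (S m)) →
                   ∀ {n M} → M ∈ map (mid ∷_) (words₃ n) → IsModel (isZero ∘ ι mid M) (S (size mid (Vec.tail M)))
star-words-model S mS M∈ with ∈-map⁻ (mid ∷_) M∈
... | M , _ , refl = IsModel-cong (λ { zero → refl ; (suc i) → refl }) (mS (size mid M))

×-pointP : ∀ φ → Invariant φ → ∀ X → Unique (elems X) → φ (X ×P pointP) ≡ φ X
×-pointP φ φ-inv X uX = φ-inv _ _ (≅-intro (X ×P pointP) X (UniqueP.cartesianProduct⁺ uX ([] ∷ [])) uX proj₁ (_, tt)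
  (λ { (x , tt) m → proj₁ (∈-cartesianProduct⁻ (elems X) (tt ∷ []) m) }) (λ x m → ∈-cartesianProduct⁺ m (here refl))
  (λ _ _ → refl) (λ _ _ → refl) (λ _ _ _ _ → ∧-identityʳ _))

-- The two identities.

module Theorem (eS : ∀ m → FaceEnum (suc m) (star (suc m))) (eπ : ∀ m → FaceEnum (suc m) (complete (suc m))) where

  open Series eS eπ

  Π : ℕ → FinPoset
  Π zero    = pointP
  Π (suc k) = Perm k

  Πc≡ : ∀ b → Πc b ≡ single (Π b)
  Πc≡ zero    = refl
  Πc≡ (suc b) = refl

  Perm-model : ∀ k → IsModel allHubs (Perm k)
  Perm-model k = Tubes.assocP-model (complete (suc k)) allHubs (complete-hub k) {zero} refl (eπ k)

  Stel-model : ∀ m → IsModel isZero (Stel m)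
  Stel-model m = Tubes.assocP-model (star (suc m)) isZero (star-hub m) {zero} refl (eS m)

  Π-model : ∀ b → IsModel {b} allHubs (Π b)
  Π-model zero    = pointP-model
  Π-model (suc k) = Perm-model k

  module _ (φ : FinPoset → ℤ) (φ-inv : Invariant φ) where

    -- The minus sign in Π° is absorbed by passing from codimension to number of classes, which is
    -- larger by one. The constant term then obeys the same formula.
    evalC-Πoc : ∀ (ψ : FinPoset → ℤ) b → evalC ψ (Πoc b) ≡ sumℤ
        (λ g → sgn (classes (dec (Π-model b) g)) ℤ.* ψ (faceP (Π b) g)) (elems (Π b))
    evalC-Πoc ψ zero    = refl
    evalC-Πoc ψ (suc k) = trans (evalC-scale ψ (ℤ.- ℤ.1ℤ) (interior (Perm k)))
        (trans (cong (ℤ._*_ (ℤ.- ℤ.1ℤ)) (evalC-interior ψ (Perm k)))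
      (trans (sumℤ-* (ℤ.- ℤ.1ℤ) (λ g → sgn (codim (Perm k) g) ℤ.* ψ (faceP (Perm k) g)) (elems (Perm k)))
          (sumℤ-cong (elems (Perm k)) λ g g∈ →
        trans (sym (ℤP.*-assoc (ℤ.- ℤ.1ℤ) (sgn (codim (Perm k) g)) (ψ (faceP (Perm k) g))))
            (cong (ℤ._* ψ (faceP (Perm k) g))
          (trans (ℤP.-1*i≡-i (sgn (codim (Perm k) g)))
              (cong sgn (suc-codim (λ _ _ → refl) {zero} refl (Perm-model k) g∈)))))))

    K : FinPoset → ℕ → ℤ
    K Z b = evalC φ (Πoc b ⊗ single Z)

    K≡ : ∀ Z b → sumℤ (λ g → sgn (classes (dec (Π-model b) g)) ℤ.* φ (faceP (Π b) g ×P Z)) (elems (Π b)) ≡ K Z b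
    K≡ Z b = sym (trans (evalC-⊗-single φ (Πoc b) Z) (evalC-Πoc (λ X → φ (X ×P Z)) b))

    first-identity : ∀ n → evalC φ (Soc n) ≡ evalC φ (rhs1 n)
    first-identity n = begin
      evalC φ (Soc n) ≡⟨ Faces.faces-sum isZero-initial {zero} refl (Stel-model n) Π Π-model
                           (map (mid ∷_) (words₃ n))
                           (UniqueP.map⁺ (λ { refl → refl })
                               (words-unique (((λ ()) ∷ (λ ()) ∷ []) ∷ ((λ ()) ∷ []) ∷ [] ∷ []) n))
                           star-words-admissible star-words-complete Z (star-words-model Stel Stel-model) φ φ-inv ⟩
      sumℤ fibre (map (mid ∷_) (words₃ n)) ≡⟨ sumℤ-map fibre (mid ∷_) (words₃ n) ⟩
      sumℤ (fibre ∘ (mid ∷_)) (words₃ n)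
          ≡⟨ sumℤ-cong (words₃ n) (λ M _ → cong (ℤ._*_ (sgn (size low M))) (K≡ (Stel (size mid M)) (size top M))) ⟩
      sumℤ (λ M → sgn (size low M) ℤ.* K (Stel (size mid M)) (size top M)) (words₃ n)
        ≡⟨ sum-words₃ n (λ a b c → sgn a ℤ.* K (Stel c) b) ⟩
      binomialSum n (λ a r → binomialSum r (λ b c → sgn a ℤ.* K (Stel c) b))
        ≡⟨ sumℤ-cong (upTo (suc n)) (λ a _ → sym (term a)) ⟩
      sumℤ (λ a → evalC φ (outer a)) (upTo (suc n)) ≡⟨ sym (evalC-sumC φ outer (upTo (suc n))) ⟩
      evalC φ (rhs1 n) ∎
      where
      open ≡-Reasoning
      -- The centre is mid too, so c mid leaves give a star on c + 1 vertices, which is `Stel c`;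
      -- hence the shifted index in S(x).
      Z : Vec Colour (suc n) → FinPoset
      Z M = Stel (size mid (Vec.tail M))
      fibre : Vec Colour (suc n) → ℤ
      fibre M = sgn (size low M) ℤ.* sumℤ
          (λ g → sgn (classes (dec (Π-model (size top M)) g)) ℤ.* φ (faceP (Π (size top M)) g ×P Z M))
          (elems (Π (size top M)))
      inner : ℕ → ℕ → Comb
      inner a b = scale (ℤ.+ ((n ∸ a) C b)) (Πoc b ⊗ Sc (n ∸ a ∸ b))
      outer : ℕ → Comb
      outer a = scale (sgn a ℤ.* (ℤ.+ (n C a))) (sumC (map (inner a) (upTo (suc (n ∸ a)))))
      term : ∀ a → evalC φ (outer a) ≡ ℤ.+ (n C a) ℤ.* binomialSum (n ∸ a) (λ b c → sgn a ℤ.* K (Stel c) b)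
      term a = begin
        evalC φ (outer a)
          ≡⟨ evalC-scale φ (sgn a ℤ.* (ℤ.+ (n C a))) (sumC (map (inner a) (upTo (suc (n ∸ a))))) ⟩
        sgn a ℤ.* (ℤ.+ (n C a)) ℤ.* evalC φ (sumC (map (inner a) (upTo (suc (n ∸ a)))))
          ≡⟨ cong₂ ℤ._*_ (ℤP.*-comm (sgn a) (ℤ.+ (n C a))) (evalC-sumC φ (inner a) (upTo (suc (n ∸ a)))) ⟩
        ℤ.+ (n C a) ℤ.* sgn a ℤ.* sumℤ (λ b → evalC φ (inner a b)) (upTo (suc (n ∸ a)))
          ≡⟨ ℤP.*-assoc (ℤ.+ (n C a)) (sgn a) (sumℤ (λ b → evalC φ (inner a b)) (upTo (suc (n ∸ a)))) ⟩
        ℤ.+ (n C a) ℤ.* (sgn a ℤ.* sumℤ (λ b → evalC φ (inner a b)) (upTo (suc (n ∸ a))))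
          ≡⟨ cong (ℤ._*_ (ℤ.+ (n C a))) (trans (sumℤ-* (sgn a) (λ b → evalC φ (inner a b)) (upTo (suc (n ∸ a))))
              (sumℤ-cong (upTo (suc (n ∸ a))) λ b _ →
               trans (cong (ℤ._*_ (sgn a)) (evalC-scale φ (ℤ.+ ((n ∸ a) C b)) (Πoc b ⊗ Sc (n ∸ a ∸ b))))
                     (left-comm (sgn a) (ℤ.+ ((n ∸ a) C b)) (K (Stel (n ∸ a ∸ b)) b)))) ⟩
        ℤ.+ (n C a) ℤ.* binomialSum (n ∸ a) (λ b c → sgn a ℤ.* K (Stel c) b) ∎
        where
        left-comm : ∀ x y z → x ℤ.* (y ℤ.* z) ≡ y ℤ.* (x ℤ.* z)
        left-comm x y z = trans (sym (ℤP.*-assoc x y z)) (trans (cong (ℤ._* z) (ℤP.*-comm x y)) (ℤP.*-assoc y x z))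

    prod2-sum : ∀ n → evalC φ (prod2 n) ≡ binomialSum n (λ b c → K (Π c) b)
    prod2-sum n = trans (evalC-sumC φ (λ b → scale (ℤ.+ (n C b)) (Πoc b ⊗ Πc (n ∸ b))) (upTo (suc n)))
        (sumℤ-cong (upTo (suc n)) λ b _ →
      trans (evalC-scale φ (ℤ.+ (n C b)) (Πoc b ⊗ Πc (n ∸ b)))
          (cong (λ L → ℤ.+ (n C b) ℤ.* evalC φ (Πoc b ⊗ L)) (Πc≡ (n ∸ b))))

    -- This says Π° Π = 1, which turns the first formula for S° into the second.
    second-identity : ∀ n → evalC φ (prod2 n) ≡ evalC φ (unitc n)
    second-identity zero    = trans (prod2-sum 0)
        (trans (ℤP.+-identityʳ (ℤ.1ℤ ℤ.* K pointP 0)) (trans (ℤP.*-identityˡ (K pointP 0))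
      (cong (λ k → ℤ.1ℤ ℤ.* k ℤ.+ ℤ.0ℤ) (×-pointP φ φ-inv pointP ([] ∷ [])))))
    second-identity (suc n) = begin
      evalC φ (prod2 (suc n))                               ≡⟨ prod2-sum (suc n) ⟩
      binomialSum (suc n) (λ b c → K (Π c) b)               ≡⟨ sym (sum-words₂ (suc n) (λ b c → K (Π c) b)) ⟩
      sumℤ (λ M → K (Π (size mid M)) (size top M)) (words₂ (suc n)) ≡⟨ sum-words₂⁺ (suc n) (λ b c → K (Π c) b) ⟩
      K pointP (suc n) ℤ.+ rest                             ≡⟨ cong₂ ℤ._+_ improper (sym interior-rest) ⟩
      ℤ.- evalC φ (interior (Perm n)) ℤ.+ evalC φ (interior (Perm n)) ≡⟨ ℤP.+-inverseˡ (evalC φ (interior (Perm n))) ⟩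
      ℤ.0ℤ ∎
      where
      open ≡-Reasoning
      rest = sumℤ (λ M → K (Π (size mid M)) (size top M)) (words₂⁺ (suc n))
      interior-rest : evalC φ (interior (Perm n)) ≡ rest
      interior-rest = trans (Faces.faces-sum (λ _ _ → refl) {zero} refl (Perm-model n) Π Π-model (words₂⁺ (suc n))
          (words₂⁺-unique (suc n))
          (words₂⁺-admissible (suc n)) (λ {M} a → words₂⁺-complete M (λ i → Admissible.hub≢low a i refl)
              (Admissible.m₀ a))
          (λ M → Π (size mid M)) (λ {M} _ → Π-model (size mid M)) φ φ-inv)
        (sumℤ-cong (words₂⁺ (suc n)) λ M M∈ → trans
            (cong₂ ℤ._*_ (cong sgn (words₂⁺-low (suc n) M∈)) (K≡ (Π (size mid M)) (size top M)))
            (ℤP.*-identityˡ (K (Π (size mid M)) (size top M))))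
      -- The word with every letter `top` has no mid vertex and describes no face; it contributes
      -- the coefficient of Π° times the unit.
      improper : K pointP (suc n) ≡ ℤ.- evalC φ (interior (Perm n))
      improper = begin
        K pointP (suc n) ≡⟨ evalC-⊗-single φ (Πoc (suc n)) pointP ⟩
        evalC (λ X → φ (X ×P pointP)) (scale (ℤ.- ℤ.1ℤ) (interior (Perm n)))
            ≡⟨ evalC-scale (λ X → φ (X ×P pointP)) (ℤ.- ℤ.1ℤ) (interior (Perm n)) ⟩
        ℤ.- ℤ.1ℤ ℤ.* evalC (λ X → φ (X ×P pointP)) (interior (Perm n))
            ≡⟨ ℤP.-1*i≡-i (evalC (λ X → φ (X ×P pointP)) (interior (Perm n))) ⟩
        ℤ.- evalC (λ X → φ (X ×P pointP)) (interior (Perm n))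
            ≡⟨ cong ℤ.-_ (trans (evalC-interior (λ X → φ (X ×P pointP)) (Perm n)) (trans
            (sumℤ-cong (elems (Perm n)) (λ g _ → cong (ℤ._*_ (sgn (codim (Perm n) g)))
                (×-pointP φ φ-inv (faceP (Perm n) g)
                (UniqueP.filter⁺ (T? ∘ (λ f → _≼_ (Perm n) f g)) (unique (Perm-model n))))))
            (sym (evalC-interior φ (Perm n))))) ⟩
        ℤ.- evalC φ (interior (Perm n)) ∎

theorem7p1 : (eS : ∀ m → FaceEnum (suc m) (star (suc m)))
    → (eπ : ∀ m → FaceEnum (suc m) (complete (suc m)))
    → let open Series eS eπ in
    (∀ n → Soc n ≈𝔓 rhs1 n) × (∀ n → prod2 n ≈𝔓 unitc n)
theorem7p1 eS eπ = (λ n φ φ-inv → first-identity φ φ-inv n) , (λ n φ φ-inv → second-identity φ φ-inv n)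
  where open Theorem eS eπ
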